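{- Let $\mathcal E=\{n\ge 5 : W_n\text{ is geodesic Leech}\}$ (with $n$ an integer). Then $$\{5,6,\ldots,13\}\subseteq\mathcal E\subseteq\{5,6,\ldots,40\}.$$
   Context: Graphs are finite, simple, undirected and connected. A geodesic of a graph $G$ is a shortest path between two distinct vertices; a path and its reverse are regarded as the same, but distinct shortest paths with the same endpoints are counted separately. Let $t_{gp}(G)$ be the number of geodesics of $G$. For an edge labeling $f:E(G)\to\{1,2,3,\ldots\}$, the weight of a path is the sum of the labels of its edges. The labeling $f$ is a geodesic Leech labeling if the multiset of the weights of all geodesics of $G$ is exactly $\{1,2,\ldots,t_{gp}(G)\}$, each value occurring once. A graph is geodesic Leech if it admits a geodesic Leech labeling. $W_n$ denotes the wheel on $n$ vertices: a hub joined to every vertex of a cycle of length $n-1$. -}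

module Defs where

open import Data.Fin using (Fin; zero; suc; toℕ)
open import Data.List using (List; []; _∷_; head; last; length; map; reverse; upTo)
open import Data.List.Properties using (reverse-involutive)
open import Data.List.Relation.Binary.Permutation.Propositional using (_↭_)
import Data.List.Relation.Unary.Enumerates.Setoid as Enumerates
open import Data.List.Relation.Unary.Linked using (Linked)
open import Data.List.Relation.Unary.Unique.Propositional using (Unique)
import Data.List.Relation.Unary.Unique.Setoid as UniqueSetoid
open import Data.Maybe using (just)
open import Data.Nat using (ℕ; suc; _+_; _≤_; s≤s)
import Data.Nat.Properties as ℕ
open import Data.Product using (∃; Σ-syntax; _×_; _,_)
open import Data.Sum using (_⊎_; inj₁; inj₂; swap)
open import Level using (0ℓ)
open import Relation.Binary using (Rel; Setoid; Symmetric; Irreflexive; Decidable)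
open import Relation.Binary.Construct.Closure.ReflexiveTransitive using (Star; ε; _◅_)
open import Relation.Binary.PropositionalEquality
  using (_≡_; _≢_; refl; sym; trans; cong)
open import Relation.Nullary using (yes; no)
open import Relation.Nullary.Decidable using (_⊎-dec_; _×-dec_)
open import Relation.Unary using (Pred)

record Graph (n : ℕ) : Set₁ where
  field
    Adj       : Rel (Fin n) 0ℓ
    adj?      : Decidable Adj
    symmetric : Symmetric Adj
    loopless  : Irreflexive _≡_ Adj
    connected : ∀ u v → Star Adj u v

module _ {n : ℕ} (G : Graph n) where
  open Graph G

  -- Paths are given by their vertex sequences.
  record IsPath (u v : Fin n) (vs : List (Fin n)) : Set where
    field
      starts   : head vs ≡ just u
      ends     : last vs ≡ just v
      linked   : Linked Adj vs
      distinct : Unique vs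

  -- `length` counts vertices, one more than the number of edges, so comparing
  -- it compares the numbers of edges.
  record Geodesic : Set where
    field
      source target : Fin n
      vertices      : List (Fin n)
      nontrivial    : source ≢ target
      isPath        : IsPath source target vertices
      shortest      : ∀ ws → IsPath source target ws → length vertices ≤ length ws

  open Geodesic

  -- A geodesic and its reverse are identified.
  _≈ᵍ_ : Rel Geodesic 0ℓ
  p ≈ᵍ q = vertices p ≡ vertices q ⊎ vertices p ≡ reverse (vertices q)

  private
    flip-reverse : ∀ {xs ys : List (Fin n)} → xs ≡ reverse ys → ys ≡ reverse xs
    flip-reverse {ys = ys} refl = sym (reverse-involutive ys)

    ≈ᵍ-sym : Symmetric _≈ᵍ_
    ≈ᵍ-sym (inj₁ e) = inj₁ (sym e)
    ≈ᵍ-sym (inj₂ e) = inj₂ (flip-reverse e)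

    ≈ᵍ-trans : ∀ {p q r} → p ≈ᵍ q → q ≈ᵍ r → p ≈ᵍ r
    ≈ᵍ-trans (inj₁ d) (inj₁ e) = inj₁ (trans d e)
    ≈ᵍ-trans (inj₁ d) (inj₂ e) = inj₂ (trans d e)
    ≈ᵍ-trans (inj₂ d) (inj₁ e) = inj₂ (trans d (cong reverse e))
    ≈ᵍ-trans (inj₂ d) (inj₂ e) =
      inj₁ (trans d (trans (cong reverse e) (reverse-involutive _)))

  geodesicSetoid : Setoid 0ℓ 0ℓ
  geodesicSetoid = record
    { Carrier       = Geodesic
    ; _≈_           = _≈ᵍ_
    ; isEquivalence = record
      { refl  = inj₁ refl
      ; sym   = λ {p q} → ≈ᵍ-sym {p} {q}
      ; trans = λ {p q r} → ≈ᵍ-trans {p} {q} {r}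
      }
    }

  -- A list containing every geodesic exactly once up to reversal. Any two such
  -- lists agree up to reordering and reversal of geodesics, so neither the
  -- number t-gp nor the multiset of weights depends on the list chosen.
  record AllGeodesics : Set where
    field
      geodesics : List Geodesic
      complete  : Enumerates.IsEnumeration geodesicSetoid geodesics
      unique    : UniqueSetoid.Unique geodesicSetoid geodesics

    t-gp : ℕ
    t-gp = length geodesics

  -- An edge is an unordered adjacent pair; the values of `label` at
  -- non-adjacent pairs are never used.
  record EdgeLabeling : Set where
    field
      label       : Fin n → Fin n → ℕ
      undirected  : ∀ {u v} → Adj u v → label u v ≡ label v u
      positive    : ∀ {u v} → Adj u v → 1 ≤ label u v

    weight : List (Fin n) → ℕ
    weight []           = 0
    weight (u ∷ [])     = 0
    weight (u ∷ v ∷ vs) = label u v + weight (v ∷ vs)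

  -- `map suc (upTo t)` is 1 ∷ 2 ∷ … ∷ t ∷ [], and _↭_ is equality of multisets.
  IsGeodesicLeechLabeling : EdgeLabeling → Set
  IsGeodesicLeechLabeling f =
    Σ[ 𝒢 ∈ AllGeodesics ] let open AllGeodesics 𝒢 in
      map (λ p → weight (vertices p)) geodesics ↭ map suc (upTo t-gp)
    where open EdgeLabeling f using (weight)

  IsGeodesicLeech : Set
  IsGeodesicLeech = ∃ IsGeodesicLeechLabeling

-- The cyclic successor relation 0 → 1 → … → m-1 → 0 on Fin m.
Next : ∀ {m} → Rel (Fin m) 0ℓ
Next {m} i j = suc (toℕ i) ≡ toℕ j ⊎ (suc (toℕ i) ≡ m × toℕ j ≡ 0)

CycleAdj : ∀ {m} → Rel (Fin m) 0ℓ
CycleAdj i j = Next i j ⊎ Next j i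

data WheelAdj {m : ℕ} : Rel (Fin (suc m)) 0ℓ where
  hub-rim : ∀ {i} → WheelAdj zero (suc i)
  rim-hub : ∀ {i} → WheelAdj (suc i) zero
  rim-rim : ∀ {i j} → CycleAdj i j → WheelAdj (suc i) (suc j)

private
  next? : ∀ {m} → Decidable (Next {m})
  next? {m} i j =
    (suc (toℕ i) ℕ.≟ toℕ j) ⊎-dec ((suc (toℕ i) ℕ.≟ m) ×-dec (toℕ j ℕ.≟ 0))

  wheelAdj? : ∀ {m} → Decidable (WheelAdj {m})
  wheelAdj? zero    zero    = no λ ()
  wheelAdj? zero    (suc j) = yes hub-rim
  wheelAdj? (suc i) zero    = yes rim-hub
  wheelAdj? (suc i) (suc j) with next? i j ⊎-dec next? j i
  ... | yes a = yes (rim-rim a)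
  ... | no ¬a = no λ { (rim-rim a) → ¬a a }

  wheelAdj-sym : ∀ {m} → Symmetric (WheelAdj {m})
  wheelAdj-sym hub-rim     = rim-hub
  wheelAdj-sym rim-hub     = hub-rim
  wheelAdj-sym (rim-rim a) = rim-rim (swap a)

  next-irrefl : ∀ {m} → 3 ≤ m → Irreflexive _≡_ (Next {m})
  next-irrefl _ refl (inj₁ e) = ℕ.1+n≢n e
  next-irrefl 3≤m {i} refl (inj₂ (e , z))
    with s≤s () ← ℕ.≤-trans 3≤m (ℕ.≤-reflexive (trans (sym e) (cong suc z)))

  wheelAdj-irrefl : ∀ {m} → 3 ≤ m → Irreflexive _≡_ (WheelAdj {m})
  wheelAdj-irrefl 3≤m refl (rim-rim (inj₁ a)) = next-irrefl 3≤m refl a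
  wheelAdj-irrefl 3≤m refl (rim-rim (inj₂ a)) = next-irrefl 3≤m refl a

  wheel-connected : ∀ {m} (u v : Fin (suc m)) → Star WheelAdj u v
  wheel-connected zero    zero    = ε
  wheel-connected zero    (suc j) = hub-rim ◅ ε
  wheel-connected (suc i) zero    = rim-hub ◅ ε
  wheel-connected (suc i) (suc j) = rim-hub ◅ hub-rim ◅ ε

-- The wheel on n vertices: `zero` is the hub, and the remaining n-1 vertices
-- form a cycle, which is a simple graph only from n = 4 on.
W : (n : ℕ) → 4 ≤ n → Graph n
W (suc m) (s≤s 3≤m) = record
  { Adj       = WheelAdj
  ; adj?      = wheelAdj?
  ; symmetric = wheelAdj-sym
  ; loopless  = wheelAdj-irrefl 3≤m
  ; connected = wheel-connected
  }

𝓔 : Pred ℕ 0ℓ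
𝓔 n = Σ[ 5≤n ∈ 5 ≤ n ] IsGeodesicLeech (W n (ℕ.<⇒≤ 5≤n))

⟦_⋯_⟧ : ℕ → ℕ → Pred ℕ 0ℓ
⟦ a ⋯ b ⟧ n = a ≤ n × n ≤ b

-- Suppose that a wheel with m ≥ 40 rim vertices has a geodesic Leech labeling, and
-- let N = m + 1. Give the hub the value 0 and every rim vertex the label of its
-- spoke. If two vertices are not neighbours on the rim, the sum of their values is
-- the weight of a geodesic, so these sums are distinct numbers between 1 and
-- t ≤ N (N + 1) / 2. Thus the N² / 2 sums of pairs are almost uniformly distributed,
-- whereas all but two of the values are at most t / 2, and the sum of two
-- independent variables on [0, t / 2] is never almost uniform on [0, t].
--
-- To make this quantitative, count the vertices whose values lie in the cells of
-- width t / 24. For every range of sums, the number of pairs whose cells force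
-- their sum into the range is at most the length of the range plus m; for N ≥ 41
-- this is a homogeneous quadratic inequality in the cell counts. The system of
-- these inequalities is refuted by a branch-and-bound tree, found by linear
-- programming: each branching compares the number of vertices in an interval of
-- cells with a threshold, and at each leaf a combination of the inequalities,
-- products of the linear facts collected on the way and squares contradicts the
-- nonnegativity of the cell counts.
module Submission where

open import Defs
open import Data.Bool.Base using (Bool; true; false; T; not; _∧_; _∨_; if_then_else_)
open import Data.Bool.Properties using (T-∧; T-∨; T-≡)
open import Data.Empty using (⊥; ⊥-elim)
open import Data.Fin.Base using (Fin; zero; suc; toℕ; fromℕ<)
import Data.Fin.Properties as Fin
open import Data.List.Base as List
  using (List; []; _∷_; [_]; _++_; length; map; reverse; filter; upTo; allFin; concatMap; cartesianProduct)
open import Data.List.Properties using (length-++; length-map; length-upTo; length-tabulate; reverse-involutive)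
open import Data.List.Membership.Propositional using (_∈_; lose)
open import Data.List.Membership.Propositional.Properties
  using ( ∈-++⁺ˡ; ∈-++⁺ʳ; ∈-++⁻; ∈-map⁺; ∈-map⁻; ∈-upTo⁺; ∈-upTo⁻; ∈-allFin; ∈-filter⁻; ∈-concatMap⁺; ∈-∃++)
open import Data.List.Relation.Binary.Permutation.Propositional
  using (_↭_; ↭-sym; ↭-trans; ↭-reflexive; ↭⇒↭ₛ)
open import Data.List.Relation.Binary.Permutation.Propositional.Properties using (∈-resp-↭)
open import Data.List.Relation.Binary.Permutation.Setoid.Properties using (Unique-resp-↭)
open import Data.List.Relation.Unary.All as All using (All; []; _∷_)
import Data.List.Relation.Unary.All.Properties as All
open import Data.List.Relation.Unary.AllPairs as AllPairs using (AllPairs; []; _∷_)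
import Data.List.Relation.Unary.AllPairs.Properties as AllPairs
open import Data.List.Relation.Unary.Any using (Any; here; there)
open import Data.List.Relation.Unary.Linked using ([-]; _∷_)
open import Data.List.Relation.Unary.Unique.Propositional using (Unique)
import Data.List.Relation.Unary.Unique.Propositional.Properties as Unique
open import Data.Maybe.Properties using (just-injective)
open import Data.Nat.Base as ℕ
  using (ℕ; zero; suc; _+_; _*_; _∸_; _⊓_; _⊔_; _≤_; _<_; _≤ᵇ_; _<ᵇ_; _≡ᵇ_; z≤n; s≤s; NonZero)
open import Data.Nat.DivMod using (_/_; _%_; m≡m%n+[m/n]*n; m%n<n; m*n/n≡m; m/n*n≤m; /-monoˡ-≤)
import Data.Nat.Properties as ℕ
open import Data.List.Sort.InsertionSort.Base ℕ.≤-decTotalOrder using (sort)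
open import Data.List.Sort.InsertionSort.Properties ℕ.≤-decTotalOrder using (sort-↭)
open import Data.Nat.Tactic.RingSolver using (solve-∀)
open import Data.Product.Base using (_×_; _,_; proj₁; proj₂; ∃)
open import Data.Sum.Base using (_⊎_; inj₁; inj₂; [_,_]′)
open import Data.Unit.Base using (tt)
open import Function.Base using (_∘_; id; const)
open import Function.Bundles using (Equivalence)
open import Relation.Binary.Bundles using (Setoid)
open import Relation.Binary.Definitions using (tri<; tri≈; tri>)
open import Relation.Binary.PropositionalEquality hiding ([_])
open import Relation.Nullary using (¬_; Dec; yes; no; does)
open import Relation.Nullary.Decidable using (_⊎-dec_; _×-dec_; ¬?; True; toWitness)
open import Relation.Unary using (Decidable; _⊆_)

-- The three certificates come from a case distinction on the largest value. Two vertices whose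
-- values sum to more than t must be rim neighbours. Hence, if a vertex has a value above ct/24,
-- only this vertex and its two neighbours can have values above (24 - c)t/24. The cases are:
-- largest value at most 13t/24, between 13t/24 and 14t/24, and above 14t/24. In each of them two or
-- three vertices remain for the top cells, so the top cells can be kept few or coarse. One finite
-- certificate serves all N ≥ 41 because every inequality is scaled by N². The lower-order terms are
-- the rim neighbours, the diagonal pairs, the rounding of range ends, the difference between t and
-- N²/2, and the exceptional vertices. Each is replaced by its share of N² or N at N = 41, and these
-- shares only shrink as N grows. For the wheels on 5 to 13 vertices explicit labelings are verified
-- by evaluation: the weights of an enumeration of the geodesics are sorted and compared with 1,
-- ..., t. The resulting distinctness of the weights also shows that the enumeration has no
-- repetitions.

private variable
  A B : Set


-- Sums over lists and certificates of quadratic infeasibility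

Σℕ : List A → (A → ℕ) → ℕ
Σℕ []       f = 0
Σℕ (x ∷ xs) f = f x + Σℕ xs f

Σℕ-mono : ∀ (xs : List A) {f g : A → ℕ} → (∀ x → f x ≤ g x) → Σℕ xs f ≤ Σℕ xs g
Σℕ-mono []       le = z≤n
Σℕ-mono (x ∷ xs) le = ℕ.+-mono-≤ (le x) (Σℕ-mono xs le)

Σℕ-cong : ∀ (xs : List A) {f g : A → ℕ} → (∀ x → f x ≡ g x) → Σℕ xs f ≡ Σℕ xs g
Σℕ-cong []       e = refl
Σℕ-cong (x ∷ xs) e = cong₂ _+_ (e x) (Σℕ-cong xs e)

Σℕ-+ : ∀ (xs : List A) (f g : A → ℕ) → Σℕ xs (λ x → f x + g x) ≡ Σℕ xs f + Σℕ xs g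
Σℕ-+ []       f g = refl
Σℕ-+ (x ∷ xs) f g rewrite Σℕ-+ xs f g = lemma (f x) (g x) (Σℕ xs f) (Σℕ xs g)
  where
  lemma : ∀ a b c d → (a + b) + (c + d) ≡ (a + c) + (b + d)
  lemma = solve-∀

Σℕ-*ˡ : ∀ (xs : List A) k (f : A → ℕ) → Σℕ xs (λ x → k * f x) ≡ k * Σℕ xs f
Σℕ-*ˡ []       k f = sym (ℕ.*-zeroʳ k)
Σℕ-*ˡ (x ∷ xs) k f = trans (cong (_+_ (k * f x)) (Σℕ-*ˡ xs k f)) (sym (ℕ.*-distribˡ-+ k (f x) (Σℕ xs f)))

Σℕ-const : ∀ (xs : List A) k → Σℕ xs (λ _ → k) ≡ length xs * k
Σℕ-const []       k = refl
Σℕ-const (x ∷ xs) k = cong (_+_ k) (Σℕ-const xs k)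

Σℕ-map : ∀ (g : A → B) xs (f : B → ℕ) → Σℕ (map g xs) f ≡ Σℕ xs (f ∘ g)
Σℕ-map g []       f = refl
Σℕ-map g (x ∷ xs) f = cong (_+_ (f (g x))) (Σℕ-map g xs f)

Σℕ-++ : ∀ (xs ys : List A) (f : A → ℕ) → Σℕ (xs ++ ys) f ≡ Σℕ xs f + Σℕ ys f
Σℕ-++ []       ys f = refl
Σℕ-++ (x ∷ xs) ys f = trans (cong (_+_ (f x)) (Σℕ-++ xs ys f)) (sym (ℕ.+-assoc (f x) _ _))

Σℕ-cartesianProduct : ∀ (xs : List A) (ys : List B) (f : A × B → ℕ) →
                      Σℕ (cartesianProduct xs ys) f ≡ Σℕ xs (λ x → Σℕ ys (λ y → f (x , y)))
Σℕ-cartesianProduct []       ys f = refl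
Σℕ-cartesianProduct (x ∷ xs) ys f = trans (Σℕ-++ (map (x ,_) ys) _ f)
  (cong₂ _+_ (Σℕ-map (x ,_) ys f) (Σℕ-cartesianProduct xs ys f))

-- Applied to a function of the cells of two points, this is a quadratic form in the cell counts.
-- Summing over points means that the counts themselves never have to be introduced.
Σ² : List A → (A → A → ℕ) → ℕ
Σ² xs f = Σℕ xs (λ x → Σℕ xs (f x))

Σ²-mono : ∀ (xs : List A) {f g} → (∀ x y → f x y ≤ g x y) → Σ² xs f ≤ Σ² xs g
Σ²-mono xs le = Σℕ-mono xs (λ x → Σℕ-mono xs (le x))

Σ²-+ : ∀ (xs : List A) f g → Σ² xs (λ x y → f x y + g x y) ≡ Σ² xs f + Σ² xs g
Σ²-+ xs f g = trans (Σℕ-cong xs (λ x → Σℕ-+ xs (f x) (g x))) (Σℕ-+ xs _ _)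

Σ²-*ˡ : ∀ (xs : List A) k f → Σ² xs (λ x y → k * f x y) ≡ k * Σ² xs f
Σ²-*ˡ xs k f = trans (Σℕ-cong xs (λ x → Σℕ-*ˡ xs k (f x))) (Σℕ-*ˡ xs k _)

Σ²-const : ∀ (xs : List A) k → Σ² xs (λ _ _ → k) ≡ length xs * (length xs * k)
Σ²-const xs k = trans (Σℕ-cong xs (λ _ → Σℕ-const xs k)) (Σℕ-const xs _)

Σ²-left : ∀ (xs : List A) f → Σ² xs (λ x _ → f x) ≡ length xs * Σℕ xs f
Σ²-left xs f = trans (Σℕ-cong xs (λ x → Σℕ-const xs (f x))) (Σℕ-*ˡ xs (length xs) f)

Σ²-right : ∀ (xs : List A) f → Σ² xs (λ _ y → f y) ≡ length xs * Σℕ xs f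
Σ²-right xs f = Σℕ-const xs _

𝟙 : Bool → ℕ
𝟙 true  = 1
𝟙 false = 0

𝟙≤1 : ∀ b → 𝟙 b ≤ 1
𝟙≤1 true  = s≤s z≤n
𝟙≤1 false = z≤n

1≤𝟙 : ∀ {P : Set} (P? : Dec P) → P → 1 ≤ 𝟙 (does P?)
1≤𝟙 (yes _) _ = s≤s z≤n
1≤𝟙 (no ¬p) p = ⊥-elim (¬p p)

𝟙-mono : ∀ {P Q : Set} (P? : Dec P) (Q? : Dec Q) → (P → Q) → 𝟙 (does P?) ≤ 𝟙 (does Q?)
𝟙-mono (yes p) Q? f = 1≤𝟙 Q? (f p)
𝟙-mono (no _)  Q? f = z≤n


Σ²-⊗ : ∀ (xs : List A) f g → Σ² xs (λ x y → f x * g y) ≡ Σℕ xs f * Σℕ xs g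
Σ²-⊗ xs f g = begin
  Σ² xs (λ x y → f x * g y)          ≡⟨ Σℕ-cong xs (λ x → Σℕ-*ˡ xs (f x) g) ⟩
  Σℕ xs (λ x → f x * Σℕ xs g)        ≡⟨ Σℕ-cong xs (λ x → ℕ.*-comm (f x) (Σℕ xs g)) ⟩
  Σℕ xs (λ x → Σℕ xs g * f x)        ≡⟨ Σℕ-*ˡ xs (Σℕ xs g) f ⟩
  Σℕ xs g * Σℕ xs f                  ≡⟨ ℕ.*-comm (Σℕ xs g) (Σℕ xs f) ⟩
  Σℕ xs f * Σℕ xs g                  ∎
  where open ≡-Reasoning

-- A product of two linear forms is written with symmetric coefficients, at the price of a factor 2,
-- so that a certificate need only be inspected on one triangle of the matrix of cells.
Σ²-⊗ˢ : ∀ (xs : List A) f g → Σ² xs (λ x y → f x * g y + f y * g x) ≡ 2 * (Σℕ xs f * Σℕ xs g)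
Σ²-⊗ˢ xs f g = begin
  Σ² xs (λ x y → f x * g y + f y * g x)
    ≡⟨ Σ²-+ xs (λ x y → f x * g y) (λ x y → f y * g x) ⟩
  Σ² xs (λ x y → f x * g y) + Σ² xs (λ x y → f y * g x)
    ≡⟨ cong₂ _+_ (Σ²-⊗ xs f g) (trans (Σℕ-cong xs (λ x → Σℕ-cong xs (λ y → ℕ.*-comm (f y) (g x)))) (Σ²-⊗ xs g f)) ⟩
  F * G + G * F   ≡⟨ lemma F G ⟩
  2 * (F * G)     ∎
  where
  open ≡-Reasoning
  F = Σℕ xs f
  G = Σℕ xs g
  lemma : ∀ F G → F * G + G * F ≡ 2 * (F * G)
  lemma = solve-∀

-- The source of the contradiction at a leaf: valid rows bound one double sum by another, while the
-- coefficients satisfy the strict reverse inequality everywhere.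
Σ²-< : ∀ (xs : List A) {f g} → 1 ≤ length xs → (∀ x y → f x y < g x y) → Σ² xs f < Σ² xs g
Σ²-< (x ∷ xs) {f} {g} _ lt = ℕ.+-mono-<-≤ (row x) (Σℕ-mono xs (λ y → ℕ.<⇒≤ (row y)))
  where
  row : ∀ y → Σℕ (x ∷ xs) (f y) < Σℕ (x ∷ xs) (g y)
  row y = ℕ.+-mono-<-≤ (lt y x) (Σℕ-mono xs (λ z → ℕ.<⇒≤ (lt y z)))

-- This is (b - a)(d - c) ≥ 0 with all negative terms moved to the other side. It justifies the rows
-- that multiply two facts.
rearrangement : ∀ {a b c d} → a ≤ b → c ≤ d → b * c + a * d ≤ b * d + a * c
rearrangement {a} {b} {c} {d} a≤b c≤d with e , refl ← ℕ.m≤n⇒∃[o]m+o≡n a≤b | f , refl ← ℕ.m≤n⇒∃[o]m+o≡n c≤d =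
  ℕ.≤-trans (ℕ.m≤m+n _ (e * f)) (ℕ.≤-reflexive (lemma a c e f))
  where
  lemma : ∀ a c e f → (a + e) * c + a * (c + f) + e * f ≡ (a + e) * (c + f) + a * c
  lemma = solve-∀

-- The square of a difference is nonnegative: `rearrangement` with the same ordered pair taken
-- twice. It justifies the rows that are squares.
2ab≤a²+b² : ∀ a b → 2 * (a * b) ≤ a * a + b * b
2ab≤a²+b² a b with ℕ.≤-total a b
... | inj₁ a≤b = subst₂ _≤_ (lemma b a) (ℕ.+-comm (b * b) (a * a)) (rearrangement a≤b a≤b)
  where
  lemma : ∀ b a → b * a + a * b ≡ 2 * (a * b)
  lemma = solve-∀
... | inj₂ b≤a = subst (_≤ a * a + b * b) (lemma a b) (rearrangement b≤a b≤a)
  where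
  lemma : ∀ a b → a * b + b * a ≡ 2 * (a * b)
  lemma = solve-∀

-- A linear form in the numbers of points per cell: with sign true the cells
-- lo … hi have coefficient a and the others -b, and sign false swaps the signs.
record Linear : Set where
  constructor lin
  field
    lo hi a b : ℕ
    sign      : Bool

-- Positive and negative part of the coefficient of a cell. Keeping them apart lets the whole check
-- run in ℕ, where evaluation is fast and no subtraction can be truncated.
plus minus : Linear → ℕ → ℕ
plus  (lin lo hi a b s) c = if (lo ≤ᵇ c) ∧ (c ≤ᵇ hi) then (if s then a else 0) else (if s then 0 else b)
minus (lin lo hi a b s) c = if (lo ≤ᵇ c) ∧ (c ≤ᵇ hi) then (if s then 0 else a) else (if s then b else 0)

negate : Linear → Linear
negate (lin lo hi a b s) = lin lo hi a b (not s)

-- Nonnegative iff at least k/410 of the points are in the cells lo … hi.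
threshold : ℕ → ℕ → ℕ → Linear
threshold lo hi k = lin lo hi (410 ∸ k) k true

-- Nonnegative iff at most k/41 of the points are in the cells lo … hi.
atMost : ℕ → ℕ → ℕ → Linear
atMost lo hi k = lin lo hi (41 ∸ k) k false

plus-negate : ∀ g c → plus (negate g) c ≡ minus g c
plus-negate (lin lo hi a b s) c with (lo ≤ᵇ c) ∧ (c ≤ᵇ hi) | s
... | true  | true  = refl
... | true  | false = refl
... | false | true  = refl
... | false | false = refl

minus-negate : ∀ g c → minus (negate g) c ≡ plus g c
minus-negate (lin lo hi a b s) c with (lo ≤ᵇ c) ∧ (c ≤ᵇ hi) | s
... | true  | true  = refl
... | true  | false = refl
... | false | true  = refl
... | false | false = refl

-- Every row is a valid inequality `pos ≤ neg` between quadratic forms in the cell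
-- counts: the bound on the sums in a range, the product of a fact with a
-- nonnegative combination of cell counts or with another fact, or the square of
-- ∑ (v c - o) n_c. The number w is a weight.
data Row : Set where
  ran : (w i j : ℕ) → Row
  cel : (w k v : ℕ) → Row
  fac : (w k l : ℕ) → Row
  sqr : (w o v : ℕ) → Row

Leaf : Set
Leaf = List Row

data Tree : Set where
  leaf   : Leaf → Tree
  branch : (lo hi k : ℕ) → Tree → Tree → Tree

-- An index out of range yields the zero form, whose nonnegativity is trivial, so rows are sound
-- whatever indices they carry.
nth : List Linear → ℕ → Linear
nth []       _       = lin 0 0 0 0 true
nth (g ∷ gs) zero    = g
nth (g ∷ gs) (suc n) = nth gs n

-- A vector indexed by cells is stored as a number in base 1000.
entry : ℕ → ℕ → ℕ
entry v zero    = v % 1000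
entry v (suc c) = entry (v / 1000) c

allBelow : ℕ → (ℕ → Bool) → Bool
allBelow zero    p = true
allBelow (suc n) p = p n ∧ allBelow n p

allBelow-sound : ∀ n p → T (allBelow n p) → ∀ {k} → k < n → T (p k)
allBelow-sound (suc n) p t {k} k<1+n with ℕ.m<1+n⇒m<n∨m≡n k<1+n
... | inj₁ k<n  = allBelow-sound n p (proj₂ (Equivalence.to (T-∧ {p n}) t)) k<n
... | inj₂ refl = proj₁ (Equivalence.to T-∧ t)

-- The rounding loss at the lower end of a range: the integer part of i t / τ loses less than 1, and
-- nothing at all when i = 0.
sgn : ℕ → ℕ
sgn zero    = 0
sgn (suc _) = 1

-- The cells 0 … top: in units of t/τ, cell c < top covers the points between c
-- and 1 + c, and cell top those between top and lim.
module Check (τ top lim : ℕ) where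

  hi : ℕ → ℕ
  hi c = if c <ᵇ top then suc c else lim

  -- The sum of points from the cells c and d is forced to lie between i and j.
  inside : ℕ → ℕ → ℕ → ℕ → Bool
  inside i j c d = (i ≤ᵇ c + d) ∧ ((τ ≤ᵇ j) ∨ (hi c + hi d ≤ᵇ j))

  -- The bound #pairs ≤ 2 |range| + 2 m + #diagonal, multiplied by 3362 τ and made
  -- homogeneous by N ≥ 41, as 1722 = 41² + 41 and 3362 = 2 · 41².
  allowance : ℕ → ℕ → ℕ → ℕ → ℕ
  allowance i j c d = (3444 * (j ∸ i) + 4 * τ * (sgn i + 40)) + 41 * τ * (𝟙 (inside i j c c) + 𝟙 (inside i j d d))

  -- The factors 256 and 512 balance the sizes of the weights.
  pos neg : List Linear → Row → ℕ → ℕ → ℕ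
  pos Γ (ran w i j) c d = w * (3362 * τ * 𝟙 (inside i j c d))
  pos Γ (cel w k v) c d = 256 * w * (minus (nth Γ k) c * entry v d + minus (nth Γ k) d * entry v c)
  pos Γ (fac w k l) c d = w * ((plus (nth Γ k) c * minus (nth Γ l) d + plus (nth Γ k) d * minus (nth Γ l) c)
                             + (minus (nth Γ k) c * plus (nth Γ l) d + minus (nth Γ k) d * plus (nth Γ l) c))
  pos Γ (sqr w o v) c d = 512 * w * (o * (entry v c + entry v d))
  neg Γ (ran w i j) c d = w * allowance i j c d
  neg Γ (cel w k v) c d = 256 * w * (plus (nth Γ k) c * entry v d + plus (nth Γ k) d * entry v c)
  neg Γ (fac w k l) c d = w * ((plus (nth Γ k) c * plus (nth Γ l) d + plus (nth Γ k) d * plus (nth Γ l) c)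
                             + (minus (nth Γ k) c * minus (nth Γ l) d + minus (nth Γ k) d * minus (nth Γ l) c))
  neg Γ (sqr w o v) c d = 512 * w * (entry v c * entry v d + o * o)

  total : (Row → ℕ → ℕ → ℕ) → Leaf → ℕ → ℕ → ℕ
  total f []      c d = 0
  total f (r ∷ l) c d = f r c d + total f l c d

  -- All rows are inequalities `pos ≤ neg` between double sums, hence so is their total. If the
  -- total of `neg` is smaller than the total of `pos` in every single coefficient, no nonempty set
  -- of points exists. The matrices are symmetric, so the entries with d ≤ c suffice.
  checkLeaf : List Linear → Leaf → Bool
  checkLeaf Γ l = allBelow (suc top) λ c → allBelow (suc c) λ d → total (neg Γ) l c d <ᵇ total (pos Γ) l c d

  -- The newest fact is put in front: the indices in the rows of a leaf count back from the last
  -- branching, and the facts known before the root come after all branchings.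
  check : List Linear → Tree → Bool
  check Γ (leaf l)              = checkLeaf Γ l
  check Γ (branch lo hi k t₁ t₂) =
    check (threshold lo hi k ∷ Γ) t₁ ∧ check (negate (threshold lo hi k) ∷ Γ) t₂

  record Refutation (Γ : List Linear) : Set where
    field
      tree  : Tree
      valid : check Γ tree ≡ true

  private
    inside-sym : ∀ i j c d → inside i j c d ≡ inside i j d c
    inside-sym i j c d rewrite ℕ.+-comm c d | ℕ.+-comm (hi c) (hi d) = refl

  -- With `neg-sym`, this carries the strict inequality from the inspected triangle d ≤ c to the
  -- cells of an arbitrary ordered pair of points.
  pos-sym : ∀ Γ r c d → pos Γ r c d ≡ pos Γ r d c
  pos-sym Γ (ran w i j) c d = cong (λ b → w * (3362 * τ * 𝟙 b)) (inside-sym i j c d)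
  pos-sym Γ (cel w k v) c d = cong (256 * w *_) (ℕ.+-comm (minus (nth Γ k) c * entry v d) _)
  pos-sym Γ (fac w k l) c d = cong (w *_) (cong₂ _+_ (ℕ.+-comm (plus (nth Γ k) c * _) _) (ℕ.+-comm (minus (nth Γ k) c * _) _))
  pos-sym Γ (sqr w o v) c d = cong (λ s → 512 * w * (o * s)) (ℕ.+-comm (entry v c) (entry v d))

  neg-sym : ∀ Γ r c d → neg Γ r c d ≡ neg Γ r d c
  neg-sym Γ (ran w i j) c d = cong (λ s → w * ((3444 * (j ∸ i) + 4 * τ * (sgn i + 40)) + 41 * τ * s))
    (ℕ.+-comm (𝟙 (inside i j c c)) (𝟙 (inside i j d d)))
  neg-sym Γ (cel w k v) c d = cong (256 * w *_) (ℕ.+-comm (plus (nth Γ k) c * entry v d) _)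
  neg-sym Γ (fac w k l) c d = cong (w *_) (cong₂ _+_ (ℕ.+-comm (plus (nth Γ k) c * _) _) (ℕ.+-comm (minus (nth Γ k) c * _) _))
  neg-sym Γ (sqr w o v) c d = cong (λ s → 512 * w * (s + o * o)) (ℕ.*-comm (entry v c) (entry v d))

  total-sym : ∀ {f} → (∀ r c d → f r c d ≡ f r d c) → ∀ l c d → total f l c d ≡ total f l d c
  total-sym e []      c d = refl
  total-sym e (r ∷ l) c d = cong₂ _+_ (e r c d) (total-sym e l c d)

  -- Soundness of the certificates

  module Sound {A : Set} (xs : List A) (κ : A → ℕ) (κ≤ : ∀ x → κ x ≤ top) (nonempty : 1 ≤ length xs)
    -- The only input that knows about sums of points. The other kinds of rows are consequences of
    -- the linear facts and of arithmetic alone.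
    (ran≤ : ∀ i j → Σ² xs (λ x y → 3362 * τ * 𝟙 (inside i j (κ x) (κ y))) ≤
                    Σ² xs (λ x y → allowance i j (κ x) (κ y))) where

    Holds : Linear → Set
    Holds g = Σℕ xs (minus g ∘ κ) ≤ Σℕ xs (plus g ∘ κ)

    private
      at² : (ℕ → ℕ → ℕ) → A → A → ℕ
      at² f x y = f (κ x) (κ y)

      nth-holds : ∀ {Γ} → All Holds Γ → ∀ k → Holds (nth Γ k)
      nth-holds []       k       = Σℕ-mono xs (λ x → zeros (κ x))
        where
        zeros : ∀ c → minus (lin 0 0 0 0 true) c ≤ plus (lin 0 0 0 0 true) c
        zeros zero    = z≤n
        zeros (suc c) = z≤n
      nth-holds (p ∷ ps) zero    = p
      nth-holds (p ∷ ps) (suc k) = nth-holds ps k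

      weighted : ∀ w {f g : A → A → ℕ} → Σ² xs f ≤ Σ² xs g → Σ² xs (λ x y → w * f x y) ≤ Σ² xs (λ x y → w * g x y)
      weighted w {f} {g} le = subst₂ _≤_ (sym (Σ²-*ˡ xs w f)) (sym (Σ²-*ˡ xs w g)) (ℕ.*-monoʳ-≤ w le)

    -- Each double sum factors into products of single sums. A `cel` row is then a fact multiplied
    -- by a nonnegative number, a `fac` row the product of two nonnegative forms, and a `sqr` row
    -- the square of a form.
    row-sound : ∀ {Γ} → All Holds Γ → ∀ r → Σ² xs (at² (pos Γ r)) ≤ Σ² xs (at² (neg Γ r))
    row-sound     ps (ran w i j) = weighted w (ran≤ i j)
    row-sound {Γ} ps (cel w k v) = weighted (256 * w) (subst₂ _≤_
      (sym (Σ²-⊗ˢ xs (minus (nth Γ k) ∘ κ) (entry v ∘ κ))) (sym (Σ²-⊗ˢ xs (plus (nth Γ k) ∘ κ) (entry v ∘ κ)))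
      (ℕ.*-monoʳ-≤ 2 (ℕ.*-monoˡ-≤ (Σℕ xs (entry v ∘ κ)) (nth-holds ps k))))
    row-sound {Γ} ps (fac w k l) = weighted w (subst₂ _≤_
      (sym (both (plus g) (minus h) (minus g) (plus h))) (sym (both (plus g) (plus h) (minus g) (minus h)))
      (ℕ.*-monoʳ-≤ 2 (rearrangement (nth-holds ps k) (nth-holds ps l))))
      where
      g = nth Γ k
      h = nth Γ l
      Σκ : (ℕ → ℕ) → ℕ
      Σκ f = Σℕ xs (f ∘ κ)
      both : ∀ f₁ g₁ f₂ g₂ → Σ² xs (at² (λ c d → (f₁ c * g₁ d + f₁ d * g₁ c) + (f₂ c * g₂ d + f₂ d * g₂ c))) ≡
                             2 * (Σκ f₁ * Σκ g₁ + Σκ f₂ * Σκ g₂)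
      both f₁ g₁ f₂ g₂ = trans (Σ²-+ xs (at² (λ c d → f₁ c * g₁ d + f₁ d * g₁ c)) (at² (λ c d → f₂ c * g₂ d + f₂ d * g₂ c)))
        (trans (cong₂ _+_ (Σ²-⊗ˢ xs (f₁ ∘ κ) (g₁ ∘ κ)) (Σ²-⊗ˢ xs (f₂ ∘ κ) (g₂ ∘ κ)))
          (sym (ℕ.*-distribˡ-+ 2 (Σκ f₁ * Σκ g₁) (Σκ f₂ * Σκ g₂))))
    -- The form ∑ (v c - o) n_c equals V - n o with n the number of points, and its square is
    -- nonnegative.
    row-sound     ps (sqr w o v) = weighted (512 * w) (subst₂ _≤_ (sym left) (sym right) (2ab≤a²+b² V (n * o)))
      where
      n = length xs
      V = Σℕ xs (entry v ∘ κ)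
      left : Σ² xs (λ x y → o * (entry v (κ x) + entry v (κ y))) ≡ 2 * (V * (n * o))
      left = trans (Σ²-*ˡ xs o (λ x y → entry v (κ x) + entry v (κ y))) (trans (cong (o *_)
        (trans (Σ²-+ xs (λ x _ → entry v (κ x)) (λ _ y → entry v (κ y)))
          (cong₂ _+_ (Σ²-left xs (entry v ∘ κ)) (Σ²-right xs (entry v ∘ κ))))) (lemma o n V))
        where
        lemma : ∀ o n V → o * (n * V + n * V) ≡ 2 * (V * (n * o))
        lemma = solve-∀
      right : Σ² xs (λ x y → entry v (κ x) * entry v (κ y) + o * o) ≡ V * V + n * o * (n * o)
      right = trans (Σ²-+ xs (λ x y → entry v (κ x) * entry v (κ y)) (λ _ _ → o * o))
        (cong₂ _+_ (Σ²-⊗ xs (entry v ∘ κ) (entry v ∘ κ)) (trans (Σ²-const xs (o * o)) (lemma o n)))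
        where
        lemma : ∀ o n → n * (n * (o * o)) ≡ n * o * (n * o)
        lemma = solve-∀

    total-sound : ∀ {Γ} → All Holds Γ → ∀ l → Σ² xs (at² (total (pos Γ) l)) ≤ Σ² xs (at² (total (neg Γ) l))
    total-sound ps []      = ℕ.≤-refl
    total-sound {Γ} ps (r ∷ l) = subst₂ _≤_
      (sym (Σ²-+ xs (at² (pos Γ r)) (at² (total (pos Γ) l)))) (sym (Σ²-+ xs (at² (neg Γ r)) (at² (total (neg Γ) l))))
      (ℕ.+-mono-≤ (row-sound ps r) (total-sound ps l))

    refute-leaf : ∀ {Γ} → All Holds Γ → ∀ l → T (checkLeaf Γ l) → ⊥
    refute-leaf {Γ} ps l t = ℕ.<⇒≱ (Σ²-< xs nonempty λ x y → pointwise (κ≤ x) (κ≤ y)) (total-sound ps l)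
      where
      ordered : ∀ {c d} → c ≤ top → d ≤ c → total (neg Γ) l c d < total (pos Γ) l c d
      ordered {c} c≤top d≤c = ℕ.<ᵇ⇒< _ _ (allBelow-sound (suc c) _ (allBelow-sound (suc top) _ t (s≤s c≤top)) (s≤s d≤c))
      pointwise : ∀ {c d} → c ≤ top → d ≤ top → total (neg Γ) l c d < total (pos Γ) l c d
      pointwise {c} {d} c≤top d≤top with ℕ.≤-total d c
      ... | inj₁ d≤c = ordered c≤top d≤c
      ... | inj₂ c≤d = subst₂ _<_ (total-sym (neg-sym Γ) l d c) (total-sym (pos-sym Γ) l d c) (ordered d≤top c≤d)

    -- The order of ℕ is total, so the threshold form or its negation is nonnegative. Both
    -- alternatives are non-strict and overlap at equality, which keeps all facts closed
    -- inequalities.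
    refute-tree : ∀ {Γ} → All Holds Γ → ∀ t → T (check Γ t) → ⊥
    refute-tree ps (leaf l) ok = refute-leaf ps l ok
    refute-tree {Γ} ps (branch lo hi k t₁ t₂) ok with ℕ.≤-total (Σℕ xs (minus (threshold lo hi k) ∘ κ)) (Σℕ xs (plus (threshold lo hi k) ∘ κ))
    ... | inj₁ le = refute-tree (le ∷ ps) t₁ (proj₁ (Equivalence.to T-∧ ok))
    ... | inj₂ le = refute-tree (subst₂ _≤_ (sym (Σℕ-cong xs (minus-negate g ∘ κ))) (sym (Σℕ-cong xs (plus-negate g ∘ κ))) le ∷ ps) t₂
                      (proj₂ (Equivalence.to (T-∧ {check (g ∷ Γ) t₁}) ok))
      where g = threshold lo hi k

    refute : ∀ {Γ} → All Holds Γ → ¬ Refutation Γ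
    refute ps r = refute-tree ps tree (Equivalence.from T-≡ valid)
      where open Refutation r

-- Geodesics in graphs of diameter two

-- Turns distinctness of the listed weights into the statement that two listed geodesics of equal
-- weight are the same entry.
Unique-map-injective : ∀ {f : A → B} {xs} → Unique (map f xs) →
                       ∀ {x y} → x ∈ xs → y ∈ xs → f x ≡ f y → x ≡ y
Unique-map-injective (_ ∷ _) (here refl) (here refl) _ = refl
Unique-map-injective (p ∷ _) (here refl) (there y∈)  e = ⊥-elim (All.lookup p (∈-map⁺ _ y∈) e)
Unique-map-injective (p ∷ _) (there x∈)  (here refl) e = ⊥-elim (All.lookup p (∈-map⁺ _ x∈) (sym e))
Unique-map-injective (_ ∷ u) (there x∈)  (there y∈)  e = Unique-map-injective u x∈ y∈ e

-- Induction on `xs`: its head is deleted from `ys`, and since the head does not occur again, the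
-- remaining elements survive the deletion.
Unique-length : ∀ {xs ys : List A} → Unique xs → (∀ {x} → x ∈ xs → x ∈ ys) → length xs ≤ length ys
Unique-length {xs = []}     _       _   = z≤n
Unique-length {xs = x ∷ xs} (p ∷ u) sub with ys₁ , ys₂ , refl ← ∈-∃++ (sub (here refl)) = begin
  suc (length xs)               ≤⟨ s≤s (Unique-length u sub′) ⟩
  suc (length (ys₁ ++ ys₂))     ≡⟨ cong suc (length-++ ys₁) ⟩
  suc (length ys₁ + length ys₂) ≡⟨ ℕ.+-suc (length ys₁) (length ys₂) ⟨
  length ys₁ + length (x ∷ ys₂) ≡⟨ length-++ ys₁ ⟨
  length (ys₁ ++ x ∷ ys₂)       ∎
  where
  open ℕ.≤-Reasoning
  sub′ : ∀ {y} → y ∈ xs → y ∈ ys₁ ++ ys₂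
  sub′ y∈ with ∈-++⁻ ys₁ (sub (there y∈))
  ... | inj₁ y∈ys₁         = ∈-++⁺ˡ y∈ys₁
  ... | inj₂ (here refl)   = ⊥-elim (All.lookup p y∈ refl)
  ... | inj₂ (there y∈ys₂) = ∈-++⁺ʳ ys₁ y∈ys₂

-- The relation `R` stands for inequivalence: listed geodesics are distinct up to reversal, which is
-- stronger than being unequal as records.
pigeonhole : ∀ {R : A → A → Set} {f : A → B} {xs ys} → AllPairs R xs →
             (∀ {x y} → R x y → f x ≢ f y) → (∀ x → f x ∈ ys) → length xs ≤ length ys
pigeonhole {f = f} {xs} {ys} u sep f∈ =
  subst (_≤ length ys) (length-map f xs)
    (Unique-length (AllPairs.map⁺ (AllPairs.map sep u)) λ y∈ → let x , _ , e = ∈-map⁻ f y∈ in subst (_∈ ys) (sym e) (f∈ x))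

module _ {n : ℕ} (G : Graph n) where
  open Graph G
  open Geodesic

  edgeGeodesic : ∀ {u v} → Adj u v → Geodesic G
  edgeGeodesic {u} {v} a = record
    { source = u ; target = v ; vertices = u ∷ v ∷ []
    ; nontrivial = λ e → loopless e a
    ; isPath = record
      { starts = refl ; ends = refl ; linked = a ∷ [-]
      ; distinct = ((λ e → loopless e a) ∷ []) ∷ [] ∷ [] }
    ; shortest = λ { [] p → ⊥-elim (case0 p) ; (w ∷ []) p → ⊥-elim (case1 p) ; (_ ∷ _ ∷ _) _ → s≤s (s≤s z≤n) }
    }
    where
    case0 : ¬ IsPath G u v []
    case0 p with () ← IsPath.starts p
    case1 : ∀ {w} → ¬ IsPath G u v (w ∷ [])
    case1 p = loopless (trans (sym (just-injective (IsPath.starts p))) (just-injective (IsPath.ends p))) a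

  viaGeodesic : ∀ {u w v} → u ≢ v → ¬ Adj u v → Adj u w → Adj w v → Geodesic G
  viaGeodesic {u} {w} {v} u≢v ¬a a b = record
    { source = u ; target = v ; vertices = u ∷ w ∷ v ∷ []
    ; nontrivial = u≢v
    ; isPath = record
      { starts = refl ; ends = refl ; linked = a ∷ b ∷ [-]
      ; distinct = ((λ e → loopless e a) ∷ u≢v ∷ []) ∷ ((λ e → loopless e b) ∷ []) ∷ [] ∷ [] }
    ; shortest = λ ws p → short ws p
    }
    where
    short : ∀ ws → IsPath G u v ws → 3 ≤ length ws
    short []              p with () ← IsPath.starts p
    short (x ∷ [])        p = ⊥-elim (u≢v (trans (sym (just-injective (IsPath.starts p))) (just-injective (IsPath.ends p))))
    short (x ∷ y ∷ [])    p with a′ ∷ _ ← IsPath.linked p =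
      ⊥-elim (¬a (subst₂ Adj (just-injective (IsPath.starts p)) (just-injective (IsPath.ends p)) a′))
    short (_ ∷ _ ∷ _ ∷ _) p = s≤s (s≤s (s≤s z≤n))

  data Shape (vs : List (Fin n)) : Set where
    edge : ∀ {u v} → Adj u v → vs ≡ u ∷ v ∷ [] → Shape vs
    via  : ∀ {u w v} → u ≢ v → ¬ Adj u v → Adj u w → Adj w v → vs ≡ u ∷ w ∷ v ∷ [] → Shape vs

  Diameter≤2 : Set
  Diameter≤2 = ∀ {u v} → u ≢ v → ¬ Adj u v → ∃ λ w → Adj u w × Adj w v

  -- A path of three vertices between adjacent ends is longer than the edge, and a path of four or
  -- more vertices is longer than a path through a common neighbour or than the edge. Both
  -- contradict `shortest`.
  shape : Diameter≤2 → (p : Geodesic G) → Shape (vertices p)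
  shape diam p = go (vertices p) (isPath p) (shortest p)
    where
    u = source p
    v = target p
    go : ∀ vs → IsPath G u v vs → (∀ ws → IsPath G u v ws → length vs ≤ length ws) → Shape vs
    go []       q _ with () ← IsPath.starts q
    go (x ∷ []) q _ = ⊥-elim (nontrivial p (trans (sym (just-injective (IsPath.starts q))) (just-injective (IsPath.ends q))))
    go (x ∷ y ∷ []) q _ with a ∷ _ ← IsPath.linked q = edge a refl
    go (x ∷ w ∷ y ∷ []) q s with a ∷ b ∷ _ ← IsPath.linked q with adj? u v
    ... | yes c with s≤s (s≤s ()) ← s _ (isPath (edgeGeodesic c))
    ... | no ¬c with refl ← IsPath.starts q | refl ← IsPath.ends q = via (nontrivial p) ¬c a b refl
    go (x ∷ y ∷ z ∷ w ∷ vs) q s with adj? u v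
    ... | yes c with s≤s (s≤s ()) ← s _ (isPath (edgeGeodesic c))
    ... | no ¬c with _ , a , b ← diam (nontrivial p) ¬c
                with s≤s (s≤s (s≤s ())) ← s _ (isPath (viaGeodesic (nontrivial p) ¬c a b))

  module _ (diam : Diameter≤2) (f : EdgeLabeling G) where
    open EdgeLabeling f

    -- A labeling is symmetric only on adjacent pairs, so the claim is made for geodesics, whose
    -- consecutive vertices are known from their shape, and not for arbitrary lists.
    weight-reverse : ∀ p → weight (reverse (vertices p)) ≡ weight (vertices p)
    weight-reverse p with vertices p | shape diam p
    ... | _ | edge a refl = cong (_+ 0) (undirected (symmetric a))
    ... | _ | via {u} {w} {v} _ _ a b refl = begin
      label v w + (label w u + 0) ≡⟨ cong₂ (λ k l → k + (l + 0)) (undirected (symmetric b)) (undirected (symmetric a)) ⟩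
      label w v + (label u w + 0) ≡⟨ lemma (label w v) (label u w) ⟩
      label u w + (label w v + 0) ∎
      where
      open ≡-Reasoning
      lemma : ∀ k l → k + (l + 0) ≡ l + (k + 0)
      lemma = solve-∀

    weight-≈ : ∀ p q → _≈ᵍ_ G p q → weight (vertices p) ≡ weight (vertices q)
    weight-≈ p q (inj₁ e) = cong weight e
    weight-≈ p q (inj₂ e) = trans (cong weight e) (weight-reverse q)

    module Leech (leech : IsGeodesicLeechLabeling G f) where
      open AllGeodesics (proj₁ leech) public

      private
        weights : List ℕ
        weights = map (λ p → weight (vertices p)) geodesics

        weights-unique : Unique weights
        weights-unique = Unique-resp-↭ (setoid ℕ) (↭⇒↭ₛ (↭-sym (proj₂ leech)))
          (Unique.map⁺ ℕ.suc-injective (Unique.upTo⁺ t-gp))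

        -- The list contains each geodesic in one orientation only. Any other geodesic is compared
        -- with a listed one, which has the same weight by `weight-≈`.
        representative : ∀ p → ∃ λ q → q ∈ geodesics × _≈ᵍ_ G p q
        representative p = find (complete p)
          where
          find : ∀ {qs} → Any (_≈ᵍ_ G p) qs → ∃ λ q → q ∈ qs × _≈ᵍ_ G p q
          find (here e)  = _ , here refl , e
          find (there i) with q , q∈ , e ← find i = q , there q∈ , e

      weight-range : ∀ p → 1 ≤ weight (vertices p) × weight (vertices p) ≤ t-gp
      weight-range p with q , q∈ , e ← representative p
        with k , k∈ , w≡ ← ∈-map⁻ suc (∈-resp-↭ (proj₂ leech) (∈-map⁺ (λ p → weight (vertices p)) q∈))
        rewrite trans (weight-≈ p q e) w≡ = s≤s z≤n , ∈-upTo⁻ k∈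

      -- The representatives of both geodesics have equal weights, hence coincide because the listed
      -- weights are distinct; the two geodesics are then equivalent through this common entry.
      weight-injective : ∀ p q → weight (vertices p) ≡ weight (vertices q) → _≈ᵍ_ G p q
      weight-injective p q e with p′ , p′∈ , ep ← representative p | q′ , q′∈ , eq ← representative q
        with refl ← Unique-map-injective weights-unique p′∈ q′∈ (trans (sym (weight-≈ p p′ ep)) (trans e (weight-≈ q q′ eq)))
        = trans-≈ {p} {p′} {q} ep (sym-≈ {q} {p′} eq)
        where open Setoid (geodesicSetoid G) using () renaming (sym to sym-≈; trans to trans-≈)

-- Geodesics of wheels

Next-functional : ∀ {m} {i j k : Fin m} → Next i j → Next i k → j ≡ k
Next-functional (inj₁ d)       (inj₁ e)       = Fin.toℕ-injective (trans (sym d) e)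
Next-functional {j = j} (inj₁ d) (inj₂ (e , _)) = ⊥-elim (ℕ.<-irrefl (trans (sym d) e) (Fin.toℕ<n j))
Next-functional {k = k} (inj₂ (d , _)) (inj₁ e) = ⊥-elim (ℕ.<-irrefl (trans (sym e) d) (Fin.toℕ<n k))
Next-functional (inj₂ (_ , d)) (inj₂ (_ , e)) = Fin.toℕ-injective (trans d (sym e))

Next-injective : ∀ {m} {i j k : Fin m} → Next i k → Next j k → i ≡ j
Next-injective (inj₁ d)       (inj₁ e)       = Fin.toℕ-injective (ℕ.suc-injective (trans d (sym e)))
Next-injective (inj₁ d)       (inj₂ (_ , e)) with () ← trans d e
Next-injective (inj₂ (_ , d)) (inj₁ e)       with () ← trans e d
Next-injective (inj₂ (d , _)) (inj₂ (e , _)) = Fin.toℕ-injective (ℕ.suc-injective (trans d (sym e)))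

-- Names for geodesics up to reversal: a spoke by its rim end, a rim edge by its first vertex in
-- cyclic order, a path of two rim edges by its middle vertex, and a path through the hub by the
-- positions of its ends, the smaller one first.
data Code (m : ℕ) : Set where
  spoke rim arc : Fin m → Code m
  hub           : ℕ × ℕ → Code m

-- The pairs i, j with i + 1 < j. For m ≥ 3 they include the pair 0, m - 1, which is adjacent around
-- the rim, so the list has one entry too many. As it serves for an upper bound this is harmless,
-- and it makes the total number of codes a triangular number.
distantPairs : ℕ → List (ℕ × ℕ)
distantPairs zero    = []
distantPairs (suc j) = map (_, j) (upTo (j ∸ 1)) ++ distantPairs j

codes : ∀ m → List (Code m)
codes m = map spoke (allFin m) ++ map rim (allFin m) ++ map arc (allFin m) ++ map hub (distantPairs m)

∈-distantPairs : ∀ {m i j} → suc i < j → j < m → (i , j) ∈ distantPairs m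
∈-distantPairs {suc m} {i} {j} i+1<j j<1+m with ℕ.m<1+n⇒m<n∨m≡n j<1+m
... | inj₁ j<m  = ∈-++⁺ʳ (map (_, m) (upTo (m ∸ 1))) (∈-distantPairs i+1<j j<m)
... | inj₂ refl with s≤s i<j-1 ← i+1<j = ∈-++⁺ˡ (∈-map⁺ (_, m) (∈-upTo⁺ i<j-1))

-- The count m (m - 1) / 2, doubled and with the subtraction moved across; a new last position adds
-- m pairs.
length-distantPairs : ∀ m → 2 * length (distantPairs (suc m)) + m ≡ m * m
length-distantPairs zero    = refl
length-distantPairs (suc m) rewrite length-++ (map {B = ℕ × ℕ} (_, suc m) (upTo m)) {distantPairs (suc m)}
  | length-map {B = ℕ × ℕ} (_, suc m) (upTo m) | length-upTo m = begin
  2 * (m + length ps) + suc m        ≡⟨ lemma₁ m (length ps) ⟩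
  (2 * length ps + m) + (2 * m + 1)  ≡⟨ cong (_+ (2 * m + 1)) (length-distantPairs m) ⟩
  m * m + (2 * m + 1)                ≡⟨ lemma₂ m ⟩
  suc m * suc m                      ∎
  where
  open ≡-Reasoning
  ps = distantPairs (suc m)
  lemma₁ : ∀ m l → 2 * (m + l) + suc m ≡ (2 * l + m) + (2 * m + 1)
  lemma₁ = solve-∀
  lemma₂ : ∀ m → m * m + (2 * m + 1) ≡ suc m * suc m
  lemma₂ = solve-∀

-- In terms of the number N of vertices of the wheel, here 2 + m, there are N (N + 1) / 2 codes.
-- This exact value is what the estimates use for t.
length-codes : ∀ m → 2 * length (codes (suc m)) ≡ (2 + m) * (2 + m) + (2 + m)
length-codes m = begin
  2 * length (codes (suc m))                           ≡⟨ cong (2 *_) len ⟩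
  2 * (suc m + (suc m + (suc m + l)))                  ≡⟨ lemma₁ m l ⟩
  (2 * l + m) + (5 * m + 6)                            ≡⟨ cong (_+ (5 * m + 6)) (length-distantPairs m) ⟩
  m * m + (5 * m + 6)                                  ≡⟨ lemma₂ m ⟩
  (2 + m) * (2 + m) + (2 + m)                          ∎
  where
  open ≡-Reasoning
  l = length (distantPairs (suc m))
  fins : ∀ (c : Fin (suc m) → Code (suc m)) → length (map c (allFin (suc m))) ≡ suc m
  fins c = trans (length-map c (allFin (suc m))) (length-tabulate {n = suc m} id)
  len : length (codes (suc m)) ≡ suc m + (suc m + (suc m + l))
  len = trans (length-++ (map spoke (allFin (suc m)))) (cong₂ _+_ (fins spoke)
       (trans (length-++ (map rim (allFin (suc m)))) (cong₂ _+_ (fins rim)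
       (trans (length-++ (map arc (allFin (suc m)))) (cong₂ _+_ (fins arc)
         (length-map hub (distantPairs (suc m))))))))
  lemma₁ : ∀ m l → 2 * (suc m + (suc m + (suc m + l))) ≡ (2 * l + m) + (5 * m + 6)
  lemma₁ = solve-∀
  lemma₂ : ∀ m → m * m + (5 * m + 6) ≡ (2 + m) * (2 + m) + (2 + m)
  lemma₂ = solve-∀

module Wheel (m : ℕ) (3≤m : 3 ≤ m) where

  G : Graph (suc m)
  G = W (suc m) (s≤s 3≤m)

  open Graph G
  open Geodesic

  diam : Diameter≤2 G
  diam {zero}  {zero}  u≢v ¬a = ⊥-elim (u≢v refl)
  diam {zero}  {suc v} u≢v ¬a = ⊥-elim (¬a hub-rim)
  diam {suc u} {zero}  u≢v ¬a = ⊥-elim (¬a rim-hub)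
  diam {suc u} {suc v} u≢v ¬a = zero , rim-hub , hub-rim

  -- Fixes one orientation per geodesic: spokes start at the hub and rim paths run in the cyclic
  -- direction. For paths through the hub the code records the order of the ends.
  data Encodes : Code m → List (Fin (suc m)) → Set where
    spoke : ∀ {i} → Encodes (spoke i) (zero ∷ suc i ∷ [])
    rim   : ∀ {i j} → Next i j → Encodes (rim i) (suc i ∷ suc j ∷ [])
    arc   : ∀ {i k j} → Next i k → Next k j → Encodes (arc k) (suc i ∷ suc k ∷ suc j ∷ [])
    hub   : ∀ {i j} → Encodes (hub (toℕ i , toℕ j)) (suc i ∷ zero ∷ suc j ∷ [])

  Encodes-functional : ∀ {c d vs ws} → Encodes c vs → Encodes d ws → c ≡ d → vs ≡ ws
  Encodes-functional spoke     spoke     refl = refl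
  Encodes-functional (rim p)   (rim q)   refl with refl ← Next-functional p q = refl
  Encodes-functional (arc p q) (arc r s) refl with refl ← Next-injective p r | refl ← Next-functional q s = refl
  Encodes-functional (hub {i} {j}) (hub {i′} {j′}) e = go i i′ j j′ e
    where
    go : ∀ i i′ j j′ → hub {m} (toℕ i , toℕ j) ≡ hub (toℕ i′ , toℕ j′) →
         _≡_ {A = List (Fin (suc m))} (suc i ∷ zero ∷ suc j ∷ []) (suc i′ ∷ zero ∷ suc j′ ∷ [])
    -- An equation between codes of hub paths cannot be matched while its indices are applications
    -- of `toℕ`. Once two of them are replaced by variables, it yields equalities of positions, and
    -- injectivity of `toℕ` gives equal ends.
    go i i′ j j′ e with toℕ i in p | toℕ j in q
    go i i′ j j′ refl | _ | _ with refl ← Fin.toℕ-injective p | refl ← Fin.toℕ-injective q = refl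

  record Encoding (vs : List (Fin (suc m))) : Set where
    field
      code       : Code m
      canonical  : List (Fin (suc m))
      encodes    : Encodes code canonical
      upToReverse : vs ≡ canonical ⊎ vs ≡ reverse canonical
      listed     : code ∈ codes m

  private
    spoke∈ : ∀ i → spoke i ∈ codes m
    spoke∈ i = ∈-++⁺ˡ (∈-map⁺ spoke (∈-allFin i))
    rim∈ : ∀ i → rim i ∈ codes m
    rim∈ i = ∈-++⁺ʳ (map spoke (allFin m)) (∈-++⁺ˡ (∈-map⁺ rim (∈-allFin i)))
    arc∈ : ∀ i → arc i ∈ codes m
    arc∈ i = ∈-++⁺ʳ (map spoke (allFin m)) (∈-++⁺ʳ (map rim (allFin m)) (∈-++⁺ˡ (∈-map⁺ arc (∈-allFin i))))
    hub∈ : ∀ {i j : Fin m} → suc (toℕ i) < toℕ j → hub (toℕ i , toℕ j) ∈ codes m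
    hub∈ {j = j} lt = ∈-++⁺ʳ (map spoke (allFin m)) (∈-++⁺ʳ (map rim (allFin m)) (∈-++⁺ʳ (map arc (allFin m))
      (∈-map⁺ hub (∈-distantPairs lt (Fin.toℕ<n j)))))

  -- With a middle vertex on the rim, both steps go in the same cyclic direction, for turning back
  -- would return to the start. A hub at either end would be adjacent to the other end.
  encoding : ∀ {vs} → Shape G vs → Encoding vs
  encoding (edge (hub-rim {i}) refl) = record
    { encodes = spoke ; upToReverse = inj₁ refl ; listed = spoke∈ i }
  encoding (edge (rim-hub {i}) refl) = record
    { encodes = spoke ; upToReverse = inj₂ refl ; listed = spoke∈ i }
  encoding (edge (rim-rim {i} (inj₁ a)) refl) = record
    { encodes = rim a ; upToReverse = inj₁ refl ; listed = rim∈ i }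
  encoding (edge (rim-rim {j = j} (inj₂ a)) refl) = record
    { encodes = rim a ; upToReverse = inj₂ refl ; listed = rim∈ j }
  encoding (via u≢v ¬a hub-rim rim-hub refl)         = ⊥-elim (u≢v refl)
  encoding (via u≢v ¬a hub-rim (rim-rim _) refl)     = ⊥-elim (¬a hub-rim)
  encoding (via u≢v ¬a (rim-rim _) rim-hub refl)     = ⊥-elim (¬a rim-hub)
  encoding (via u≢v ¬a (rim-rim (inj₁ a)) (rim-rim (inj₁ b)) refl) = record
    { encodes = arc a b ; upToReverse = inj₁ refl ; listed = arc∈ _ }
  encoding (via u≢v ¬a (rim-rim (inj₁ a)) (rim-rim (inj₂ b)) refl) =
    ⊥-elim (u≢v (cong suc (Next-injective a b)))
  encoding (via u≢v ¬a (rim-rim (inj₂ a)) (rim-rim (inj₁ b)) refl) =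
    ⊥-elim (u≢v (cong suc (Next-functional a b)))
  encoding (via u≢v ¬a (rim-rim (inj₂ a)) (rim-rim (inj₂ b)) refl) = record
    { encodes = arc b a ; upToReverse = inj₂ refl ; listed = arc∈ _ }
  -- The ends are sorted by position. Among non-adjacent ends the positions differ by more than one,
  -- which is exactly membership in `distantPairs`.
  encoding (via u≢v ¬a (rim-hub {i}) (hub-rim {j}) refl) with ℕ.<-cmp (toℕ i) (toℕ j)
  ... | tri≈ _ e _ = ⊥-elim (u≢v (cong suc (Fin.toℕ-injective e)))
  ... | tri< lt _ _ = record
    { encodes = hub ; upToReverse = inj₁ refl
    ; listed = hub∈ (ℕ.≤∧≢⇒< lt (λ e → ¬a (rim-rim (inj₁ (inj₁ e))))) }
  ... | tri> _ _ gt = record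
    { encodes = hub ; upToReverse = inj₂ refl
    ; listed = hub∈ (ℕ.≤∧≢⇒< gt (λ e → ¬a (rim-rim (inj₂ (inj₁ e))))) }

  code-≈ : ∀ p q (c : Encoding (vertices p)) (d : Encoding (vertices q)) →
           Encoding.code c ≡ Encoding.code d → _≈ᵍ_ G p q
  code-≈ p q c d e with Encodes-functional (Encoding.encodes c) (Encoding.encodes d) e
  ... | eq with Encoding.upToReverse c | Encoding.upToReverse d
  ... | inj₁ r | inj₁ s = inj₁ (trans r (trans eq (sym s)))
  ... | inj₁ r | inj₂ s = inj₂ (trans r (trans eq (sym (trans (cong reverse s) (reverse-involutive _)))))
  ... | inj₂ r | inj₁ s = inj₂ (trans r (cong reverse (trans eq (sym s))))
  ... | inj₂ r | inj₂ s = inj₁ (trans r (trans (cong reverse eq) (sym s)))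

  -- Sending a geodesic to its code is injective up to reversal, so inequivalent geodesics occupy
  -- different entries of the list of codes.
  t-gp-bound : (𝒢 : AllGeodesics G) → AllGeodesics.t-gp 𝒢 ≤ length (codes m)
  t-gp-bound 𝒢 = pigeonhole {f = λ p → Encoding.code (enc p)} (AllGeodesics.unique 𝒢)
    (λ {p} {q} p≉q e → p≉q (code-≈ p q (enc p) (enc q) e)) (λ p → Encoding.listed (enc p))
    where
    enc : ∀ p → Encoding (vertices p)
    enc p = encoding (shape G diam p)

-- Counting sums of points

module Count {P : A → Set} (P? : Decidable P) where

  count : List A → ℕ
  count xs = Σℕ xs (λ x → 𝟙 (does (P? x)))

  count≡length-filter : ∀ xs → count xs ≡ length (filter P? xs)
  count≡length-filter []       = refl
  count≡length-filter (x ∷ xs) with does (P? x)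
  ... | true  = cong suc (count≡length-filter xs)
  ... | false = count≡length-filter xs

  count-≤ : ∀ {xs} → Unique xs → (f : A → B) (ys : List B) →
            (∀ {x y} → P x → P y → f x ≡ f y → x ≡ y) → (∀ {x} → P x → f x ∈ ys) → count xs ≤ length ys
  count-≤ {xs = xs} u f ys inj f∈ = begin
    count xs                       ≡⟨ count≡length-filter xs ⟩
    length (filter P? xs)          ≡⟨ length-map f (filter P? xs) ⟨
    length (map f (filter P? xs))  ≤⟨ Unique-length (unique (Unique.filter⁺ P? u) (All.all-filter P? xs)) sub ⟩
    length ys                      ∎
    where
    open ℕ.≤-Reasoning
    distinct : ∀ {x zs} → P x → All (x ≢_) zs → All P zs → All (f x ≢_) (map f zs)
    distinct px []       []         = []
    distinct px (n ∷ ns) (pz ∷ pzs) = (λ e → n (inj px pz e)) ∷ distinct px ns pzs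
    unique : ∀ {zs} → Unique zs → All P zs → Unique (map f zs)
    unique []       []         = []
    unique (p ∷ ps) (pz ∷ pzs) = distinct pz p pzs ∷ unique ps pzs
    sub : ∀ {y} → y ∈ map f (filter P? xs) → y ∈ ys
    sub y∈ with x , x∈ , refl ← ∈-map⁻ f y∈ = f∈ (proj₂ (∈-filter⁻ P? {xs = xs} x∈))

  count-≤1 : ∀ {xs} → Unique xs → (∀ {x y} → P x → P y → x ≡ y) → count xs ≤ 1
  count-≤1 u one = count-≤ u (const tt) (tt ∷ []) (λ p q _ → one p q) (λ _ → here refl)

open Count

-- Adjacency along the rim

next? : ∀ {m} (i j : Fin m) → Dec (Next i j)
next? {m} i j = (suc (toℕ i) ℕ.≟ toℕ j) ⊎-dec ((suc (toℕ i) ℕ.≟ m) ×-dec (toℕ j ℕ.≟ 0))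

-- Three successor steps that close up pass from the last position to 0. Without such a passage the
-- positions increase forever, one passage forces m = 3, and two force m = 1.
Next-triangle : ∀ {m} {i j k : Fin m} → 4 ≤ m → Next i j → Next j k → ¬ Next k i
Next-triangle 4≤m (inj₁ a) (inj₁ b) (inj₁ c) =
  ℕ.<-irrefl refl (ℕ.<-trans (ℕ.≤-reflexive a) (ℕ.<-trans (ℕ.≤-reflexive b) (ℕ.≤-reflexive c)))
Next-triangle 4≤m (inj₁ a) (inj₁ b) (inj₂ (c , z))
  with s≤s (s≤s (s≤s ())) ← subst (4 ≤_) (trans (sym c) (cong suc (trans (sym b) (cong suc (trans (sym a) (cong suc z)))))) 4≤m
Next-triangle 4≤m (inj₁ a) (inj₂ (b , z)) (inj₁ c)
  with s≤s (s≤s (s≤s ())) ← subst (4 ≤_) (trans (sym b) (cong suc (trans (sym a) (cong suc (trans (sym c) (cong suc z)))))) 4≤m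
Next-triangle 4≤m (inj₂ (a , z)) (inj₁ b) (inj₁ c)
  with s≤s (s≤s (s≤s ())) ← subst (4 ≤_) (trans (sym a) (cong suc (trans (sym c) (cong suc (trans (sym b) (cong suc z)))))) 4≤m
Next-triangle 4≤m (inj₂ (a , y)) (inj₂ (b , _)) _
  with s≤s () ← subst (4 ≤_) (trans (sym b) (cong suc y)) 4≤m
Next-triangle 4≤m _ (inj₂ (a , y)) (inj₂ (b , _))
  with s≤s () ← subst (4 ≤_) (trans (sym b) (cong suc y)) 4≤m
Next-triangle 4≤m (inj₂ (a , _)) _ (inj₂ (b , y))
  with s≤s () ← subst (4 ≤_) (trans (sym a) (cong suc y)) 4≤m

-- Adjacency of wheel vertices that does not involve the hub.
Near : ∀ {m} → Fin (suc m) → Fin (suc m) → Set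
Near zero    _       = ⊥
Near (suc i) zero    = ⊥
Near (suc i) (suc j) = CycleAdj i j

near? : ∀ {m} (u v : Fin (suc m)) → Dec (Near u v)
near? zero    _       = no id
near? (suc i) zero    = no id
near? (suc i) (suc j) = next? i j ⊎-dec next? j i

-- A cycle of length at least four has no triangle: either two of the three vertices are the same
-- neighbour of the third, or the three edges run around the cycle.
Near-triangle : ∀ {m} {u v w : Fin (suc m)} → 4 ≤ m → u ≢ v → v ≢ w → u ≢ w → Near u v → Near v w → ¬ Near u w
Near-triangle {u = suc _} {suc _} {suc _} 4≤m u≢v v≢w u≢w = go
  where
  go : _ → _ → ¬ _
  go (inj₁ a) (inj₁ b) (inj₁ c) = v≢w (cong suc (Next-functional a c))
  go (inj₁ a) (inj₁ b) (inj₂ c) = Next-triangle 4≤m a b c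
  go (inj₁ a) (inj₂ b) c        = u≢w (cong suc (Next-injective a b))
  go (inj₂ a) (inj₁ b) c        = u≢w (cong suc (Next-functional a b))
  go (inj₂ a) (inj₂ b) (inj₁ c) = Next-triangle 4≤m c b a
  go (inj₂ a) (inj₂ b) (inj₂ c) = v≢w (cong suc (Next-injective a c))

-- A rim vertex has one successor and one predecessor, and the hub is near no vertex.
near-count : ∀ {m} (u : Fin (suc m)) → Σℕ (allFin (suc m)) (λ v → 𝟙 (does (near? u v))) ≤ 2
near-count {m} zero = ℕ.≤-trans (ℕ.≤-reflexive (trans (Σℕ-const (allFin (suc m)) 0) (ℕ.*-zeroʳ (length (allFin (suc m)))))) z≤n
near-count {m} (suc i) = begin
  Σℕ (allFin (suc m)) (λ v → 𝟙 (does (near? (suc i) v)))  ≤⟨ Σℕ-mono (allFin (suc m)) split ⟩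
  Σℕ (allFin (suc m)) (λ v → 𝟙 (does (fore? v)) + 𝟙 (does (back? v)))
    ≡⟨ Σℕ-+ (allFin (suc m)) (λ v → 𝟙 (does (fore? v))) (λ v → 𝟙 (does (back? v))) ⟩
  count fore? (allFin (suc m)) + count back? (allFin (suc m))
    ≤⟨ ℕ.+-mono-≤ (count-≤1 fore? (Unique.allFin⁺ _) fore-one) (count-≤1 back? (Unique.allFin⁺ _) back-one) ⟩
  2 ∎
  where
  open ℕ.≤-Reasoning
  Fore Back : Fin (suc m) → Set
  Fore zero    = ⊥
  Fore (suc j) = Next i j
  Back zero    = ⊥
  Back (suc j) = Next j i
  fore? : Decidable Fore
  fore? zero    = no id
  fore? (suc j) = next? i j
  back? : Decidable Back
  back? zero    = no id
  back? (suc j) = next? j i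
  fore-one : ∀ {v w} → Fore v → Fore w → v ≡ w
  fore-one {suc _} {suc _} a b = cong suc (Next-functional a b)
  back-one : ∀ {v w} → Back v → Back w → v ≡ w
  back-one {suc _} {suc _} a b = cong suc (Next-injective a b)
  split : ∀ v → 𝟙 (does (near? (suc i) v)) ≤ 𝟙 (does (fore? v)) + 𝟙 (does (back? v))
  split zero = z≤n
  split (suc j) with does (next? i j)
  ... | true  = s≤s z≤n
  ... | false = ℕ.≤-refl

-- Rounding and homogenization of the range bound

-- Rounding the upper end down can only shrink the range. Rounding the lower end down adds less than
-- one integer, and none if the range starts at 0.
range-length : ∀ T .{{_ : NonZero T}} t i j →
               T * ((j * t) / T ∸ (i * t) / T) ≤ (j ∸ i) * t + T * sgn i
range-length T t i j = begin
  T * (b ∸ a)              ≡⟨ ℕ.*-distribˡ-∸ T b a ⟩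
  T * b ∸ T * a            ≤⟨ ℕ.m≤n+o⇒m∸n≤o (T * b) (T * a) bound ⟩
  (j ∸ i) * t + T * sgn i  ∎
  where
  open ℕ.≤-Reasoning
  a = (i * t) / T
  b = (j * t) / T
  lower : ∀ i → i * t ≤ T * ((i * t) / T) + T * sgn i
  lower zero    = z≤n
  lower (suc i) = begin
    suc i * t                                         ≡⟨ m≡m%n+[m/n]*n (suc i * t) T ⟩
    (suc i * t) % T + (suc i * t) / T * T             ≤⟨ ℕ.+-monoˡ-≤ _ (ℕ.<⇒≤ (m%n<n (suc i * t) T)) ⟩
    T + (suc i * t) / T * T                           ≡⟨ lemma T ((suc i * t) / T) ⟩
    T * ((suc i * t) / T) + T * 1                     ∎
    where
    lemma : ∀ T a → T + a * T ≡ T * a + T * 1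
    lemma = solve-∀
  bound : T * b ≤ T * a + ((j ∸ i) * t + T * sgn i)
  bound = begin
    T * b                                   ≡⟨ ℕ.*-comm T b ⟩
    b * T                                   ≤⟨ m/n*n≤m (j * t) T ⟩
    j * t                                   ≤⟨ ℕ.*-monoˡ-≤ t (ℕ.m≤n+m∸n j i) ⟩
    (i + (j ∸ i)) * t                       ≡⟨ ℕ.*-distribʳ-+ t i (j ∸ i) ⟩
    i * t + (j ∸ i) * t                     ≤⟨ ℕ.+-monoˡ-≤ _ (lower i) ⟩
    T * a + T * sgn i + (j ∸ i) * t         ≡⟨ lemma (T * a) (T * sgn i) ((j ∸ i) * t) ⟩
    T * a + ((j ∸ i) * t + T * sgn i)       ∎
    where
    lemma : ∀ p q r → p + q + r ≡ p + (r + q)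
    lemma = solve-∀

-- The parameters q and r stand for 41 and 40; they are variables because the
-- solver would otherwise expand the numerals.
homogenize : ∀ q r m N T t Q D g k s → q ≡ suc r → r ≤ m → N ≡ suc m → q ≤ r + r → 2 * t ≡ N * N + N →
             Q ≤ D + (2 * m + 2 * k) → T * k ≤ g * t + T * s →
             2 * (q * q) * T * Q ≤ N * (N * (2 * (q * q + q) * g + 4 * T * (s + r))) + q * T * (N * D + N * D)
homogenize q r m N T t Q D g k s q≡ r≤m N≡ q≤2r 2t≡ Q≤ Tk≤ = begin
  2 * (q * q) * T * Q
    ≤⟨ ℕ.*-monoʳ-≤ (2 * (q * q) * T) Q≤ ⟩
  2 * (q * q) * T * (D + (2 * m + 2 * k))
    ≡⟨ expand q T D m k ⟩
  2 * q * T * (q * D) + (4 * T * (q * q * m) + 4 * (q * q) * (T * k))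
    -- Raises the linear terms to quadratic ones: the diagonal count D by q D ≤ N D, and the number
    -- of rim edges by `edges`. The length of the range is expressed by t, which `values` treats
    -- below.
    ≤⟨ ℕ.+-mono-≤ (ℕ.*-monoʳ-≤ (2 * q * T) (ℕ.*-monoˡ-≤ D q≤N))
         (ℕ.+-mono-≤ (ℕ.*-monoʳ-≤ (4 * T) edges) (ℕ.*-monoʳ-≤ (4 * (q * q)) Tk≤)) ⟩
  2 * q * T * (N * D) + (4 * T * (r * (N * N)) + 4 * (q * q) * (g * t + T * s))
    ≡⟨ regroup q r T (N * D) (N * N) g t s ⟩
  2 * q * T * (N * D) + (4 * T * (r * (N * N)) + (2 * g * (q * q * (2 * t)) + 4 * T * s * (q * q)))
    ≤⟨ ℕ.+-monoʳ-≤ (2 * q * T * (N * D)) (ℕ.+-monoʳ-≤ (4 * T * (r * (N * N)))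
         (ℕ.+-mono-≤ (ℕ.*-monoʳ-≤ (2 * g) values) (ℕ.*-monoʳ-≤ (4 * T * s) (ℕ.*-mono-≤ q≤N q≤N)))) ⟩
  2 * q * T * (N * D) + (4 * T * (r * (N * N)) + (2 * g * ((q * q + q) * (N * N)) + 4 * T * s * (N * N)))
    ≡⟨ collect q r T N D g s ⟩
  N * (N * (2 * (q * q + q) * g + 4 * T * (s + r))) + q * T * (N * D + N * D) ∎
  where
  open ℕ.≤-Reasoning
  expand : ∀ q T D m k → 2 * (q * q) * T * (D + (2 * m + 2 * k)) ≡
           2 * q * T * (q * D) + (4 * T * (q * q * m) + 4 * (q * q) * (T * k))
  expand = solve-∀
  regroup : ∀ q r T E M k t s → 2 * q * T * E + (4 * T * (r * M) + 4 * (q * q) * (k * t + T * s)) ≡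
            2 * q * T * E + (4 * T * (r * M) + (2 * k * (q * q * (2 * t)) + 4 * T * s * (q * q)))
  regroup = solve-∀
  collect : ∀ q r T N D k s →
    2 * q * T * (N * D) + (4 * T * (r * (N * N)) + (2 * k * ((q * q + q) * (N * N)) + 4 * T * s * (N * N))) ≡
    N * (N * (2 * (q * q + q) * k + 4 * T * (s + r))) + q * T * (N * D + N * D)
  collect = solve-∀
  q≤N : q ≤ N
  q≤N = subst₂ _≤_ (sym q≡) (sym N≡) (s≤s r≤m)
  -- Since 2t = N² + N, the linear term is N ≤ N² / q.
  values : q * q * (2 * t) ≤ (q * q + q) * (N * N)
  values = begin
    q * q * (2 * t)                  ≡⟨ cong (_*_ (q * q)) 2t≡ ⟩
    q * q * (N * N + N)              ≡⟨ ℕ.*-distribˡ-+ (q * q) (N * N) N ⟩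
    q * q * (N * N) + q * q * N      ≡⟨ cong (_+_ (q * q * (N * N))) (ℕ.*-assoc q q N) ⟩
    q * q * (N * N) + q * (q * N)    ≤⟨ ℕ.+-monoʳ-≤ (q * q * (N * N)) (ℕ.*-monoʳ-≤ q (ℕ.*-monoˡ-≤ N q≤N)) ⟩
    q * q * (N * N) + q * (N * N)    ≡⟨ ℕ.*-distribʳ-+ (N * N) (q * q) q ⟨
    (q * q + q) * (N * N)            ∎
  lemma₁ : ∀ r q k → q * q * (r + k) ≡ r * (q * q) + q * (q * k)
  lemma₁ = solve-∀
  lemma₂ : ∀ r q k → r * (q * q) + (r + r) * (q * k) + r * (k * k) ≡ r * ((q + k) * (q + k))
  lemma₂ = solve-∀
  -- This is m / (m + 1)² ≤ r / (r + 1)² for m ≥ r. With m = r + e the two sides are r q² + q² e and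
  -- r q² + 2 r q e + r e², so q ≤ 2r is enough.
  edges : q * q * m ≤ r * (N * N)
  edges = begin
    q * q * m                                       ≡⟨ cong (_*_ (q * q)) (ℕ.m+[n∸m]≡n r≤m) ⟨
    q * q * (r + e)                                 ≡⟨ lemma₁ r q e ⟩
    r * (q * q) + q * (q * e)                       ≤⟨ ℕ.+-monoʳ-≤ (r * (q * q)) (ℕ.*-monoˡ-≤ (q * e) q≤2r) ⟩
    r * (q * q) + (r + r) * (q * e)                 ≤⟨ ℕ.m≤m+n _ (r * (e * e)) ⟩
    r * (q * q) + (r + r) * (q * e) + r * (e * e)   ≡⟨ lemma₂ r q e ⟩
    r * ((q + e) * (q + e))                         ≡⟨ cong (λ n → r * (n * n)) q+e≡N ⟩
    r * (N * N)                                     ∎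
    where
    e = m ∸ r
    q+e≡N : q + e ≡ N
    q+e≡N = trans (cong (_+ e) q≡) (trans (cong suc (ℕ.m+[n∸m]≡n r≤m)) (sym N≡))

-- Points with distinct sums, located in cells

module System {m : ℕ} (40≤m : 40 ≤ m) (x : Fin (suc m) → ℕ) (t : ℕ) (2t≡ : 2 * t ≡ suc m * suc m + suc m)
  -- All that is kept of the labeling: over distinct vertices that are not rim neighbours, the sums
  -- lie between 1 and t and determine the unordered pair.
  (sum≥1 : ∀ {u v} → u ≢ v → ¬ Near u v → 1 ≤ x u + x v)
  (sum≤t : ∀ {u v} → u ≢ v → ¬ Near u v → x u + x v ≤ t)
  (sum-injective : ∀ {u v u′ v′} → u ≢ v → ¬ Near u v → u′ ≢ v′ → ¬ Near u′ v′ →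
                   x u + x v ≡ x u′ + x v′ → (u ≡ u′ × v ≡ v′) ⊎ (u ≡ v′ × v ≡ u′))
  where

  private
    V = Fin (suc m)
    N = suc m
    vs = allFin N

    41≤N : 41 ≤ N
    41≤N = s≤s 40≤m

    4≤m : 4 ≤ m
    4≤m = ℕ.≤-trans (s≤s (s≤s (s≤s (s≤s z≤n)))) 40≤m

    vs-unique : Unique vs
    vs-unique = Unique.allFin⁺ N

    length-vs : length vs ≡ N
    length-vs = length-tabulate id

  Good : V × V → Set
  Good (u , v) = u ≢ v × ¬ Near u v

  -- A sum of a good pair determines the pair up to order, and the order is
  -- recorded by a Boolean; hence the factor 2.
  interval-count : ∀ {P : V × V → Set} (P? : Decidable P) a b →
    (∀ {p} → P p → Good p × a < x (proj₁ p) + x (proj₂ p) × x (proj₁ p) + x (proj₂ p) ≤ b) →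
    Σ² vs (λ u v → 𝟙 (does (P? (u , v)))) ≤ 2 * (b ∸ a)
  interval-count {P} P? a b inside = begin
    Σ² vs (λ u v → 𝟙 (does (P? (u , v))))  ≡⟨ Σℕ-cartesianProduct vs vs (λ p → 𝟙 (does (P? p))) ⟨
    count P? (cartesianProduct vs vs)   ≤⟨ count-≤ P? (Unique.cartesianProduct⁺ vs-unique vs-unique) key keys injective listed ⟩
    length keys                        ≡⟨ length-keys ⟩
    2 * (b ∸ a)                         ∎
    where
    open ℕ.≤-Reasoning
    order : V × V → Bool
    order (u , v) = toℕ u ℕ.<ᵇ toℕ v
    key : V × V → Bool × ℕ
    key p = order p , x (proj₁ p) + x (proj₂ p) ∸ suc a
    half : Bool → List (Bool × ℕ)
    half o = map (o ,_) (upTo (b ∸ a))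
    keys : List (Bool × ℕ)
    keys = half true ++ half false
    length-keys : length keys ≡ 2 * (b ∸ a)
    length-keys = trans (length-++ (half true))
      (cong₂ _+_ (len true) (trans (len false) (sym (ℕ.+-identityʳ (b ∸ a)))))
      where
      len : ∀ o → length (half o) ≡ b ∸ a
      len o = trans (length-map (o ,_) (upTo (b ∸ a))) (length-upTo (b ∸ a))
    listed : ∀ {p} → P p → key p ∈ keys
    listed {p} q with _ , a<s , s≤b ← inside q = in-half (order p) (∈-upTo⁺ bound)
      where
      bound : x (proj₁ p) + x (proj₂ p) ∸ suc a < b ∸ a
      bound = begin
        suc (x (proj₁ p) + x (proj₂ p) ∸ suc a) ≡⟨ ℕ.+-∸-assoc 1 a<s ⟨
        x (proj₁ p) + x (proj₂ p) ∸ a           ≤⟨ ℕ.∸-monoˡ-≤ a s≤b ⟩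
        b ∸ a                                   ∎
      in-half : ∀ o {k} → k ∈ upTo (b ∸ a) → (o , k) ∈ keys
      in-half true  k∈ = ∈-++⁺ˡ (∈-map⁺ (true ,_) k∈)
      in-half false k∈ = ∈-++⁺ʳ (half true) (∈-map⁺ (false ,_) k∈)
    injective : ∀ {p q} → P p → P q → key p ≡ key q → p ≡ q
    injective {u , v} {u′ , v′} p q e
      with (u≢v , ¬n) , a<s , _ ← inside p | (u′≢v′ , ¬n′) , a<s′ , _ ← inside q
      with sum-injective u≢v ¬n u′≢v′ ¬n′ (ℕ.∸-cancelʳ-≡ a<s a<s′ (cong proj₂ e))
    ... | inj₁ (refl , refl) = refl
    ... | inj₂ (refl , refl) = ⊥-elim (flip u v u≢v (cong proj₁ e))
      where
      flip : ∀ u v → u ≢ v → (toℕ u ℕ.<ᵇ toℕ v) ≢ (toℕ v ℕ.<ᵇ toℕ u)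
      flip u v u≢v e with ℕ.<-cmp (toℕ u) (toℕ v)
      ... | tri≈ _ eq _ = u≢v (Fin.toℕ-injective eq)
      ... | tri< lt _ ¬gt = ¬gt (ℕ.<ᵇ⇒< _ _ (subst T e (ℕ.<⇒<ᵇ lt)))
      ... | tri> ¬lt _ gt = ¬lt (ℕ.<ᵇ⇒< _ _ (subst T (sym e) (ℕ.<⇒<ᵇ gt)))

  -- Cells are open at the lower end, so that a sum is strictly above the sum of the lower ends and
  -- the integers to be counted are those in a half-open range. Cell 0 is the exception, as it must
  -- also contain the value 0.
  module Located (τ top lim : ℕ) .{{_ : NonZero τ}} (κ : V → ℕ)
    (above : ∀ u → κ u ≡ 0 ⊎ κ u * t < τ * x u)
    (below : ∀ u → τ * x u ≤ Check.hi τ top lim (κ u) * t) where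

    open Check τ top lim

    module _ (i j : ℕ) where

      private
        𝕀 : V → V → ℕ
        𝕀 u v = 𝟙 (inside i j (κ u) (κ v))

        Q D : ℕ
        Q = Σ² vs 𝕀
        D = Σℕ vs (λ u → 𝕀 u u)

        a b : ℕ
        a = (i * t) / τ
        b = (j * t) / τ

        Ranged : V × V → Set
        Ranged (u , v) = (u ≢ v × ¬ Near u v) × (a < x u + x v × x u + x v ≤ b)

        ranged? : Decidable Ranged
        ranged? (u , v) = (¬? (u Fin.≟ v) ×-dec ¬? (near? u v)) ×-dec ((a ℕ.<? x u + x v) ×-dec (x u + x v ℕ.≤? b))

        diagonal near ranged : V → V → ℕ
        -- A diagonal pair counts only if its own cell forces the sum into the range; this refines
        -- the trivial bound N on the diagonal to D.
        diagonal u v = 𝟙 (does (u Fin.≟ v)) * 𝕀 u u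
        near u v     = 𝟙 (does (near? u v))
        ranged u v   = 𝟙 (does (ranged? (u , v)))

        weak : ∀ u → κ u * t ≤ τ * x u
        weak u with above u
        ... | inj₁ e  = ℕ.≤-trans (ℕ.≤-reflexive (cong (_* t) e)) z≤n
        ... | inj₂ lt = ℕ.<⇒≤ lt

        -- One vertex in a cell with a strict lower end makes the whole sum strictly larger than the
        -- sum of the lower ends.
        sum-above : ∀ {u v} → u ≢ v → ¬ Near u v → i ≤ κ u + κ v → a < x u + x v
        sum-above {u} {v} u≢v ¬n i≤ = ℕ.*-cancelʳ-< τ a (x u + x v) (begin-strict
          a * τ                              ≤⟨ m/n*n≤m (i * t) τ ⟩
          i * t                              <⟨ sums< ⟩
          τ * x u + τ * x v                  ≡⟨ ℕ.*-distribˡ-+ τ (x u) (x v) ⟨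
          τ * (x u + x v)                    ≡⟨ ℕ.*-comm τ (x u + x v) ⟩
          (x u + x v) * τ                    ∎)
          where
          open ℕ.≤-Reasoning
          i*t≤ : i * t ≤ κ u * t + κ v * t
          i*t≤ = ℕ.≤-trans (ℕ.*-monoˡ-≤ t i≤) (ℕ.≤-reflexive (ℕ.*-distribʳ-+ t (κ u) (κ v)))
          sums< : i * t < τ * x u + τ * x v
          sums< with above u | above v
          ... | inj₂ lt | _       = ℕ.≤-<-trans i*t≤ (ℕ.+-mono-<-≤ lt (weak v))
          ... | inj₁ _  | inj₂ lt = ℕ.≤-<-trans i*t≤ (ℕ.+-mono-≤-< (weak u) lt)
          -- Both vertices lie in cell 0, where the lower end is not strict. Then i t = 0, and
          -- strictness comes from the weights starting at 1.
          ... | inj₁ d  | inj₁ e  = begin-strict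
            i * t                   ≤⟨ i*t≤ ⟩
            κ u * t + κ v * t ≡⟨ cong₂ (λ k l → k * t + l * t) d e ⟩
            0                       <⟨ ℕ.*-mono-< {0} {τ} {0} (ℕ.>-nonZero⁻¹ τ) (sum≥1 u≢v ¬n) ⟩
            τ * (x u + x v)         ≡⟨ ℕ.*-distribˡ-+ τ (x u) (x v) ⟩
            τ * x u + τ * x v       ∎

        -- Either the range reaches up to t, which bounds every sum in question, or the upper ends
        -- of the two cells already add up to at most the end of the range. Since the sum is an
        -- integer, it is also bounded by the rounded end.
        sum-below : ∀ {u v} → u ≢ v → ¬ Near u v → τ ≤ j ⊎ hi (κ u) + hi (κ v) ≤ j → x u + x v ≤ b
        sum-below {u} {v} u≢v ¬n h = begin
          x u + x v                 ≡⟨ m*n/n≡m (x u + x v) τ ⟨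
          (x u + x v) * τ / τ       ≤⟨ /-monoˡ-≤ τ (ℕ.≤-trans (ℕ.≤-reflexive (ℕ.*-comm (x u + x v) τ)) (bound h)) ⟩
          b                         ∎
          where
          open ℕ.≤-Reasoning
          bound : τ ≤ j ⊎ hi (κ u) + hi (κ v) ≤ j → τ * (x u + x v) ≤ j * t
          bound (inj₁ τ≤j) = ℕ.*-mono-≤ τ≤j (sum≤t u≢v ¬n)
          bound (inj₂ h≤j) = begin
            τ * (x u + x v)               ≡⟨ ℕ.*-distribˡ-+ τ (x u) (x v) ⟩
            τ * x u + τ * x v             ≤⟨ ℕ.+-mono-≤ (below u) (below v) ⟩
            hi (κ u) * t + hi (κ v) * t   ≡⟨ ℕ.*-distribʳ-+ t (hi (κ u)) (hi (κ v)) ⟨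
            (hi (κ u) + hi (κ v)) * t     ≤⟨ ℕ.*-monoˡ-≤ t h≤j ⟩
            j * t                         ∎

        ranged-complete : ∀ {u v} → u ≢ v → ¬ Near u v → 𝕀 u v ≤ ranged u v
        ranged-complete {u} {v} u≢v ¬n with inside i j (κ u) (κ v) in eq
        ... | false = z≤n
        ... | true  = 1≤𝟙 (ranged? (u , v)) ((u≢v , ¬n) , sum-above u≢v ¬n (ℕ.≤ᵇ⇒≤ i _ (proj₁ split)) , sum-below u≢v ¬n
          ([ inj₁ ∘ ℕ.≤ᵇ⇒≤ τ j , inj₂ ∘ ℕ.≤ᵇ⇒≤ _ j ]′ (Equivalence.to (T-∨ {τ ≤ᵇ j}) (proj₂ split))))
          where split = Equivalence.to (T-∧ {i ≤ᵇ κ u + κ v}) (subst T (sym eq) tt)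

        -- An ordered pair whose cells force the sum into the range is diagonal, or consists of rim
        -- neighbours, whose sum is uncontrolled, or has a sum that really is a weight in the range.
        pointwise : ∀ u v → 𝕀 u v ≤ diagonal u v + (near u v + ranged u v)
        pointwise u v = split (u Fin.≟ v) (near? u v)
          where
          split : Dec (u ≡ v) → Dec (Near u v) → 𝕀 u v ≤ diagonal u v + (near u v + ranged u v)
          split (yes refl) _       = ℕ.m≤n⇒m≤n+o (near u u + ranged u u) (ℕ.≤-trans (ℕ.≤-reflexive (sym (ℕ.*-identityˡ (𝕀 u u))))
                                       (ℕ.*-monoˡ-≤ (𝕀 u u) (1≤𝟙 (u Fin.≟ u) refl)))
          split (no _)     (yes n) = ℕ.m≤n⇒m≤o+n (diagonal u v) (ℕ.m≤n⇒m≤n+o (ranged u v) (ℕ.≤-trans (𝟙≤1 _) (1≤𝟙 (near? u v) n)))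
          split (no u≢v)   (no ¬n) = ℕ.m≤n⇒m≤o+n (diagonal u v) (ℕ.m≤n⇒m≤o+n (near u v) (ranged-complete u≢v ¬n))

        Σ-diagonal : Σ² vs diagonal ≤ D
        Σ-diagonal = Σℕ-mono vs λ u → begin
          Σℕ vs (λ v → 𝟙 (does (u Fin.≟ v)) * 𝕀 u u)   ≡⟨ Σℕ-cong vs (λ v → ℕ.*-comm (𝟙 (does (u Fin.≟ v))) (𝕀 u u)) ⟩
          Σℕ vs (λ v → 𝕀 u u * 𝟙 (does (u Fin.≟ v)))   ≡⟨ Σℕ-*ˡ vs (𝕀 u u) (λ v → 𝟙 (does (u Fin.≟ v))) ⟩
          𝕀 u u * count (u Fin.≟_) vs                  ≤⟨ ℕ.*-monoʳ-≤ (𝕀 u u) (count-≤1 (u Fin.≟_) vs-unique (λ p q → trans (sym p) q)) ⟩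
          𝕀 u u * 1                                    ≡⟨ ℕ.*-identityʳ (𝕀 u u) ⟩
          𝕀 u u                                        ∎
          where open ℕ.≤-Reasoning

        -- The hub contributes an empty row, which saves 2 against the bound 2N; at N = 41 the
        -- certificates are sharp enough for such terms to be kept.
        Σ-near : Σ² vs near ≤ 2 * m
        Σ-near = begin
          Σℕ vs (λ u → Σℕ vs (near u))                   ≤⟨ ℕ.+-monoˡ-≤ _ (ℕ.≤-reflexive hub-row) ⟩
          0 + Σℕ rims (λ u → Σℕ vs (near u))             ≤⟨ Σℕ-mono rims near-count ⟩
          Σℕ rims (λ _ → 2)                              ≡⟨ Σℕ-const rims 2 ⟩
          length rims * 2                                ≡⟨ cong (_* 2) (length-tabulate {n = m} suc) ⟩
          m * 2                                          ≡⟨ ℕ.*-comm m 2 ⟩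
          2 * m                                          ∎
          where
          open ℕ.≤-Reasoning
          rims : List V
          rims = List.tabulate suc
          hub-row : Σℕ vs (near zero) ≡ 0
          hub-row = trans (Σℕ-const vs 0) (ℕ.*-zeroʳ (length vs))

        Q≤ : Q ≤ D + (2 * m + 2 * (b ∸ a))
        Q≤ = begin
          Q                                                    ≤⟨ Σ²-mono vs pointwise ⟩
          Σ² vs (λ u v → diagonal u v + (near u v + ranged u v)) ≡⟨ Σ²-+ vs diagonal (λ u v → near u v + ranged u v) ⟩
          Σ² vs diagonal + Σ² vs (λ u v → near u v + ranged u v) ≡⟨ cong (_+_ (Σ² vs diagonal)) (Σ²-+ vs near ranged) ⟩
          Σ² vs diagonal + (Σ² vs near + Σ² vs ranged)         ≤⟨ ℕ.+-mono-≤ Σ-diagonal (ℕ.+-mono-≤ Σ-near (interval-count ranged? a b (λ r → r))) ⟩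
          D + (2 * m + 2 * (b ∸ a))                            ∎
          where open ℕ.≤-Reasoning

        homogeneous : 3362 * τ * Q ≤
                      N * (N * (3444 * (j ∸ i) + 4 * τ * (sgn i + 40))) + 41 * τ * (N * D + N * D)
        -- The argument `ℕ.m≤m+n 41 39` is the condition q ≤ r + r, that is 41 ≤ 80.
        homogeneous = homogenize 41 40 m N τ t Q D (j ∸ i) (b ∸ a) (sgn i) refl 40≤m refl (ℕ.m≤m+n 41 39) 2t≡ Q≤ (range-length τ t i j)

        Σ-allowance : Σ² vs (λ u v → allowance i j (κ u) (κ v)) ≡
                      N * (N * (3444 * (j ∸ i) + 4 * τ * (sgn i + 40))) + 41 * τ * (N * D + N * D)
        Σ-allowance = trans (Σ²-+ vs (λ _ _ → c) (λ u v → 41 * τ * (𝕀 u u + 𝕀 v v))) (cong₂ _+_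
          (trans (Σ²-const vs c) (cong₂ (λ p q → p * (q * c)) length-vs length-vs))
          (trans (Σ²-*ˡ vs (41 * τ) (λ u v → 𝕀 u u + 𝕀 v v)) (cong (_*_ (41 * τ))
            (trans (Σ²-+ vs (λ u _ → 𝕀 u u) (λ _ v → 𝕀 v v)) (cong₂ _+_
              (trans (Σ²-left vs (λ u → 𝕀 u u)) (cong (_* D) length-vs))
              (trans (Σ²-right vs (λ v → 𝕀 v v)) (cong (_* D) length-vs)))))))
          where c = 3444 * (j ∸ i) + 4 * τ * (sgn i + 40)

      ran≤ : Σ² vs (λ u v → 3362 * τ * 𝕀 u v) ≤ Σ² vs (λ u v → allowance i j (κ u) (κ v))
      ran≤ = subst₂ _≤_ (sym (Σ²-*ˡ vs (3362 * τ) 𝕀)) (sym Σ-allowance) homogeneous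

  0<t : 0 < t
  0<t = positive t 2t≡
    where
    positive : ∀ t {k} → 2 * t ≡ suc k → 0 < t
    positive (suc t) _ = s≤s z≤n

  -- The hub is near no vertex, so every vertex lies in a good pair: with the hub, or, for the hub
  -- itself, with any rim vertex.
  x≤t : ∀ u → x u ≤ t
  x≤t zero    = ℕ.≤-trans (ℕ.m≤m+n (x zero) (x (suc i₀))) (sum≤t (λ ()) id)
    where
    i₀ : Fin m
    i₀ = fromℕ< (ℕ.≤-trans (s≤s z≤n) 4≤m)
  x≤t (suc i) = ℕ.≤-trans (ℕ.m≤m+n (x (suc i)) (x zero)) (sum≤t (λ ()) id)

  -- Vertices that are pairwise neighbours on the rim form a clique in a cycle without triangles.
  large : ∀ (k : ℕ) (f : V → ℕ) → (∀ {u v} → k < f u → k < f v → u ≢ v → Near u v) → count (λ u → k ℕ.<? f u) vs ≤ 2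
  large k f clique = subst (_≤ 2) (sym (count≡length-filter big? vs)) (go (Unique.filter⁺ big? vs-unique) (All.all-filter big? vs))
    where
    big? = λ u → k ℕ.<? f u
    go : ∀ {us} → Unique us → All (λ u → k < f u) us → length us ≤ 2
    go []              _ = z≤n
    go (_ ∷ [])        _ = s≤s z≤n
    go (_ ∷ _ ∷ [])    _ = s≤s (s≤s z≤n)
    go ((u≢v ∷ u≢w ∷ _) ∷ (v≢w ∷ _) ∷ _ ∷ _) (p ∷ q ∷ r ∷ _) =
      ⊥-elim (Near-triangle 4≤m u≢v v≢w u≢w (clique p q u≢v) (clique q r v≢w) (clique p r u≢w))

  exceeds⇒near : ∀ {u v} → t < x u + x v → u ≢ v → Near u v
  exceeds⇒near {u} {v} lt u≢v with near? u v
  ... | yes n = n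
  ... | no ¬n = ⊥-elim (ℕ.<⇒≱ lt (sum≤t u≢v ¬n))

  -- Two values above t / 2 have a sum above t, which a good pair cannot have; so all such vertices
  -- are pairwise near.
  count-large : count (λ u → t ℕ.<? 2 * x u) vs ≤ 2
  count-large = large t (λ u → 2 * x u) clique
    where
    clique : ∀ {u v} → t < 2 * x u → t < 2 * x v → u ≢ v → Near u v
    clique {u} {v} p q = exceeds⇒near (ℕ.*-cancelˡ-< 2 t (x u + x v) (begin-strict
      2 * t                   ≡⟨ cong (_+_ t) (ℕ.+-identityʳ t) ⟩
      t + t                   <⟨ ℕ.+-mono-< p q ⟩
      2 * x u + 2 * x v       ≡⟨ ℕ.*-distribˡ-+ 2 (x u) (x v) ⟨
      2 * (x u + x v)         ∎))
      where open ℕ.≤-Reasoning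

  -- A vertex whose sum with `M` exceeds t is `M` itself or one of its at most two rim neighbours.
  count-exceeding : ∀ M → count (λ u → t ℕ.<? x M + x u) vs ≤ 3
  count-exceeding M = begin
    count (λ u → t ℕ.<? x M + x u) vs
      ≤⟨ Σℕ-mono vs (λ u → split u (M Fin.≟ u)) ⟩
    Σℕ vs (λ u → 𝟙 (does (M Fin.≟ u)) + 𝟙 (does (near? M u)))
      ≡⟨ Σℕ-+ vs (λ u → 𝟙 (does (M Fin.≟ u))) (λ u → 𝟙 (does (near? M u))) ⟩
    count (M Fin.≟_) vs + Σℕ vs (λ u → 𝟙 (does (near? M u)))
      ≤⟨ ℕ.+-mono-≤ (count-≤1 (M Fin.≟_) vs-unique (λ p q → trans (sym p) q)) (near-count M) ⟩
    3 ∎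
    where
    open ℕ.≤-Reasoning
    split : ∀ u → Dec (M ≡ u) → 𝟙 (does (t ℕ.<? x M + x u)) ≤ 𝟙 (does (M Fin.≟ u)) + 𝟙 (does (near? M u))
    split u (yes e)   = ℕ.m≤n⇒m≤n+o (𝟙 (does (near? M u))) (ℕ.≤-trans (𝟙≤1 _) (1≤𝟙 (M Fin.≟ u) e))
    split u (no M≢u)  = ℕ.m≤n⇒m≤o+n (𝟙 (does (M Fin.≟ u))) (𝟙-mono (t ℕ.<? x M + x u) (near? M u) (λ lt → exceeds⇒near lt M≢u))

  module Case (τ top lim : ℕ) .{{_ : NonZero τ}} (lim-bound : ∀ u → τ * x u ≤ lim * t) where

    open Check τ top lim

    private instance
      t≢0 : NonZero t
      t≢0 = ℕ.>-nonZero 0<t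

    -- Dividing τ x - 1 instead of τ x puts a multiple of t into the lower of the two adjacent
    -- cells, so cells are open below and closed above. The truncated subtraction puts the value 0
    -- into cell 0, and the minimum merges everything from `top` on into one cell.
    raw κ : V → ℕ
    raw u = (τ * x u ∸ 1) / t
    κ u   = raw u ℕ.⊓ top

    raw-above : ∀ u c → suc c ≤ raw u → suc c * t < τ * x u
    raw-above u c c<raw = ℕ.≤-<-trans (begin
      suc c * t      ≤⟨ ℕ.*-monoˡ-≤ t c<raw ⟩
      raw u * t      ≤⟨ m/n*n≤m (τ * x u ∸ 1) t ⟩
      τ * x u ∸ 1    ∎) (shrink (ℕ.≤-trans (ℕ.≤-trans 0<t (ℕ.m≤m+n t (c * t))) (ℕ.≤-trans (ℕ.*-monoˡ-≤ t c<raw) (m/n*n≤m (τ * x u ∸ 1) t))))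
      where
      open ℕ.≤-Reasoning
      -- The hypothesis excludes k = 0, where truncation would make the two sides equal.
      shrink : ∀ {k} → 1 ≤ k ∸ 1 → k ∸ 1 < k
      shrink {suc k} _ = ℕ.≤-refl

    above : ∀ u → κ u ≡ 0 ⊎ κ u * t < τ * x u
    above u with κ u in eq
    ... | zero  = inj₁ refl
    ... | suc c = inj₂ (raw-above u c (subst (_≤ raw u) eq (ℕ.m⊓n≤m (raw u) top)))

    raw-below : ∀ u → τ * x u ≤ suc (raw u) * t
    raw-below u = begin
      τ * x u                                    ≤⟨ ℕ.m≤n+m∸n (τ * x u) 1 ⟩
      suc (τ * x u ∸ 1)                          ≡⟨ cong suc (m≡m%n+[m/n]*n (τ * x u ∸ 1) t) ⟩
      suc ((τ * x u ∸ 1) % t) + raw u * t        ≤⟨ ℕ.+-monoˡ-≤ (raw u * t) (m%n<n (τ * x u ∸ 1) t) ⟩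
      t + raw u * t                              ∎
      where open ℕ.≤-Reasoning

    top≮top : (top ℕ.<ᵇ top) ≡ false
    top≮top with top ℕ.<ᵇ top in eq
    ... | false = refl
    ... | true  = ⊥-elim (ℕ.n≮n top (ℕ.<ᵇ⇒< top top (subst T (sym eq) tt)))

    below : ∀ u → τ * x u ≤ hi (κ u) * t
    below u with ℕ.⊓-sel (raw u) top
    ... | inj₂ e rewrite e | top≮top = lim-bound u
    ... | inj₁ e rewrite e with raw u ℕ.<ᵇ top
    ... | true  = raw-below u
    ... | false = lim-bound u

    open Located τ top lim κ above below using (ran≤)
    open Sound vs κ (λ u → ℕ.m⊓n≤n (raw u) top) (ℕ.≤-trans (ℕ.≤-trans (s≤s z≤n) 41≤N) (ℕ.≤-reflexive (sym length-vs))) ran≤ public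

    -- Here an absolute count becomes a share: at most k vertices are at most k N / 41 of them
    -- because N ≥ 41. Adding k C on both sides, with C the number of vertices in the cells, avoids
    -- subtraction. The lower cell is a successor because cell 0 has no strict lower end.
    atMost-holds : ∀ {P : V → Set} (P? : Decidable P) l h k → count P? vs ≤ k →
                   k ≤ 41 → (∀ {u} → suc l ≤ κ u → P u) → Holds (atMost (suc l) h k)
    atMost-holds {P} P? l h k few k≤41 implied = ℕ.+-cancelˡ-≤ (k * C) _ _ (begin
      k * C + Σℕ vs (minus g ∘ κ)  ≡⟨ balance minus-value ⟩
      41 * C                       ≤⟨ ℕ.*-mono-≤ 41≤N (ℕ.≤-trans (Σℕ-mono vs pointwise) few) ⟩
      N * k                        ≡⟨ cong (_* k) length-vs ⟨
      length vs * k                ≡⟨ Σℕ-const vs k ⟨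
      Σℕ vs (λ _ → k)              ≡⟨ Σℕ-cong vs plus-value ⟨
      Σℕ vs (λ u → k * interval u + plus g (κ u))  ≡⟨ Σℕ-+ vs (λ u → k * interval u) (plus g ∘ κ) ⟩
      Σℕ vs (λ u → k * interval u) + Σℕ vs (plus g ∘ κ) ≡⟨ cong (_+ Σℕ vs (plus g ∘ κ)) (Σℕ-*ˡ vs k interval) ⟩
      k * C + Σℕ vs (plus g ∘ κ)   ∎)
      where
      open ℕ.≤-Reasoning
      g = atMost (suc l) h k
      interval : V → ℕ
      interval u = 𝟙 ((suc l ≤ᵇ κ u) ∧ (κ u ≤ᵇ h))
      C = Σℕ vs interval
      minus-value : ∀ u → k * interval u + minus g (κ u) ≡ 41 * interval u
      minus-value u with (suc l ≤ᵇ κ u) ∧ (κ u ≤ᵇ h)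
      ... | true  = trans (cong (_+ (41 ∸ k)) (ℕ.*-identityʳ k)) (ℕ.m+[n∸m]≡n k≤41)
      ... | false = trans (ℕ.+-identityʳ (k * 0)) (ℕ.*-zeroʳ k)
      plus-value : ∀ u → k * interval u + plus g (κ u) ≡ k
      plus-value u with (suc l ≤ᵇ κ u) ∧ (κ u ≤ᵇ h)
      ... | true  = trans (ℕ.+-identityʳ (k * 1)) (ℕ.*-identityʳ k)
      ... | false = cong (_+ k) (ℕ.*-zeroʳ k)
      balance : (∀ u → k * interval u + minus g (κ u) ≡ 41 * interval u) → k * C + Σℕ vs (minus g ∘ κ) ≡ 41 * C
      balance e = trans (cong (_+ Σℕ vs (minus g ∘ κ)) (sym (Σℕ-*ˡ vs k interval)))
        (trans (sym (Σℕ-+ vs (λ u → k * interval u) (minus g ∘ κ))) (trans (Σℕ-cong vs e) (Σℕ-*ˡ vs 41 interval)))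
      pointwise : ∀ u → interval u ≤ 𝟙 (does (P? u))
      pointwise u with suc l ≤ᵇ κ u in eq
      ... | false = z≤n
      ... | true  = ℕ.≤-trans (𝟙≤1 (κ u ≤ᵇ h)) (1≤𝟙 (P? u) (implied (ℕ.≤ᵇ⇒≤ (suc l) (κ u) (subst T (sym eq) tt))))

    κ-above : ∀ {u} l → suc l ≤ κ u → suc l * t < τ * x u
    κ-above {u} l l<κ = raw-above u l (ℕ.≤-trans l<κ (ℕ.m⊓n≤m (raw u) top))

    -- From cell τ / 2 on, all values exceed t / 2, so `count-large` applies.
    holds-2 : ∀ l h → τ ≤ 2 * suc l → Holds (atMost (suc l) h 2)
    holds-2 l h τ≤2l = atMost-holds (λ u → t ℕ.<? 2 * x u) l h 2 count-large (ℕ.m≤m+n 2 39) λ {u} l<κ →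
      ℕ.*-cancelˡ-< τ t (2 * x u) (begin-strict
        τ * t              ≤⟨ ℕ.*-monoˡ-≤ t τ≤2l ⟩
        2 * suc l * t      ≡⟨ ℕ.*-assoc 2 (suc l) t ⟩
        2 * (suc l * t)    <⟨ ℕ.*-monoʳ-< 2 (κ-above l l<κ) ⟩
        2 * (τ * x u)      ≡⟨ lemma τ (x u) ⟩
        τ * (2 * x u)      ∎)
      where
      open ℕ.≤-Reasoning
      lemma : ∀ τ k → 2 * (τ * k) ≡ τ * (2 * k)
      lemma = solve-∀

    -- A vertex in one of these cells lies above the complement of `M`: the two lower ends add up to
    -- at least τ, so the sum exceeds t and `count-exceeding` applies.
    holds-3 : ∀ M c l h → c * t < τ * x M → τ ≤ c + suc l → Holds (atMost (suc l) h 3)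
    holds-3 M c l h M-large τ≤c+l = atMost-holds (λ u → t ℕ.<? x M + x u) l h 3 (count-exceeding M) (ℕ.m≤m+n 3 38) λ {u} l<κ →
      ℕ.*-cancelˡ-< τ t (x M + x u) (begin-strict
        τ * t                  ≤⟨ ℕ.*-monoˡ-≤ t τ≤c+l ⟩
        (c + suc l) * t        ≡⟨ ℕ.*-distribʳ-+ t c (suc l) ⟩
        c * t + suc l * t      <⟨ ℕ.+-mono-< M-large (κ-above l l<κ) ⟩
        τ * x M + τ * x u      ≡⟨ ℕ.*-distribˡ-+ τ (x M) (x u) ⟨
        τ * (x M + x u)        ∎)
      where open ℕ.≤-Reasoning

-- The upper bound

module Spokes (m : ℕ) (3≤m : 3 ≤ m) (leech : IsGeodesicLeech (Wheel.G m 3≤m)) where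
  open Wheel m 3≤m
  open EdgeLabeling (proj₁ leech)
  open Leech G diam (proj₁ leech) (proj₂ leech)
  open Geodesic

  private
    V = Fin (suc m)

  x : V → ℕ
  x zero    = 0
  x (suc i) = label zero (suc i)

  -- The paths whose weight is the sum of the values of their ends: a spoke, where the hub
  -- contributes 0, or two spokes.
  data HubPath (u v : V) : List V → Set where
    direct  : HubPath u v (u ∷ v ∷ [])
    through : HubPath u v (u ∷ zero ∷ v ∷ [])

  -- The ends can be read off the vertex list, and the two kinds of paths differ in length. Thus
  -- equivalence of the geodesics gives equality of unordered pairs.
  HubPath-ends : ∀ {u v u′ v′ vs ws} → HubPath u v vs → HubPath u′ v′ ws → vs ≡ ws ⊎ vs ≡ reverse ws →
                 (u ≡ u′ × v ≡ v′) ⊎ (u ≡ v′ × v ≡ u′)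
  HubPath-ends direct  direct  (inj₁ refl) = inj₁ (refl , refl)
  HubPath-ends direct  direct  (inj₂ refl) = inj₂ (refl , refl)
  HubPath-ends direct  through (inj₁ ())
  HubPath-ends direct  through (inj₂ ())
  HubPath-ends through direct  (inj₁ ())
  HubPath-ends through direct  (inj₂ ())
  HubPath-ends through through (inj₁ refl) = inj₁ (refl , refl)
  HubPath-ends through through (inj₂ refl) = inj₂ (refl , refl)

  -- Two rim vertices that are not neighbours are at distance two, and the hub is a common
  -- neighbour. A second geodesic along the rim may exist, but the one through the hub is chosen.
  hubGeodesic : ∀ u v → u ≢ v → ¬ Near u v →
                ∃ λ (p : Geodesic G) → HubPath u v (vertices p) × weight (vertices p) ≡ x u + x v
  hubGeodesic zero    zero    u≢v _  = ⊥-elim (u≢v refl)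
  hubGeodesic zero    (suc j) _   _  = edgeGeodesic G hub-rim , direct , ℕ.+-identityʳ _
  hubGeodesic (suc i) zero    _   _  = edgeGeodesic G rim-hub , direct , cong (_+ 0) (undirected rim-hub)
  hubGeodesic (suc i) (suc j) u≢v ¬n = viaGeodesic G u≢v (λ { (rim-rim a) → ¬n a }) rim-hub hub-rim , through ,
    cong₂ _+_ (undirected rim-hub) (ℕ.+-identityʳ _)

  -- The number of codes bounds the number of geodesics and has the closed form that the counting
  -- requires, so it takes the place of `t-gp`.
  t : ℕ
  t = length (codes m)

  sum≥1 : ∀ {u v} → u ≢ v → ¬ Near u v → 1 ≤ x u + x v
  sum≥1 {u} {v} u≢v ¬n with p , _ , e ← hubGeodesic u v u≢v ¬n = subst (1 ≤_) e (proj₁ (weight-range p))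

  sum≤t : ∀ {u v} → u ≢ v → ¬ Near u v → x u + x v ≤ t
  sum≤t {u} {v} u≢v ¬n with p , _ , e ← hubGeodesic u v u≢v ¬n =
    ℕ.≤-trans (subst (_≤ t-gp) e (proj₂ (weight-range p))) (t-gp-bound (proj₁ (proj₂ leech)))

  sum-injective : ∀ {u v u′ v′} → u ≢ v → ¬ Near u v → u′ ≢ v′ → ¬ Near u′ v′ →
                  x u + x v ≡ x u′ + x v′ → (u ≡ u′ × v ≡ v′) ⊎ (u ≡ v′ × v ≡ u′)
  sum-injective {u} {v} {u′} {v′} u≢v ¬n u′≢v′ ¬n′ e
    with p , h , d ← hubGeodesic u v u≢v ¬n | p′ , h′ , d′ ← hubGeodesic u′ v′ u′≢v′ ¬n′
    = HubPath-ends h h′ (weight-injective p p′ (trans d (trans e (sym d′))))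

-- Branch-and-bound certificates

-- For largest value at most 13t/24, with cells 0 to 12. Almost all branchings ask for the share of
-- an initial interval of cells, so a leaf confines the distribution function of the values between
-- thresholds in units of 1/410. Multipliers of cell counts have three digits per cell, the last
-- group belonging to cell 0. Where two `cel` rows refer to the same fact, the one of smaller weight
-- refines the multipliers of the other.
treeA : Tree
treeA =
  -- In the first subtree at least 212/410 of the vertices lie in the cells 0 to 5, that is, have
  -- values at most t / 4; in the second at most 212/410 do.
  (branch 0 5 212
   (branch 0 3 172
    (branch 0 9 274
     (branch 0 3 190
      (branch 0 2 142
       (branch 0 9 285
        (branch 0 5 232
         (leaf (ran 28297 0 16 ∷ ran 189 7 16 ∷ ran 1538 0 18 ∷ ran 4411 8 16 ∷ ran 347 5 16 ∷
           ran 1149 9 16 ∷ ran 4532 10 16 ∷ ran 1098 0 14 ∷ ran 2609 0 17 ∷ ran 562 6 17 ∷ ran 1180 11 17 ∷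
           ran 1180 3 16 ∷ cel 23 0 139986911283255000000000000000011 ∷
           cel 1 0 20014022013012000000000000000011 ∷ cel 12 1 275064048000028111576969561279060018000 ∷
           cel 1 1 9005007000011003006002004010003011000 ∷ cel 3 2 154000064000000291000547698000076000 ∷
           cel 1 2 3000002000000001000001002000002000 ∷ cel 27 3 685965845072067200004062000000000000000 ∷
           cel 1 3 5013008007026018023022000000000000000 ∷
           cel 253 7 368000000000019000163000215997038000000 ∷
           cel 1 7 154000000000075000049000188209149000000 ∷ fac 1234 2 0 ∷
           sqr 1128 19 10013013019049042040043023020020016 ∷
           sqr 1332 30 39040050040024007042031035018026023 ∷ sqr 2098 11 4002002002041023018018011012011014 ∷
           sqr 1028 22 19021025034052052037027030022020014 ∷ sqr 708 30 35030029037042049034035038021020026 ∷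
           sqr 120 30 22043036034032000009023028010033040031 ∷
           sqr 146 30 33030047039058043035042033025028023 ∷
           sqr 55 23 27013031020038053014000044050023024016 ∷
           sqr 229 10 28001000012004040021021019010010011008 ∷
           sqr 230 30 34037038034031011014000018019037042034 ∷
           sqr 61 30 52034020040051000032002035028034033034 ∷ []))
         (branch 0 10 307
          (leaf (ran 7797 0 16 ∷ ran 4045 8 16 ∷ ran 693 7 16 ∷ ran 1215 6 14 ∷ ran 1202 3 16 ∷
            ran 1111 10 16 ∷ ran 333 11 16 ∷ ran 939 9 17 ∷ ran 1723 5 16 ∷ ran 420 0 15 ∷ ran 2762 0 14 ∷
            ran 1287 6 17 ∷ ran 835 6 18 ∷ cel 7 0 32045000000000000065000866000428000000 ∷
            cel 1 0 2001000000000000003000001000002000000 ∷ cel 2 1 970000000000000000000 ∷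
            cel 1 1 1000000000000000000 ∷ cel 7 2 69025033000000000190946000390097094000 ∷
            cel 1 2 3005006000000000007001000003001002000 ∷ cel 1 3 267000000000000000000794000000000 ∷
            cel 7 4 686901732000079000000854467384118000158 ∷ cel 1 4 2003001000001000000001001006001000005 ∷
            cel 4 7 933676000000000000000000062000 ∷ cel 1 7 4000000000000000000000002000 ∷
            cel 116 8 176023000000000000077000072990033251000 ∷
            cel 1 8 54049000000000000080000062067016101000 ∷ fac 4009 7 1 ∷ fac 3367 4 1 ∷ fac 847 7 2 ∷
            fac 434 7 0 ∷ sqr 6054 6 3004004006016014013014007006006005 ∷
            sqr 8248 4 2002005005008008014014012007003000000 ∷
            sqr 6361 10 6011013012010003000008010012009012011 ∷
            sqr 3380 10 13010012011009002000009011006012014012 ∷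
            sqr 4093 10 18011011008009004011000002005011012012 ∷
            sqr 3291 2 2000001002002012002009003007003001000 ∷
            sqr 4146 3 4004004003013008001004001004001001 ∷
            sqr 1172 3 9000000004001013007007006003003003002 ∷
            sqr 886 10 10008017012006014019016012008008008 ∷
            sqr 1276 10 8012012013012000002016010010007013010 ∷ fac 2969 8 1 ∷ fac 400 4 0 ∷ []))
          (leaf (ran 13266 0 16 ∷ ran 4269 8 16 ∷ ran 1050 7 16 ∷ ran 1408 9 14 ∷ ran 1946 5 17 ∷
            ran 2907 11 14 ∷ ran 2596 3 16 ∷ ran 1872 10 16 ∷ ran 2803 11 17 ∷ ran 806 8 17 ∷ ran 4873 6 15 ∷
            ran 196 0 13 ∷ cel 4 0 653998439000000424000000000000083 ∷
            cel 1 0 3001003000000001000000000000003 ∷ cel 4 1 800000000000000000000 ∷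
            cel 1 1 3000000000000000000 ∷ cel 7 2 433000000000714901000261519000000 ∷
            cel 1 2 2000000000005004000002006000000 ∷ cel 2 3 646000000233000 ∷ cel 1 3 1000000001000 ∷
            cel 14 4 674682952610160170000425234039000000065 ∷
            cel 1 4 12004014014013001000011008006000000010 ∷ cel 6 7 187890000000000000000000000000 ∷
            cel 1 7 5005000000000000000000000000 ∷ cel 150 8 249000000000000000019000221995177137000 ∷
            cel 1 8 31000000000000000037000104129038109000 ∷ fac 8966 7 1 ∷ fac 3105 7 2 ∷ fac 16112 8 7 ∷
            fac 4316 3 0 ∷ fac 20085 8 0 ∷ fac 2941 1 0 ∷ fac 4130 4 0 ∷ fac 13014 8 2 ∷ fac 1510 7 4 ∷
            sqr 2043 11 8000007020011015007036041015018012009 ∷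
            sqr 1297 22 19021025034052052037027030022020014 ∷
            sqr 1453 30 19034038035030010000023030037028037033 ∷
            sqr 1042 20 20050034023008016009026021028022020 ∷
            sqr 802 30 44038039016030034028000012016032036031 ∷
            sqr 519 19 10013013019049042040043023020020016 ∷
            sqr 61 30 54034033025026013034000005015033036037 ∷
            sqr 586 9 12012013008039024003012004013004004 ∷ []))))
        (branch 0 1 138
         (leaf (ran 70484 10 16 ∷ ran 57850 0 14 ∷ ran 19131 10 17 ∷ ran 10890 5 17 ∷ ran 80 11 17 ∷
           ran 7378 8 17 ∷ ran 22427 0 18 ∷ ran 4973 8 15 ∷ ran 10057 9 16 ∷ ran 3146 7 17 ∷ ran 5481 2 16 ∷
           ran 4861 4 16 ∷ ran 3737 3 16 ∷ ran 7073 11 14 ∷ cel 43 0 53000000000765990000154000341000000 ∷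
           cel 1 0 14000000000001033000021000037000000 ∷ cel 82 1 987760222000000557000000000074 ∷
           cel 1 1 47068047000000080000000000050 ∷ cel 14 2 298948000000000 ∷ cel 1 2 10006000000000 ∷
           cel 91 3 544333000934989000000000071000000016079 ∷
           cel 1 3 88076000041034000000000053000000032087 ∷ cel 92 6 343997667668162000000000000000000 ∷
           cel 1 6 78014022086019000000000000000000 ∷ cel 722 7 78000002000000060060000164998021720000 ∷
           cel 1 7 263000599000000036419000027467323376000 ∷ fac 11052 2 1 ∷ fac 67806 3 1 ∷ fac 126869 7 6 ∷
           fac 31997 6 0 ∷ fac 65780 1 0 ∷ fac 16974 6 1 ∷ fac 12017 6 3 ∷ fac 3546 3 2 ∷ fac 5557 7 4 ∷
           fac 1771 3 0 ∷ sqr 2110 30 7000003046043037059058046036043043040 ∷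
           sqr 2431 30 28033040056036029009000037044051032020 ∷
           sqr 2126 30 12007046050037053036049032037037039 ∷
           sqr 2967 20 24016019000025050020011021030007024018 ∷
           sqr 968 27 16041048015055023032027039056057000008 ∷
           sqr 2344 30 40035029040032006029000039016032034033 ∷
           sqr 1645 27 38032034057039031008000026046025026020 ∷
           sqr 889 26 32021039056037000021018037017051032022 ∷
           sqr 609 30 52021037000044032059059032043047015022 ∷
           sqr 1240 30 34030026030028044035000045032025034032 ∷
           sqr 282 26 35012040036000056031027024033018040022 ∷
           sqr 391 16 21012020002017000046029017013021013016 ∷
           sqr 244 25 37028025049055000008030020030044023015 ∷
           sqr 54 30 49028013013034000042005042007032031051 ∷ fac 31697 1 1 ∷ []))
         (leaf (ran 2117 0 16 ∷ ran 39963 10 16 ∷ ran 9972 0 17 ∷ ran 10267 0 18 ∷ ran 966 2 16 ∷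
           ran 571 7 17 ∷ ran 1830 10 14 ∷ ran 2977 11 16 ∷ ran 5778 9 17 ∷ ran 721 4 15 ∷ ran 3503 3 16 ∷
           cel 36 0 87886975155000000000000000099000 ∷ cel 1 0 8015034024000000000000000016000 ∷
           cel 88 1 998000000342259095000000329000000011018 ∷
           cel 1 1 69000000045085028000000043000000001031 ∷ cel 4 2 559780000408000 ∷ cel 1 2 2002000003000 ∷
           cel 35 3 578318000951970227000000430000072261222 ∷ cel 1 3 6000035034034000000006000035018028 ∷
           cel 44 6 279987751244138000000000000000000 ∷ cel 1 6 28012029040008000000000000000000 ∷
           cel 394 7 22000000000018106059000086996000011000 ∷
           cel 1 7 356000000000127381224000303211000301000 ∷ fac 3287 2 1 ∷ fac 44268 3 1 ∷ fac 16373 1 1 ∷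
           fac 68608 7 6 ∷ fac 2080 6 2 ∷ fac 153 2 0 ∷ fac 7232 6 1 ∷ fac 6686 3 3 ∷ fac 3989 6 3 ∷
           fac 554633 7 1 ∷ fac 4002 3 0 ∷ sqr 83287 4 5003004000003007005006004005004003004 ∷
           sqr 128894 4 5005005005005000002003003004004004004 ∷
           sqr 46530 4 4004004004004004004000008005005002004 ∷
           sqr 26831 4 3004006006006001006005005000006005004 ∷
           sqr 35212 4 4004005004004005005000007005003005003 ∷
           sqr 9991 4 4005005004004003004008000005008002002 ∷ []))))
       (leaf (ran 23991 8 16 ∷ ran 4393 7 16 ∷ ran 3973 9 16 ∷ ran 210658 3 16 ∷ ran 6812 11 16 ∷
         ran 29471 10 17 ∷ ran 14497 5 17 ∷ ran 2528 5 18 ∷ cel 90 0 818877411359162034000000000992870870 ∷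
         cel 187 1 998817000083385181117050000041000000 ∷ cel 40 2 181000000000000000894981000000084000000 ∷
         cel 187 4 181998848172146000000000000000000 ∷ cel 682 5 998772772878609000000000458000000000000 ∷
         fac 40316 2 0 ∷ fac 4198 3 0 ∷ fac 642760 5 0 ∷ fac 214723 5 1 ∷
         sqr 1584087 3 2002002003007006006006004003003003 ∷ fac 19289 4 1 ∷ [])))
      (branch 0 9 293
       (branch 0 5 240
        (branch 0 10 305
         (leaf (ran 24220 4 16 ∷ ran 15620 8 16 ∷ ran 27635 0 14 ∷ ran 6724 0 18 ∷ ran 6549 3 16 ∷
           ran 5419 10 18 ∷ ran 12007 9 18 ∷ ran 4214 7 18 ∷ ran 10275 5 18 ∷ ran 9515 4 17 ∷ ran 4304 0 17 ∷
           ran 2738 11 16 ∷ ran 9472 10 15 ∷ cel 34 0 146000000000128986000000248446000000 ∷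
           cel 1 0 33000000000005025000000002034000000 ∷ cel 56 1 1295884986761358251000062000001000 ∷
           cel 1 1 16051031049048051009000009000014000 ∷ cel 19 2 16438000000610017000000974307046000 ∷
           cel 1 2 7015000000003009000000013005011000 ∷ cel 17 3 957857000000000000027000 ∷
           cel 1 3 16014000000000000009000 ∷ cel 11 5 912000000000000000022000000000 ∷
           cel 1 5 8000000000000000006000000000 ∷ cel 428 7 232007000023000058000394000996371505000 ∷
           cel 1 7 363344000076000214000256000353097084000 ∷ fac 13109 5 3 ∷ fac 95197 7 3 ∷ fac 31365 3 2 ∷
           fac 63371 7 1 ∷ fac 8061 3 0 ∷ fac 4795 3 1 ∷ sqr 3844 16 17007000020033046031020012038027014011 ∷
           sqr 1952 13 16014019023043040032016025011010008000 ∷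
           sqr 1029 29 27034034033039037059056052004000015018 ∷
           sqr 1360 30 50041041022041007000011032011027033034 ∷
           sqr 1021 30 55039041036025046047048046000003016018 ∷
           sqr 1054 27 33033029055057052042042025018020014 ∷
           sqr 696 14 22002016010044032042035042021019002000 ∷
           sqr 977 28 45034058032023020000008025022031032029 ∷
           sqr 335 27 56038054043026042057047049000011003007 ∷
           sqr 612 30 31037047025048010013000026030038039033 ∷
           sqr 823 9 14000025018011015022010016023039007000 ∷
           sqr 792 20 31020030034024010010000015028050025017 ∷
           sqr 619 16 17019021009046012001003021005000023019 ∷
           sqr 274 18 23024040036048047025001027023047015000 ∷
           sqr 661 8 12003008008038014013008023011027007000 ∷
           sqr 778 9 39009010014017025022016016002000000000 ∷
           sqr 187 12 23008038015039022000004026020042011001 ∷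
           sqr 244 11 41004013015000023027019012011009003008 ∷
           sqr 108 30 30032020016032027030039038008000033036 ∷
           sqr 328 11 15004016012011000026009012020041006009 ∷
           sqr 102 30 44033040026044000040021033014020028032 ∷
           sqr 69 30 36020038048000031038033023035046029031 ∷ []))
         (leaf (ran 86599 4 18 ∷ ran 45110 4 15 ∷ ran 50358 8 16 ∷ ran 46571 9 16 ∷ ran 208219 11 16 ∷
           ran 73563 10 14 ∷ ran 37487 4 17 ∷ ran 243513 0 18 ∷ ran 43450 3 14 ∷ ran 25817 4 16 ∷
           ran 52053 5 16 ∷ ran 64136 4 14 ∷ cel 317 0 730998681663000000000000000000000 ∷
           cel 1 0 180063169301000000000000000000000 ∷ cel 525 1 539998785570121130000004033028025 ∷
           cel 1 1 445343316429266486000136229358273 ∷ cel 247 2 996000000893088000000902427000000 ∷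
           cel 1 2 247000000001093000000210010000000 ∷ cel 179 3 997000000000000000007000 ∷
           cel 1 3 104000000000000000074000 ∷ cel 21 5 966000000000000000667000000000 ∷
           cel 1 5 19000000000000000003000000000 ∷ cel 2680 7 474000463000000092000580000998300488000 ∷
           cel 3 7 555000092000000041000018000822394749000 ∷ fac 97998 5 3 ∷ fac 478534 7 3 ∷
           fac 187042 3 2 ∷ fac 75757 5 1 ∷ fac 776381 7 1 ∷ fac 405307 7 2 ∷ fac 95774 5 0 ∷
           fac 244806 1 0 ∷ fac 78843 2 2 ∷ sqr 2770 31 7131077096071007030065092088030006 ∷
           sqr 1705 86 85000012051104095151186171071087090100 ∷
           sqr 911 85 89000137180062148108091102136185109097 ∷
           sqr 1067 36 5011067136114023117051002103082018000 ∷
           sqr 3175 100 75046111138114158156127100079103102 ∷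
           sqr 1205 75 84050175076000066091105103064125077077 ∷
           sqr 370 95 88112111110127120195185170013000047057 ∷
           sqr 597 100 138132143007106129110020124124098094 ∷
           sqr 709 43 29000098103050010079004032079143041050 ∷
           sqr 300 41 35067119074141000049006049050086020005 ∷
           sqr 353 100 68109039165000164146128081062127089101 ∷
           sqr 395 100 106089134110102078113087189000109105105 ∷ [])))
        (branch 0 10 304
         (branch 0 4 206
          (branch 0 6 256
           (leaf (ran 1468 4 14 ∷ ran 15864 4 17 ∷ ran 6289 6 15 ∷ ran 20319 0 16 ∷ ran 9714 9 16 ∷
             ran 1488 5 17 ∷ ran 5589 11 14 ∷ ran 9249 0 18 ∷ ran 3911 3 17 ∷ ran 588 7 17 ∷ ran 6978 10 14 ∷
             ran 7515 8 14 ∷ ran 5387 6 17 ∷ ran 680 6 16 ∷ cel 17 0 993393000000000000000000193 ∷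
             cel 1 0 3004000000000000000000009 ∷ cel 20 1 586986125887232000204000088104000000 ∷
             cel 1 1 11003011020000016000012004000000 ∷ cel 19 2 32000000000000000243000406985146000 ∷
             cel 1 2 4000000000000000010000009009010000 ∷ cel 19 3 972484000000000000000000000 ∷
             cel 1 3 16003000000000000000000000 ∷ cel 20 4 54075000000163000000000977151000000 ∷
             cel 1 4 18006000000014000000000015010000000 ∷ cel 5 5 892000000000000000000000000 ∷
             cel 1 5 4000000000000000000000000 ∷ cel 16 7 965000000000000000204000000000 ∷
             cel 1 7 15000000000000000005000000000 ∷ cel 1 8 685000 ∷
             cel 253 9 71000000000013214000154178997321634000 ∷
             cel 1 9 6000000000150226000123120209131075000 ∷ fac 4608 7 5 ∷ fac 135691 9 5 ∷ fac 32829 9 8 ∷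
             fac 13700 5 4 ∷ fac 3930 8 3 ∷ fac 204 7 3 ∷ fac 16781 5 2 ∷ fac 5612 8 2 ∷ fac 2082 3 1 ∷
             fac 1844 7 1 ∷ fac 3999 2 0 ∷ fac 13133 4 0 ∷ fac 11856 3 0 ∷ fac 4372 5 0 ∷ fac 16922 9 0 ∷
             fac 4411 9 2 ∷ sqr 97209 2 3001002002003006006005004003003000000 ∷
             sqr 72812 1 1000000001003005002005003002000001000 ∷
             sqr 67360 4 4005006004004000003002002006005005004 ∷ sqr 71136 1 1002002002003001005003002000 ∷
             sqr 40497 4 6004005005002002000003005002007004005 ∷
             sqr 19169 3 4005004005005004000001005005007003000 ∷
             sqr 26563 2 1000001003002003001005003004006002001 ∷ fac 330 4 3 ∷ []))
           (branch 0 9 301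
            (leaf (ran 1885 4 14 ∷ ran 247 8 16 ∷ ran 1360 8 15 ∷ ran 1504 6 16 ∷ ran 114 10 17 ∷
              ran 70 7 16 ∷ ran 331 3 14 ∷ ran 1466 0 18 ∷ ran 886 0 16 ∷ ran 243 5 14 ∷ ran 919 9 16 ∷
              ran 599 11 17 ∷ ran 501 9 14 ∷ ran 1035 7 17 ∷
              cel 3 0 114000039000000209451000000891032000000 ∷ cel 1 0 1000000002000000000002001000000 ∷
              cel 1 1 449000000 ∷ cel 3 2 737101540000000422000146093000000 ∷
              cel 1 2 2001000000001000003001000000 ∷ cel 3 3 52000000000036169000000173729000000 ∷
              cel 1 3 1001000000000002000000 ∷ cel 1 4 166000 ∷ cel 1 6 344000000000000000000000000 ∷
              cel 2 8 977000000000000000000000057000 ∷ cel 1 8 1000000000000000000000001000 ∷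
              cel 1 9 218000000 ∷ cel 24 10 402094030189000000083000000991404771000 ∷
              cel 1 10 22022002009000000002000000022014024000 ∷ fac 409 8 6 ∷ fac 6161 10 6 ∷ fac 6196 10 9 ∷
              fac 571 9 4 ∷ fac 1977 6 3 ∷ fac 262 9 3 ∷ fac 89 4 2 ∷ fac 4121 10 2 ∷ fac 1083 9 1 ∷
              fac 136 8 2 ∷ fac 425 8 1 ∷ fac 1794 9 0 ∷ fac 1716 6 0 ∷
              sqr 18903 2 3001002002003006006005004003003000000 ∷
              sqr 8946 3 4006003005005007003004004000000001001 ∷
              sqr 6635 2 1002002002002003006005003000002001 ∷
              sqr 16189 3 2004003004004005007003006004003002 ∷
              sqr 5293 4 3002002008007008005007006004004003 ∷ sqr 8070 4 3002004004008007006005004006004003 ∷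
              fac 270 2 1 ∷ fac 717 9 6 ∷ []))
            (leaf (ran 11912 4 14 ∷ ran 10054 8 16 ∷ ran 7307 6 16 ∷ ran 788 10 17 ∷ ran 12806 0 17 ∷
              ran 2452 5 14 ∷ ran 8214 9 16 ∷ ran 2303 3 17 ∷ ran 6970 10 16 ∷ ran 6962 7 15 ∷
              ran 4766 11 14 ∷ ran 4037 7 14 ∷ ran 2711 9 18 ∷ ran 2569 4 18 ∷
              cel 5 0 856000000000000000000000000 ∷ cel 1 0 2000000000000000000000000 ∷
              cel 6 1 163000263000378000000000354842000000 ∷ cel 1 1 2000003000006000000000005005000000 ∷
              cel 15 2 335936000000459000077000000000 ∷ cel 1 2 6014000000008000002000000000 ∷
              cel 18 3 16098000000054000000000000276953076000 ∷ cel 1 3 7000000006000000000000006001006000 ∷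
              cel 1 4 164000000000 ∷ cel 23 5 219000000000979236000000 ∷ cel 1 5 23000000000004003000000 ∷
              cel 2 6 743000000000000000000354000 ∷ cel 1 6 1000000000000000000000000 ∷
              cel 17 8 964000000000000000000061000000 ∷ cel 1 8 13000000000000000000014000000 ∷
              cel 195 10 737139000000000042047000000995236629000 ∷
              cel 1 10 75151000000000034120000000167045004000 ∷ fac 2662 8 6 ∷ fac 51376 10 6 ∷
              fac 11950 10 9 ∷ fac 6165 6 5 ∷ fac 3844 9 4 ∷ fac 16600 6 3 ∷ fac 4629 9 3 ∷ fac 3178 4 2 ∷
              fac 10597 3 2 ∷ fac 85499 10 2 ∷ fac 10075 9 1 ∷ fac 2229 8 2 ∷ fac 3714 8 1 ∷ fac 973 5 0 ∷
              fac 9869 1 0 ∷ fac 6550 4 0 ∷ fac 9392 8 0 ∷ fac 15222 2 0 ∷ fac 661 2 1 ∷ fac 745 5 3 ∷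
              sqr 20605 4 7001003003007014014011008007006000000 ∷
              sqr 11822 10 7005005019018019012016016010011008 ∷
              sqr 20805 10 12013014011015013017012010007010007 ∷ sqr 8268 5 3005006009009013015009009001003 ∷
              sqr 7505 10 7015011011006018018007018018010008 ∷
              sqr 8324 4 2001000004004011007014007006003005003 ∷
              sqr 3190 9 10010008019014000009011008014015009005 ∷
              sqr 3396 5 5005004009015011005001008014005002 ∷ []))))
          (branch 2 2 28
           (leaf (ran 16634 6 16 ∷ ran 19511 5 17 ∷ ran 18354 8 14 ∷ ran 16302 5 15 ∷ ran 2011 5 14 ∷
             ran 2432 0 15 ∷ ran 8806 7 15 ∷ ran 15794 9 14 ∷ ran 25392 4 16 ∷ ran 1820 4 18 ∷
             ran 4153 10 14 ∷ ran 12234 11 18 ∷ cel 18 0 79296000295000000207982000000067 ∷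
             cel 1 0 6013000012000000001004000000012 ∷ cel 37 1 680996000745092000000000 ∷
             cel 1 1 4016000001037000000000 ∷ cel 12 2 533000000000000485000560955000032000 ∷
             cel 1 2 5000000000000010000004011000008000 ∷ cel 37 4 37074000000114317000000979000000000 ∷
             cel 1 4 12025000000027002000000030000000000 ∷ cel 9 5 330000000000000000000914000 ∷
             cel 1 5 3000000000000000000007000 ∷ cel 11 7 942000000000000000000000000000 ∷
             cel 1 7 2000000000000000000000000000 ∷ cel 4 8 602997000000000000000977000 ∷
             cel 1 8 4002000000000000000003000 ∷ cel 428 9 291000000000015057122000000996000751000 ∷
             cel 1 9 278000000000137365345000000353000233000 ∷ fac 26249 7 5 ∷ fac 115417 9 5 ∷
             fac 110205 9 8 ∷ fac 23178 5 4 ∷ fac 22401 8 3 ∷ fac 15284 8 4 ∷ fac 14843 8 1 ∷ fac 10863 8 2 ∷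
             fac 10887 5 2 ∷ fac 3949 5 1 ∷ fac 1189 3 0 ∷ fac 17459 2 0 ∷ fac 130440 9 0 ∷
             sqr 4235 22 33026028029033039052028035000008008012 ∷
             sqr 6139 30 44041035031030023030018000019016035034 ∷
             sqr 4704 11 14002008000020015028019041029015008003 ∷
             sqr 2196 25 21018018042053042051055032030021013 ∷
             sqr 2373 30 22030032034028029052001000039038030033 ∷
             sqr 1610 16 22000005020019046046042011014011016013 ∷
             sqr 1491 17 22030027025036047017038004014008005 ∷
             sqr 2306 8 9000015012013008023008002038017006001 ∷
             sqr 824 22 24025000025021036032052011016009022018 ∷
             sqr 698 27 35000006022031051038057046042036027025 ∷
             sqr 1702 17 7011020018029047038023020015016013 ∷
             sqr 1448 10 18002024025007013009011025040014010000 ∷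
             sqr 678 30 33042037035035008024011034000023030035 ∷
             sqr 94 20 23030030046020032002000043050034020001 ∷ []))
           (branch 0 10 313
            (leaf (ran 705 6 14 ∷ ran 2307 5 16 ∷ ran 1055 5 18 ∷ ran 1714 9 14 ∷ ran 232 3 17 ∷
              ran 420 11 17 ∷ ran 929 7 14 ∷ ran 884 6 15 ∷ ran 936 8 14 ∷ ran 290 4 17 ∷ ran 227 8 16 ∷
              ran 514 4 18 ∷ ran 106 10 17 ∷ cel 3 0 160000000000000209000000000897000000 ∷
              cel 1 0 1000000000000002000000000001000000 ∷ cel 2 1 563000000 ∷ cel 1 1 1000000 ∷
              cel 4 2 67000263000462770000710000050000000 ∷ cel 1 2 2000002000002001000003000002000000 ∷
              cel 4 5 22000000000108094000084804000000000 ∷ cel 1 5 3002000004002000000000 ∷ cel 1 6 844000 ∷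
              cel 3 8 881000000000000000000000000000 ∷ cel 1 8 1000000000000000000000000000 ∷
              cel 1 9 267000 ∷ cel 31 10 540050000000000000000000000502000998000 ∷
              cel 1 10 8013000000000000000000000010000010000 ∷ fac 1200 8 6 ∷ fac 6064 10 6 ∷ fac 7681 10 9 ∷
              fac 1697 6 5 ∷ fac 1357 9 4 ∷ fac 546 9 5 ∷ fac 1288 9 2 ∷ fac 223 9 0 ∷ fac 321 6 0 ∷
              sqr 6829 5 1003005005007005009015009010003004 ∷ sqr 3183 6 3004007006010016013008007005006005 ∷
              sqr 1822 6 4000003003007010008010013016013009005 ∷
              sqr 1917 10 15012007011006012000013006005009011011 ∷
              sqr 1768 4 5001003000007005010007014010005003001 ∷
              sqr 413 8 7006006014017014017018010010007004 ∷
              sqr 2284 8 18011009010009007010002000006005003008 ∷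
              sqr 790 9 15006010010005009008019009007000009010 ∷
              sqr 466 10 10012016011011008007006012000006010012 ∷
              sqr 338 8 8007001008007012010018012002000009008 ∷
              sqr 535 4 9000001001005005008003014003004006004 ∷
              sqr 316 9 12000002007010017013019015014012009008 ∷
              sqr 473 5 3004006006009012015006013008002001 ∷
              sqr 992 10 4014012013009011009011000015012008009 ∷
              sqr 841 4 14002006006005007009011005000000001002 ∷
              sqr 172 4 3001003004008007013000009012014001000 ∷ []))
            (leaf (ran 1857 10 14 ∷ ran 9125 5 16 ∷ ran 4338 9 14 ∷ ran 491 3 17 ∷ ran 4887 7 14 ∷
              ran 4999 9 15 ∷ ran 7437 8 14 ∷ ran 8181 6 18 ∷ ran 4959 4 17 ∷ ran 3830 5 17 ∷ ran 8182 5 14 ∷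
              ran 6249 11 16 ∷ cel 9 1 985000000 ∷ cel 1 1 3000000 ∷
              cel 24 2 20331000578976000646053000000000 ∷ cel 1 2 17007000022021000006020000000000 ∷
              cel 13 3 447000000158940073000 ∷ cel 1 3 3000000002007004000 ∷
              cel 21 5 131000000058256000000963000000000 ∷ cel 1 5 14000000018015000000020000000000 ∷
              cel 5 6 916000 ∷ cel 1 6 2000 ∷ cel 15 8 993000000000000000000000000000 ∷
              cel 1 8 15000000000000000000000000000 ∷ cel 4 9 741000000000000000867000 ∷
              cel 1 9 1000000000000000004000 ∷ cel 195 10 214000000073000079000282058552152995000 ∷
              cel 1 10 172000000078000107000034181166138167000 ∷ fac 7513 8 6 ∷ fac 20907 10 9 ∷
              fac 8024 6 5 ∷ fac 9465 9 4 ∷ fac 2928 9 5 ∷ fac 6679 9 2 ∷ fac 4083 9 3 ∷ fac 1573 6 3 ∷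
              fac 1081 8 1 ∷ fac 2236 3 0 ∷ fac 3636 1 0 ∷ fac 6658 8 0 ∷ fac 2461 2 0 ∷ fac 4332 10 3 ∷
              fac 878 2 1 ∷ sqr 5131 30 44041035031030023030018000019016035034 ∷
              sqr 963 30 31033051031033017023000017048055028030 ∷
              sqr 915 25 21018018042053042051055032030021013 ∷
              sqr 726 27 35000006022031051038057046042036027025 ∷
              sqr 862 12 7008013017018029033042016016006 ∷ sqr 1155 17 7011020018029047038023020015016013 ∷
              sqr 688 12 9004009013024022040001026036042004000 ∷
              sqr 665 30 44037020034019035000039017015027032034 ∷
              sqr 366 28 24017044040009039013058000034037023033 ∷
              sqr 309 30 44023029034021040005041000049057029032 ∷
              sqr 337 28 23021008021036032047031058024000036029 ∷
              sqr 670 30 35035037035020044017027023000028033035 ∷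
              sqr 213 30 20043032058037048000021043041031037020 ∷ [])))))
         (branch 0 6 254
          (leaf (ran 2250 4 16 ∷ ran 2062 11 14 ∷ ran 2109 6 16 ∷ ran 1147 5 16 ∷ ran 1466 10 17 ∷
            ran 1655 11 15 ∷ ran 1991 11 18 ∷ ran 1881 4 14 ∷ ran 558 9 14 ∷ ran 173 6 13 ∷ ran 964 3 17 ∷
            ran 920 8 16 ∷ cel 4 0 266792357000679000000000031000 ∷ cel 1 0 3003000000001000000000004000 ∷
            cel 6 1 920897457336000000000000000123148 ∷ cel 1 1 4005003006000000000000000004001 ∷
            cel 3 2 870000875000000440000154000000000 ∷ cel 1 2 2000003000000002000002000000000 ∷
            cel 4 3 352000000615000385000833101000000 ∷ cel 1 3 3000000003000003000004002000000 ∷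
            cel 5 4 49972000000000000000118000 ∷ cel 1 4 1005000000000000000001000 ∷
            cel 2 6 847859000000000000000000000000000 ∷ cel 1 6 1001000000000000000000000000000 ∷
            cel 53 8 288000493000000000000000096986356550000 ∷
            cel 1 8 24000050000000000000000049044005012000 ∷ fac 1178 6 4 ∷ fac 2069 4 3 ∷ fac 1378 7 2 ∷
            fac 2627 6 1 ∷ fac 910 2 1 ∷ fac 20564 8 3 ∷ fac 14772 8 4 ∷ fac 2494 2 0 ∷ fac 566 4 2 ∷
            fac 6401 8 0 ∷ sqr 2624 10 5014012010012008016014019017013010 ∷
            sqr 3367 10 3000012017015010020017017013016010009 ∷
            sqr 5047 6 6000016011008009004006013010012006006 ∷
            sqr 4388 10 7013015011009002000006012011010012010 ∷
            sqr 647 9 13009018019010014000003013015014010007 ∷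
            sqr 1533 10 6015014007001012000006007011014013011 ∷
            sqr 695 4 5002008012004000007001000012014003002 ∷
            sqr 1639 6 4000010014009009010013006016010008004 ∷
            sqr 2640 10 11010011003007010017013013000006010011 ∷
            sqr 337 10 8014018011010015016019013018008005 ∷ fac 362 3 1 ∷ []))
          (leaf (ran 201810 11 16 ∷ ran 59899 10 14 ∷ ran 24046 6 16 ∷ ran 53096 7 14 ∷ ran 19394 3 18 ∷
            ran 4558 5 14 ∷ ran 76602 4 15 ∷ ran 31598 8 17 ∷ ran 27914 5 18 ∷ ran 4223 5 15 ∷
            ran 43186 9 17 ∷ ran 25764 6 18 ∷ ran 15932 11 17 ∷ ran 28324 8 13 ∷
            cel 114 0 47000000018147000990318020000000 ∷ cel 1 0 95000000101094000062004096000000 ∷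
            cel 136 1 993866409000000000000000000316606 ∷ cel 1 1 135134115000000000000000000091130 ∷
            cel 46 2 989000000000000000000000000000000 ∷ cel 1 2 21000000000000000000000000000000 ∷
            cel 157 3 141000000099000017000993137000000 ∷ cel 1 3 123000000102000093000015107000000 ∷
            cel 52 4 998000000000651096279000 ∷ cel 1 4 46000000000034039034000 ∷
            cel 227 6 994641218000000055000000000000000 ∷ cel 1 6 193113027000000004000000000000000 ∷
            cel 11 7 992000000000000000000458000 ∷ cel 1 7 2000000000000000000008000 ∷
            cel 2062 8 314000589034000046023000000998437306000 ∷
            cel 2 8 675000258294000855588000000719035222000 ∷ fac 430390 8 7 ∷ fac 55315 4 3 ∷
            fac 63401 7 2 ∷ fac 223143 6 1 ∷ fac 728163 8 3 ∷ fac 479102 8 4 ∷ fac 52611 7 0 ∷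
            fac 61033 1 0 ∷ fac 13998 7 6 ∷ fac 48194 7 3 ∷ fac 18372 6 0 ∷
            sqr 1743 100 70132152112094015000057120109099121105 ∷
            sqr 1340 61 60000161107085096042056127098117058063 ∷
            sqr 567 66 145166139072071083111043016005000012010 ∷
            sqr 823 56 50082011073068155156089054000060054018 ∷
            sqr 643 60 37000105139094094105126056160102077037 ∷
            sqr 714 62 54067104124128068162102084105080035000 ∷
            sqr 319 93 193000145145159093132169147161148093067 ∷
            sqr 518 100 81105085000131140146103155075075106097 ∷
            sqr 215 100 142081127098106000029045089138136116126 ∷ [])))))
       (branch 0 10 303
        (branch 0 5 236
         (leaf (ran 1474764 4 18 ∷ ran 914651 10 16 ∷ ran 3340859 4 17 ∷ ran 104567 6 16 ∷ ran 853578 5 15 ∷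
           ran 453013 7 18 ∷ ran 7079045 0 16 ∷ ran 621782 3 18 ∷ ran 1953055 8 16 ∷ ran 5833530 10 18 ∷
           ran 1720875 5 14 ∷ ran 952500 11 14 ∷ ran 579965 8 14 ∷ ran 2014660 9 14 ∷
           cel 14802 0 837998597314194000000000000000 ∷ cel 15 0 169955504668715000000000000000 ∷
           cel 6993 1 67000010000000998000665067527061000 ∷ cel 7 1 856000567000000904000293156631327000 ∷
           cel 3655 2 998599000000000723000114016000 ∷ cel 4 2 722892000000000510000352011000 ∷
           cel 1260 3 570998000000000232531000 ∷ cel 2 3 614566000000000001345000 ∷
           cel 3513 5 998000000000000000000000000000 ∷ cel 3 5 929000000000000000000000000000 ∷
           cel 81165 7 233000000000000161045480000998088537000 ∷
           cel 81 7 430000000000000607722077000991602816000 ∷ fac 2397853 5 3 ∷ fac 24386374 7 3 ∷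
           fac 5294538 5 2 ∷ fac 1467942 3 1 ∷ fac 2214817 1 0 ∷ fac 3375617 2 0 ∷ fac 16807022 7 0 ∷
           fac 8814827 7 4 ∷ fac 4951689 4 2 ∷ fac 644619 2 1 ∷ fac 706499 5 0 ∷ fac 2426628 7 1 ∷
           sqr 5806 241 129108503618614641457391303226130151 ∷
           sqr 4174 400 46000046684713656607601483775661467474 ∷
           sqr 6538 183 232000077396347583506452377183127114099 ∷
           sqr 3560 400 726715770367320426541461538000110155178 ∷
           sqr 1401 400 104185746119741461619451638460535495 ∷
           sqr 942 274 76112517280531446674452366258254242 ∷
           sqr 1171 214 228240449406614129062000253358523211100 ∷
           sqr 843 181 543000100302581577284159283286160216127 ∷
           sqr 909 318 366313355607718607203000397475469377230 ∷
           sqr 1085 115 75146159160515328087024229225254021000 ∷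
           sqr 1061 147 121142340167547310180000310206266133042 ∷
           sqr 695 173 210259312573434131114000080321501060030 ∷
           sqr 451 399 144130369427799519721611533319497464 ∷
           sqr 289 153 194018000412383553324201182333168169098 ∷
           sqr 213 400 586495654674634301467000366392706377297 ∷
           sqr 577 400 410447482362698374281000338536558443427 ∷
           sqr 380 400 530424545307125000480526357253487247409 ∷
           sqr 572 214 206275240291614273238000206352420211118 ∷
           sqr 141 400 431696735405671645785613593000139076114 ∷
           sqr 193 273 77170000219634673356397361412229304281 ∷ []))
         (branch 0 1 126
          (leaf (ran 254838 10 16 ∷ ran 159915 6 14 ∷ ran 545867 10 14 ∷ ran 79752 11 14 ∷ ran 202227 4 17 ∷
            ran 107747 6 15 ∷ ran 47476 5 17 ∷ ran 37999 9 17 ∷ ran 158480 9 16 ∷ ran 126662 3 15 ∷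
            ran 245114 8 16 ∷ ran 40755 7 15 ∷ cel 239 0 490000201122000385929996000000 ∷
            cel 1 0 102000042080000128168184000000 ∷ cel 351 1 42000000822000997412000129000 ∷
            cel 1 1 58000000340000165294000322000 ∷ cel 485 2 49095000085000000070000740143997028000 ∷
            cel 1 2 191287000480000000133000289456141112000 ∷ cel 686 3 776662375000000315000998000000 ∷
            cel 1 3 394578549000000425000191000000 ∷ cel 109 4 180000000000000997000000 ∷
            cel 1 4 107000000000000075000000 ∷ cel 513 6 837997000000000000000000016000 ∷
            cel 1 6 469373000000000000000000499000 ∷ cel 5888 8 213013000000000112171000280670133998000 ∷
            cel 6 8 763961000000000447911000202845356897000 ∷ fac 217278 6 4 ∷ fac 396575 6 3 ∷
            fac 94026 7 2 ∷ fac 349171 7 1 ∷ fac 168368 3 1 ∷ fac 799384 3 0 ∷ fac 120854 7 0 ∷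
            fac 49113 6 0 ∷ fac 355581 8 7 ∷ sqr 2541 92 105123125070142137192126182000043023044 ∷
            sqr 2719 72 85113145163098067088108169172040003 ∷
            sqr 2717 49 149076092077093086112042063004016000003 ∷
            sqr 4031 100 112118103134085000093008037073146102126 ∷
            sqr 3621 100 127110108090106070026000084139144106111 ∷
            sqr 3979 64 67043030029068109164116069019000066070 ∷
            sqr 1161 84 175160184116117081116084108027073000009 ∷
            sqr 1323 67 69065109012105120148167165055063000006 ∷
            sqr 1652 100 38001000164130102099117090172172166146 ∷
            sqr 2273 50 48035079094085087120150055088071025000 ∷
            sqr 2684 100 122125096119106052032000085104118106114 ∷
            sqr 925 85 134080142116123091000145121185167068027 ∷
            sqr 555 66 89043076105079000000065080118166075059 ∷
            sqr 383 40 61000021070095111140076067022025032025 ∷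
            sqr 291 41 73000035065021103067141013084011063034 ∷ fac 206864 3 3 ∷ []))
          (leaf (ran 3030 6 17 ∷ ran 10847 10 16 ∷ ran 2966 8 14 ∷ ran 5590 6 18 ∷ ran 3043 9 17 ∷
            ran 1180 6 16 ∷ ran 3265 4 15 ∷ ran 6065 10 14 ∷ ran 3088 5 16 ∷ ran 1782 3 17 ∷ ran 1381 9 15 ∷
            ran 4392 11 16 ∷ cel 11 0 620911206000000000000000021000 ∷ cel 1 0 7002008000000000000000002000 ∷
            cel 12 1 532000917000000000000 ∷ cel 1 1 3000003000000000000 ∷
            cel 9 2 107000000000000302000988000116000000 ∷ cel 1 2 3000000000000007000005000009000000 ∷
            cel 8 3 316000972573182000000701000484113157 ∷ cel 1 3 7000007000008000000006000005002006 ∷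
            cel 20 6 990667000000000132029000000000 ∷ cel 1 6 9003000000000014011000000000 ∷
            cel 3 7 943304000000000000000000000 ∷ cel 1 7 3002000000000000000000000 ∷
            cel 116 8 439088000000126317401000000990000520000 ∷
            cel 1 8 108004000000084069083000000067000073000 ∷ fac 1335 6 4 ∷ fac 14632 8 7 ∷ fac 18050 6 3 ∷
            fac 3120 7 2 ∷ fac 8763 7 1 ∷ fac 5707 3 1 ∷ fac 5246 8 4 ∷ fac 2395 5 0 ∷ fac 6300 2 0 ∷
            fac 2793 4 0 ∷ fac 973 7 6 ∷ fac 955 6 2 ∷ fac 20233 8 5 ∷
            sqr 941 16 11001000030021038043046014023014016013 ∷
            sqr 810 24 32014001028040054042005000044021024030 ∷
            sqr 944 12 18000006021029033042023020007007010008 ∷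
            sqr 826 30 54035025031024000008019022031036036034 ∷
            sqr 1199 30 22015042035031034056041051040030025 ∷
            sqr 830 30 20032026039041020000019050058048030025 ∷
            sqr 368 22 29023011000014052020024024044016022016 ∷ []))))
        (branch 0 6 256
         (branch 0 1 127
          (leaf (ran 3720 3 17 ∷ ran 2487 11 17 ∷ ran 6211 11 15 ∷ ran 6194 10 14 ∷ ran 675 6 17 ∷
            ran 1844 5 17 ∷ ran 9371 0 16 ∷ ran 1430 8 17 ∷ ran 4459 10 19 ∷ ran 2075 11 18 ∷
            ran 9482 11 14 ∷ ran 2900 9 18 ∷ ran 3903 4 18 ∷ cel 10 0 302905000000179427200000158 ∷
            cel 1 0 9005000000005003007000007 ∷ cel 21 1 893955683000000000000162000000 ∷
            cel 1 1 12013007000000000000002000000 ∷ cel 21 2 954954283000000000186171000000084 ∷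
            cel 1 2 1004004000000000004010000000009 ∷ cel 12 3 494000000000000306000931211000 ∷
            cel 1 3 5000000000000011000004008000 ∷ cel 17 4 963000000000008000000000 ∷
            cel 1 4 11000000000015000000000 ∷ cel 14 6 991000000000102000000000041000 ∷
            cel 1 6 2000000000003000000000009000 ∷ cel 10 7 351000949988000000000000000000 ∷
            cel 1 7 2000005010000000000000000000 ∷ cel 116 8 320231000000000006000111000629274990000 ∷
            cel 1 8 76061000000000016000037000035080067000 ∷ fac 1448 6 4 ∷ fac 8044 6 3 ∷ fac 4086 5 3 ∷
            fac 44962 8 1 ∷ fac 43651 8 4 ∷ fac 7553 3 1 ∷ fac 2109 7 0 ∷ fac 5439 1 0 ∷ fac 7454 2 0 ∷
            fac 7088 3 0 ∷ fac 731 3 2 ∷ fac 1112 7 6 ∷ fac 25167 8 5 ∷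
            sqr 16928 7 1000010016014011001005009017015010009 ∷
            sqr 24749 9 2013019012014014013013013014010009 ∷
            sqr 32511 8 7004000009009011018013008009006007008 ∷
            sqr 15340 7 1000014006003001017013010007009009008 ∷ fac 3476 6 2 ∷ fac 378 7 3 ∷ []))
          (leaf (ran 2423 11 15 ∷ ran 5485 11 18 ∷ ran 2700 5 14 ∷ ran 90 4 14 ∷ ran 7216 4 17 ∷
            ran 760 6 19 ∷ ran 833 9 16 ∷ ran 2726 3 14 ∷ ran 1718 4 19 ∷ ran 4790 11 16 ∷ ran 6969 10 16 ∷
            cel 7 0 548962324000236000000000100057000 ∷ cel 1 0 3004004000001000000000004004000 ∷
            cel 18 1 706954447000000000000000000000 ∷ cel 1 1 4006000000000000000000000 ∷
            cel 20 2 918989506151000000063000000000000 ∷ cel 1 2 3015010002000000002000000000000 ∷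
            cel 8 3 96000000886000000063000 ∷ cel 1 3 8000000005000000006000 ∷
            cel 11 4 630924000000000000189000000 ∷ cel 1 4 8000000000000008000000 ∷
            cel 1 6 342000000000000000000000000000 ∷ cel 8 7 945000578702000000000000013000 ∷
            cel 1 7 6000002007000000000000004000 ∷ cel 89 8 861000228000117135000000194993000452000 ∷
            cel 1 8 56000084000076064000000054013000051000 ∷ fac 4846 6 4 ∷ fac 848 8 7 ∷ fac 1662 6 3 ∷
            fac 5732 5 3 ∷ fac 22675 8 1 ∷ fac 39852 8 4 ∷ fac 3743 3 1 ∷ fac 3972 6 2 ∷ fac 2319 6 0 ∷
            fac 696 5 0 ∷ fac 10049 8 0 ∷ fac 673 0 0 ∷ fac 391 7 3 ∷ fac 32873 8 5 ∷ fac 2939 2 2 ∷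
            sqr 10261 7 1000010016014011001005009017015010009 ∷
            sqr 5490 5 4004011010013015013011013000000001001 ∷
            sqr 13490 8 7004000009009011018013008009006007008 ∷
            sqr 5171 5 3000015015009002010009009007009005003 ∷
            sqr 5170 4 1000010007005002014010009001004004003 ∷
            sqr 17795 3 13001001005007009008006006001000001001 ∷
            sqr 14300 10 17013013004003000001003004011013012012 ∷
            sqr 8944 9 2013019012014014013013013014010009 ∷
            sqr 7922 3 4000011013009005000002008006006001002 ∷
            sqr 4528 7 8009000010017014001004007009006007007 ∷
            sqr 581 7 7009009008006006010013000008017003003 ∷ [])))
         (leaf (ran 37737 11 16 ∷ ran 358 11 18 ∷ ran 8820 9 17 ∷ ran 9141 10 15 ∷ ran 7693 5 18 ∷
           ran 5721 7 18 ∷ ran 2083 6 18 ∷ ran 5467 6 14 ∷ ran 11453 8 14 ∷ ran 7186 10 17 ∷ ran 7478 4 18 ∷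
           ran 5786 11 13 ∷ cel 17 0 488000979299111000000 ∷ cel 1 0 4000013009001000000 ∷
           cel 47 1 982000076000000000000000000000330 ∷ cel 1 1 1000044000000000000000000000035 ∷
           cel 17 2 958229000000000000000000306000 ∷ cel 1 2 7004000000000000000000004000 ∷
           cel 3 3 149906000 ∷ cel 1 3 2000000 ∷ cel 2 4 949000000000 ∷
           cel 20 5 952484000000000000000000000041 ∷ cel 1 5 15002000000000000000000000003 ∷
           cel 10 6 983000000801000000000000144000 ∷ cel 1 6 6000000008000000000000009000 ∷
           cel 329 7 536000440401100000000000048997225231000 ∷
           cel 1 7 123000233221257000000000222172034263000 ∷ fac 5105 5 3 ∷ fac 112085 7 6 ∷ fac 27332 5 2 ∷
           fac 8909 4 2 ∷ fac 23697 6 0 ∷ fac 15067 1 0 ∷ fac 5518 6 5 ∷ fac 26226 7 3 ∷ fac 32461 7 0 ∷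
           fac 5272 5 1 ∷ fac 9430 4 1 ∷ fac 10327 7 4 ∷ sqr 7511 30 14037042052060059054047036031026025 ∷
           sqr 3821 17 41036047027022032017010016000004005001 ∷
           sqr 2513 30 17013000035030035029038035042037038039 ∷
           sqr 1466 30 43000043046041031048042038055042023031 ∷
           sqr 1717 12 8000042025021005009006015027023017013 ∷
           sqr 959 14 11000041018038031012017044020016009010 ∷
           sqr 1425 26 56037000031037050035027017021013019014 ∷
           sqr 1534 8 11000019038017013001014022018016008001 ∷
           sqr 1388 12 14000032033016042004007026020016013010 ∷
           sqr 762 18 30007000037022048029027008025018022016 ∷
           sqr 1186 16 33000046017023013011007025022027016020 ∷
           sqr 1195 11 12009006041016018019018000023011013004 ∷
           sqr 475 30 35038044000022024015005032021034034036 ∷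
           sqr 86 14 19009000044042026016024029036011014000 ∷ []))))))
     (leaf (ran 40273 10 16 ∷ ran 28654 10 17 ∷ ran 23081 10 18 ∷ ran 7247 10 14 ∷ ran 13503 8 18 ∷
       ran 2074 10 15 ∷ ran 3500 11 18 ∷ ran 4699 7 18 ∷ ran 2656 10 13 ∷ ran 2479 4 14 ∷ ran 8133 6 16 ∷
       ran 8441 9 16 ∷ ran 3737 5 18 ∷ cel 59 0 121020000990751110000000423379474716771 ∷
       cel 1 0 18053000053026058000000045014037027011 ∷ cel 12 1 939774000000000093000000322464 ∷
       cel 1 1 7005000000000011000000010009 ∷ cel 100 2 18990826463326000000000000026009 ∷
       cel 1 2 59002096039071000000000000036091 ∷ cel 428 3 223000000000000000000864480996076148007 ∷
       cel 1 3 72000000000000000000152334353306367373 ∷ fac 70213 1 0 ∷ fac 46083 2 0 ∷ fac 35795 2 1 ∷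
       sqr 4002 16 17011025018000014022046017008016017014 ∷ sqr 2107 14 7014021040025030044017025014008004 ∷
       sqr 2493 30 31032025045034024032000042026035026031 ∷
       sqr 2606 30 32033020026033045024000027026037038034 ∷ sqr 756 24 43041048024054044032029016008011005 ∷
       sqr 2234 30 37030032051039029040000027038034030028 ∷
       sqr 706 20 29023042013050048037050032022008009000 ∷
       sqr 1298 30 21036027036037028031000037025026034033 ∷
       sqr 696 29 30031035000059034026024029029029031028 ∷ sqr 261 11 8021019003041035017016008012005003000 ∷
       sqr 1656 11 41009015030029038026007017010012005000 ∷
       sqr 405 25 26021035022055000029031027028027025022 ∷ sqr 104 30 3032032050007000015015025034031039037 ∷
       fac 30022 0 0 ∷ [])))
    (branch 0 9 279
     (branch 0 4 198
      (branch 0 10 302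
       (branch 0 5 227
        (leaf (ran 280776 4 17 ∷ ran 126485 8 14 ∷ ran 88387 6 14 ∷ ran 11756 10 14 ∷ ran 329141 4 18 ∷
          ran 64847 11 16 ∷ ran 109836 10 16 ∷ ran 82822 7 16 ∷ ran 165113 9 14 ∷ ran 38532 4 16 ∷
          ran 33197 3 14 ∷ ran 47972 5 14 ∷ ran 60949 8 15 ∷ cel 390 0 356885684997336095000000000000000 ∷
          cel 1 0 245285381258048193000000000000000 ∷ cel 290 1 271000000000087792113000000996073000 ∷
          cel 1 1 45000000000109147231000000023027000 ∷ cel 360 2 134413000997178105304000077000000000 ∷
          cel 1 2 302206000287334058244000017000000000 ∷ cel 297 3 236000000427437000000997000000000 ∷
          cel 1 3 239000000219108000000286000000000 ∷ cel 573 4 743926998053000123119310263 ∷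
          cel 1 4 484322064083000019047216205 ∷ cel 3484 6 344044000084087000164291000986419998000 ∷
          cel 4 6 650069000411859000520209000410157802000 ∷ fac 1540454 6 4 ∷ fac 52967 4 3 ∷
          fac 149416 4 1 ∷ fac 328833 4 0 ∷ fac 1161039 6 0 ∷
          sqr 2843 45 40000020037145112078082064123100021024 ∷
          sqr 2021 64 40046064099164129129069109095068033 ∷
          sqr 2444 39 39023017063061071072018049120139000009 ∷
          sqr 1551 100 136146101065115113000034089025075104120 ∷
          sqr 1047 55 68000075076064120106141071155127042016 ∷
          sqr 1029 100 45125000092105154116107105099026105100 ∷
          sqr 368 92 129036000101118172185154112192099071062 ∷
          sqr 879 75 91105119102080090007000073077175073052 ∷
          sqr 1074 100 186119087113072041102000086083104104113 ∷
          sqr 517 79 96101086107109179000026066116109095054 ∷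
          sqr 456 100 135197073142056085027102065107117107 ∷
          sqr 297 88 19103068086146188000091089043032099097 ∷
          sqr 167 100 182086109053175127126160106094000105086 ∷
          sqr 254 100 103067110109136146127115182164079072 ∷
          sqr 111 88 73045157188000097091096079075117091096 ∷
          sqr 65 100 96121097119107128163000089123054147095 ∷ []))
        (branch 0 9 292
         (leaf (ran 2609 4 14 ∷ ran 595 9 14 ∷ ran 2165 7 17 ∷ ran 1025 8 17 ∷ ran 917 11 16 ∷
           ran 1880 9 18 ∷ ran 1045 8 18 ∷ ran 3194 6 14 ∷ ran 698 5 17 ∷ ran 2069 4 15 ∷ ran 800 4 19 ∷
           ran 1147 10 17 ∷ cel 5 0 16000000287185000000910110063000 ∷ cel 1 1 582000000 ∷
           cel 4 2 267000000000000460000000000854000000 ∷ cel 5 3 171000046887146000811000142000000000 ∷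
           cel 8 5 714881922000000158085044000 ∷ cel 53 7 222000000000000243054000000377538987000 ∷
           fac 5247 6 5 ∷ fac 28796 7 5 ∷ fac 29742 7 6 ∷ fac 2694 6 1 ∷ fac 1416 3 1 ∷ fac 965 6 2 ∷
           fac 1297 5 0 ∷ sqr 4611 10 14018019016017014018013003000001004004 ∷
           sqr 2704 5 4000005004004010005015007006008004005 ∷ sqr 2505 5 1003005009008012015008013005005003 ∷
           sqr 1976 3 3000002003004007000013005006004005002 ∷
           sqr 681 9 13003000010012017018015011019010007006 ∷
           sqr 3899 7 11012011011014011017007003002000005002 ∷
           sqr 1217 6 3009009010007012013007014016005002 ∷ sqr 683 9 14015012011001005000009002000000019011 ∷
           sqr 1797 10 8006011017013019005012019013008009 ∷
           sqr 2081 6 7000008008007012011015008016013005002 ∷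
           sqr 904 7 7000010004015013010017011015015008004 ∷ sqr 2437 4 3005005006014014006006004005002 ∷ []))
         (leaf (ran 10127 6 14 ∷ ran 14433 4 17 ∷ ran 1082 10 17 ∷ ran 2403 9 18 ∷ ran 2315 7 14 ∷
           ran 2501 8 15 ∷ ran 4438 8 18 ∷ ran 4574 9 16 ∷ ran 441 5 13 ∷ ran 5082 10 14 ∷ ran 1313 7 18 ∷
           ran 1461 11 15 ∷ ran 1141 5 18 ∷ ran 305 5 19 ∷ cel 5 0 671804000000000000000000000000 ∷
           cel 1 0 1002000000000000000000000000 ∷ cel 3 1 735228000000000000000200000 ∷
           cel 1 1 2000000000000000000002000 ∷ cel 13 2 130000000000000562147000159988050000 ∷
           cel 1 2 12000000000000004008000012004010000 ∷ cel 16 3 71142000043943235000800000000000000000 ∷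
           cel 1 3 4001000007010014000012000000000000000 ∷ cel 10 4 996000040000 ∷ cel 1 4 8000000000 ∷
           cel 21 5 675861980000000097148036000 ∷ cel 1 5 6010018000000018012019000 ∷
           cel 150 7 294000000064055344000000000442337995000 ∷
           cel 1 7 42000000060092054000000000108035129000 ∷ fac 13030 6 5 ∷ fac 88531 7 5 ∷ fac 2833 5 4 ∷
           fac 100187 7 6 ∷ fac 2106 5 2 ∷ fac 8919 6 1 ∷ fac 3642 3 1 ∷ fac 3930 6 2 ∷ fac 1089 4 2 ∷
           fac 1103 4 1 ∷ fac 1678 3 0 ∷ sqr 17199 10 14018019016017014018013003000001004004 ∷
           sqr 2214 7 11011013013014013017012002002000003001 ∷
           sqr 19337 3 3000002003004007000013005006004005002 ∷
           sqr 6579 7 15009008008017017015016006003002004000 ∷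
           sqr 3118 9 13003000010012017018015011019010007006 ∷
           sqr 2918 8 6000009013018015015011014014009004 ∷ sqr 6791 10 8006011017013019005012019013008009 ∷
           sqr 3964 6 7000008008007012011015008016013005002 ∷
           sqr 2041 9 14015012011001005000009002000000019011 ∷
           sqr 6024 5 1003005009008012015008013005005003 ∷ sqr 709 5 3000002001007010010015008005002006005 ∷
           sqr 1241 6 3009009010007012013007014016005002 ∷
           sqr 2307 10 9012013003011002010012011005000014012 ∷
           sqr 1578 10 12014016011011007000008007008019011009 ∷
           sqr 518 7 7000010004015013010017011015015008004 ∷ sqr 2610 4 3005005006014014006006004005002 ∷
           fac 941 5 3 ∷ fac 240 0 0 ∷ []))))
       (branch 0 5 229
        (leaf (ran 1315 4 17 ∷ ran 1099 10 15 ∷ ran 302 5 15 ∷ ran 772 6 17 ∷ ran 3381 4 14 ∷ ran 279 2 15 ∷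
          ran 4462 11 18 ∷ ran 368 7 19 ∷ ran 1085 9 17 ∷ ran 104 7 18 ∷ ran 1701 8 17 ∷
          cel 5 0 990881832745365000000000000000000 ∷ cel 1 0 3004001003004000000000000000000 ∷
          cel 7 1 725922549299000000000000098000092 ∷ cel 1 1 1005000003000000000000005000005 ∷
          cel 7 2 388779965543000076000104136000000 ∷ cel 1 2 1000007000000005000002001000000 ∷
          cel 2 3 882410000000741000000000 ∷ cel 1 3 1002000000000000000000 ∷
          cel 6 4 249578000617834278100000216134186121 ∷ cel 1 4 2002000000006005002000006000002006 ∷
          cel 31 6 196000000258345228000712438452592998000 ∷ cel 1 6 15000000012005019000005017016016010000 ∷
          fac 680 5 4 ∷ fac 4721 6 4 ∷ fac 3500 4 3 ∷ fac 10304 6 5 ∷ fac 3494 6 3 ∷ fac 3585 2 1 ∷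
          fac 2088 1 0 ∷ sqr 27569 4 1007007005005007005005007008003004 ∷
          sqr 24685 2 3000002006006005003004001006004002001 ∷ fac 944 1 1 ∷ fac 1286 2 0 ∷ []))
        (leaf (ran 1403 4 17 ∷ ran 1527 11 14 ∷ ran 892 9 17 ∷ ran 843 10 15 ∷ ran 216 5 17 ∷ ran 529 6 16 ∷
          ran 192 8 16 ∷ ran 128 6 13 ∷ ran 1403 11 18 ∷ ran 712 7 17 ∷ ran 633 8 19 ∷ ran 690 4 14 ∷
          ran 140 10 16 ∷ cel 1 0 190000375000 ∷ cel 3 1 557883587300000000000000000000294 ∷
          cel 1 1 1001001003000000000000000000002 ∷ cel 4 2 594868608000166000000000000013 ∷
          cel 1 2 3003002000002000000000000002 ∷ cel 2 3 838000000000000000000634000066000 ∷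
          cel 1 3 1000000000000000000001000001000 ∷ cel 4 4 269000610843408180000179048068000 ∷
          cel 1 4 3000004003003002000004003001000 ∷ cel 2 5 645559406605000000000000000000000 ∷
          cel 1 5 1000002000000000000000000000 ∷ cel 19 6 128000340093161000097238963702567858000 ∷
          cel 1 6 4000019017009000011008015004000013000 ∷ fac 400 5 4 ∷ fac 4347 6 4 ∷ fac 1805 4 3 ∷
          fac 3781 6 5 ∷ fac 2956 6 3 ∷ fac 1692 2 1 ∷ fac 903 5 0 ∷ fac 136 5 3 ∷
          sqr 3880 10 4005000014015019019016009011011009010 ∷
          sqr 1126 5 7000005014014012008010002015011004002 ∷ sqr 1300 9 1017017012012017012012017019007008 ∷
          sqr 1580 8 5000012010013009006009013018016007009 ∷ fac 268 5 2 ∷ []))))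
      (branch 0 10 302
       (branch 9 9 29
        (leaf (ran 204733 6 18 ∷ ran 197759 4 18 ∷ ran 197312 8 14 ∷ ran 19737 11 16 ∷ ran 63682 9 18 ∷
          ran 87323 7 17 ∷ ran 17392 6 17 ∷ ran 135645 9 16 ∷ ran 158345 5 15 ∷ ran 32710 5 14 ∷
          ran 6103 5 13 ∷ ran 114766 9 14 ∷ cel 427 0 2000017000146998661000000207025050000 ∷
          cel 1 0 39000225000290061138000000177209062000 ∷ cel 285 1 61000000000000717000127427996009000 ∷
          cel 1 1 74000000000000240000046133147251000 ∷ cel 152 2 968856000996000000226000 ∷
          cel 1 2 120084000123000000038000 ∷ cel 196 3 112000000000000000000995032000000 ∷
          cel 1 3 80000000000000000000011143000000 ∷ cel 293 4 123657998000000064239380000 ∷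
          cel 1 4 81271278000000054005247000 ∷ cel 253 5 25296000330998219000000543287476000 ∷
          cel 1 5 185089000234141088000000116008170000 ∷ cel 2680 6 118000000000204311323000000783545998000 ∷
          cel 3 6 517000000000263598121000000345851822000 ∷ fac 361913 5 4 ∷ fac 1025242 6 4 ∷
          fac 96552 4 3 ∷ fac 2564483 6 5 ∷ fac 73262 5 2 ∷ fac 1674400 6 2 ∷ fac 50666 4 1 ∷
          fac 156922 5 0 ∷ fac 35821 6 1 ∷ sqr 2111 38 53003025000130138095082124064057030002 ∷
          sqr 2440 41 53014020035062096141092087135030021000 ∷
          sqr 1218 71 18054052000162171168111140126122070028 ∷
          sqr 1279 50 28025000017150142123096084098062058023 ∷
          sqr 855 100 90118113135085004000051100001120152130 ∷
          sqr 925 41 24021030000059141092117071071047009013 ∷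
          sqr 486 100 95105158081067024166117047103000122118 ∷
          sqr 390 77 80034086066057075177102092134083000071 ∷
          sqr 171 100 53099000100146175189153127184079066053 ∷
          sqr 107 65 65000017054157160084089148165122043041 ∷
          sqr 289 100 64070107121107103151102151174147000087 ∷
          sqr 74 90 89057149078107000190108092096069106094 ∷ []))
        (branch 5 5 26
         (branch 0 2 141
          (leaf (ran 97411 9 18 ∷ ran 89326 6 16 ∷ ran 124624 8 14 ∷ ran 2740 6 15 ∷ ran 140787 10 15 ∷
            ran 70683 5 17 ∷ ran 15112 11 14 ∷ ran 140515 5 18 ∷ ran 29520 9 19 ∷ ran 190576 4 14 ∷
            ran 4580 7 14 ∷ ran 22669 8 18 ∷ ran 2647 3 14 ∷ ran 89273 7 16 ∷
            cel 49 0 993647000000000000537683000000000 ∷ cel 1 0 19020000000000000044004000000000 ∷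
            cel 216 1 171000994292000134282000000000 ∷ cel 1 1 135000185054000124214000000000 ∷
            cel 12 2 948000000000000000000000000000 ∷ cel 1 2 4000000000000000000000000000 ∷
            cel 261 3 38000000000000618000353551998000000 ∷ cel 1 3 209000000000000141000114165041000000 ∷
            cel 133 4 995000070000000000000 ∷ cel 1 4 117000017000000000000 ∷ cel 147 5 995000000000 ∷
            cel 1 5 89000000000 ∷ cel 155 6 405997000000000113236000 ∷ cel 1 6 52102000000000089014000 ∷
            cel 75 7 997000000000000000000000000 ∷ cel 1 7 5000000000000000000000000 ∷
            cel 2680 8 104000000000000087095000000850612998000 ∷
            cel 3 8 186000000000000106700000000007173822000 ∷ fac 103106 7 6 ∷ fac 817405 8 6 ∷
            fac 158784 6 5 ∷ fac 411793 8 7 ∷ fac 191737 7 4 ∷ fac 442221 8 5 ∷ fac 54204 6 3 ∷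
            fac 23582 7 3 ∷ fac 139139 6 2 ∷ fac 7549 3 2 ∷ fac 130245 8 2 ∷ fac 52817 5 2 ∷ fac 769137 8 1 ∷
            fac 36499 8 3 ∷ fac 15219 6 0 ∷ fac 8199 6 6 ∷ fac 12270 5 1 ∷
            sqr 2491 49 15007018078077120139092135149079046000 ∷
            sqr 987 65 65000017054157160084089148165122043041 ∷
            sqr 1349 100 101095076151077107000097118119135121111 ∷
            sqr 316 91 101027000137145191133149186171119080053 ∷
            sqr 444 74 25037174047148070128097132083103074 ∷
            sqr 359 100 112145102000143004018014118099134109121 ∷
            sqr 242 100 132100170165008087116117013000038101128 ∷
            sqr 315 50 91010035092108106119059094150086049000 ∷
            sqr 352 48 57000021101059090148102052088041046025 ∷
            sqr 399 65 71084065081081106011066067070000165055 ∷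
            sqr 121 86 96000053071096163136114186184135040073 ∷
            sqr 75 61 33054018000161121158072088102064048024 ∷ []))
          (leaf (ran 1059 11 16 ∷ ran 3238 9 18 ∷ ran 1341 10 16 ∷ ran 4477 6 16 ∷ ran 6622 4 18 ∷
            ran 5662 8 14 ∷ ran 1475 5 17 ∷ ran 5853 5 15 ∷ ran 7415 10 14 ∷ ran 3705 7 17 ∷ ran 1455 5 18 ∷
            ran 2729 9 19 ∷ ran 483 7 14 ∷ cel 3 0 384000000000328452967000 ∷
            cel 1 0 2000000000001002003000 ∷ cel 9 1 108000956384000079000000000000 ∷
            cel 1 1 1000006009000006000000000000 ∷ cel 3 2 970000000000000000000000000000 ∷
            cel 1 2 2000000000000000000000000000 ∷ cel 12 3 47000000000000626000241128972000000 ∷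
            cel 1 3 4000000000000012000010010007000000 ∷ cel 5 4 98000000951000000000000000000 ∷
            cel 1 4 5000000000000000000 ∷ cel 4 5 836000000000000000000000000000000 ∷
            cel 1 5 4000000000000000000000000000000 ∷ cel 8 6 929000000000000000000 ∷
            cel 1 6 4000000000000000000 ∷ cel 6 7 206000896119000000000000000214000 ∷
            cel 1 7 3000002001000000000000000005000 ∷ cel 116 8 279114000141000246226000000127674990000 ∷
            cel 1 8 74079000013000092094000000085053067000 ∷ fac 2197 7 6 ∷ fac 2625 6 5 ∷ fac 37620 8 7 ∷
            fac 8828 7 4 ∷ fac 29859 8 5 ∷ fac 6593 6 2 ∷ fac 1654 3 2 ∷ fac 23319 8 1 ∷ fac 2714 8 3 ∷
            fac 4862 5 0 ∷ fac 3533 3 0 ∷ fac 59957 8 0 ∷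
            sqr 10160 9 10003000014014019013015019017012008005 ∷
            sqr 3468 5 9001003009011011012006009015009005000 ∷
            sqr 4238 10 11014010000014000002001012010013011012 ∷
            sqr 6658 10 13011014016000004000009007006010011014 ∷ fac 503 1 0 ∷ fac 693 7 3 ∷ fac 233 2 0 ∷
            fac 423 7 0 ∷ fac 99 5 3 ∷ [])))
         (leaf (ran 19491 4 14 ∷ ran 3630 11 17 ∷ ran 14923 6 18 ∷ ran 4832 10 16 ∷ ran 3923 6 14 ∷
           ran 9579 9 18 ∷ ran 8747 7 16 ∷ ran 738 6 19 ∷ ran 6345 5 16 ∷ ran 16234 8 14 ∷ ran 1995 9 17 ∷
           ran 9096 10 17 ∷ ran 8551 6 15 ∷ cel 24 0 115000231000971000000000000000000000217 ∷
           cel 1 0 17000004000024000000000000000000000003 ∷ cel 9 1 799959000000000000000000000000 ∷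
           cel 1 1 9000000000000000000000000 ∷ cel 35 2 17000008000000464000000280972038000 ∷
           cel 1 2 35000025000000015000000008009002000 ∷ cel 15 3 275000000997000000000000178000 ∷
           cel 1 3 3000000002000000000000009000 ∷ cel 27 4 41000000068000000000971129000000 ∷
           cel 1 4 12000000025000000000007019000000 ∷ cel 10 5 436985000000051803000000 ∷
           cel 1 5 7009000000002002000000 ∷ cel 15 6 973294000000000122117000000 ∷
           cel 1 6 8002000000000011012000000 ∷ cel 329 7 146000000000000158038000000624293997000 ∷
           cel 1 7 133000000000000299222000000242061172000 ∷ fac 10307 6 5 ∷ fac 112503 7 5 ∷ fac 21200 5 4 ∷
           fac 135958 7 6 ∷ fac 20140 6 3 ∷ fac 52802 7 3 ∷ fac 46123 7 4 ∷ fac 11662 5 2 ∷ fac 9394 6 2 ∷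
           fac 20026 5 1 ∷ fac 13913 6 0 ∷ fac 2250 5 3 ∷ fac 7733 3 0 ∷ fac 1984 4 3 ∷
           sqr 1843 15 5002006024023036042028041045024014000 ∷
           sqr 1367 27 30008000041043057040044056051035024015 ∷
           sqr 1796 16 9005009009019032033046017027000017014 ∷
           sqr 1201 19 41031030049018038010030000007003029009 ∷
           sqr 1960 14 16003006000017028009044019014020014013 ∷
           sqr 683 25 19030025018035045000055028054032025012 ∷
           sqr 622 13 23016018015023017043000010000009012007 ∷
           sqr 740 30 34036036042025039021003023000019044038 ∷
           sqr 1201 30 47032034038016021000033026025033032036 ∷
           sqr 145 11 2000001013019018041028001029008011008 ∷
           sqr 317 13 6006005003027025030043026021036013000 ∷
           sqr 477 19 30000012012019031049031026027022018018 ∷ fac 71 3 2 ∷ []))))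
       (branch 0 6 241
        (leaf (ran 5040 4 18 ∷ ran 1828 5 15 ∷ ran 3738 6 19 ∷ ran 979 9 14 ∷ ran 217 7 19 ∷ ran 9717 11 18 ∷
          ran 344 3 16 ∷ ran 5589 5 17 ∷ ran 3166 11 19 ∷ ran 12162 11 14 ∷ ran 3192 6 13 ∷ ran 4900 8 16 ∷
          ran 7127 10 18 ∷ ran 5707 4 15 ∷ ran 6347 9 16 ∷ cel 16 0 605872956461000000000000000000000 ∷
          cel 1 0 1007001014000000000000000000000 ∷ cel 18 1 816960317000000000000000000154490 ∷
          cel 1 1 15011016000000000000000000007017 ∷ cel 9 2 243000316952000394312000000000 ∷
          cel 1 2 6007000005001000000000 ∷ cel 4 3 899000000000712000000000 ∷
          cel 1 3 1000000000002000000000 ∷ cel 24 4 377000583963000000000051173218000 ∷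
          cel 1 4 14000006008000000000005020022000 ∷ cel 16 5 271538306754952000000000000114000 ∷
          cel 1 5 3006001015008000000000000011000 ∷ cel 195 6 313000729154153000000000000995559387000 ∷
          cel 1 6 176000010104112000000000000167048141000 ∷ fac 53190 6 4 ∷ fac 10392 4 3 ∷ fac 49254 6 5 ∷
          fac 62474 6 2 ∷ fac 109354 6 3 ∷ fac 7786 5 1 ∷ fac 4931 4 0 ∷ fac 4978 2 0 ∷ fac 39967 6 0 ∷
          fac 1080 3 2 ∷ fac 2552 3 1 ∷ sqr 2233 14 18000015024044029025020025030019013008 ∷
          sqr 1164 30 29000038047045040030030048059056030035 ∷
          sqr 3013 30 29034030033034026000020036036041036031 ∷
          sqr 847 18 3000035040015048039031028027030012013 ∷
          sqr 789 19 21000023046023013033028023049030019016 ∷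
          sqr 684 13 15000000040033039006016016043019016008 ∷
          sqr 628 18 17011048026011004000011027030034027021 ∷
          sqr 361 16 7000046031031024035021029033021014012 ∷
          sqr 563 19 18000024023008018049028024023031009022 ∷ []))
        (leaf (ran 777331 11 18 ∷ ran 51659 4 18 ∷ ran 55355 11 16 ∷ ran 38646 10 17 ∷ ran 94174 6 14 ∷
          ran 97546 10 15 ∷ ran 126722 7 16 ∷ ran 108701 8 15 ∷ ran 100206 9 16 ∷ ran 47515 8 16 ∷
          ran 4478 5 16 ∷ ran 149134 9 14 ∷ ran 135278 5 13 ∷ cel 250 0 997000480000245000000 ∷
          cel 1 0 126000147000143000000 ∷ cel 482 1 997030405000000000000000000456787 ∷
          cel 1 1 480477473000000000000000000198137 ∷ cel 532 2 998000177098000000000 ∷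
          cel 1 2 255000019274000000000 ∷ cel 35 3 140000000000000000000997000000000 ∷
          cel 1 3 1000000000000000000014000000000 ∷ cel 347 4 996000000000140257166000 ∷
          cel 1 4 323000000000169191193000 ∷ cel 439 5 500184486000034998000000000069082149 ∷
          cel 1 5 84396358000196058000000000325295345 ∷ cel 3484 6 419000998000434639108319000965406322000 ∷
          cel 4 6 245000802000418564087820000067448455000 ∷ fac 14826 5 4 ∷ fac 1009498 6 4 ∷
          fac 218321 4 3 ∷ fac 2336194 6 5 ∷ fac 8902 5 2 ∷ fac 2983670 6 2 ∷ fac 2649281 6 3 ∷
          fac 213063 5 1 ∷ fac 234422 3 1 ∷ fac 41567 2 1 ∷ fac 333730 5 0 ∷ fac 370407 1 0 ∷
          sqr 4908 55 25000155106106080118072099111070047041 ∷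
          sqr 6152 48 19000063035148097099112103051047031036 ∷
          sqr 5827 64 74000048096115164057090105085086070063 ∷
          sqr 2323 69 45000029075142157165169123096048062043 ∷
          sqr 1154 82 84064050075182129000064117108073095087 ∷
          sqr 839 100 119000150161165169136126149198125112103 ∷
          sqr 702 100 99129184076191036000045123128080132106 ∷
          sqr 858 39 47005139035065000071048067069045053045 ∷
          sqr 1170 46 54000048043041066146099058072046042041 ∷
          sqr 470 86 82096115186000086034042065109115094089 ∷ [])))))
     (branch 0 2 145
      (branch 0 4 199
       (leaf (ran 7517 10 18 ∷ ran 841 10 15 ∷ ran 1219 6 17 ∷ ran 13728 10 17 ∷ ran 2477 8 15 ∷
         ran 3203 9 15 ∷ cel 23 0 956738738707000000019000000000 ∷ cel 1 0 4005005003000000008000000000 ∷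
         cel 5 1 915000000000000000000 ∷ cel 1 1 1000000000000000000 ∷
         cel 15 2 935550167000000000156692755755 ∷ cel 1 2 6002001000000000009012004004 ∷
         cel 14 3 406582718993008000066066000000 ∷ cel 1 3 4002002013001000013013000000 ∷
         cel 10 4 901825250000000000000000000000 ∷ cel 1 4 8002006000000000000000000000 ∷
         cel 116 5 498990000432000000 ∷ cel 1 5 22067000015000000 ∷ fac 3608 4 2 ∷ fac 3106 2 1 ∷
         fac 3809 4 1 ∷ fac 6956 2 2 ∷ fac 4532 0 0 ∷ fac 1467 1 0 ∷ fac 887 3 3 ∷ fac 17776 2 0 ∷ []))
       (leaf (ran 4458 10 18 ∷ ran 5220 10 15 ∷ ran 752 4 18 ∷ ran 2068 10 17 ∷ ran 825 5 19 ∷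
         ran 150 11 19 ∷ ran 2118 10 16 ∷ ran 384 11 18 ∷ ran 1296 8 18 ∷ ran 3497 9 15 ∷
         cel 1 0 538000000000874000000 ∷ cel 6 1 574000000955000000722000171000 ∷
         cel 1 1 2000000005000000002000000000 ∷ cel 9 2 53021000919512388000000040403441573593 ∷
         cel 1 2 8008000000002007000000003003004005008 ∷ cel 9 3 58967000000103000099000 ∷
         cel 1 3 7002000000002000002000 ∷ cel 12 4 973811668383000000000000017000 ∷
         cel 1 4 6003008005000000000000006000 ∷ cel 69 5 28000015000000097081635000456985040000 ∷
         cel 1 5 54000017000000027045008000053027055000 ∷ fac 16606 5 3 ∷ fac 6482 4 2 ∷ fac 10450 5 4 ∷
         fac 9326 2 1 ∷ fac 6579 4 1 ∷ fac 844 3 1 ∷ fac 2199 4 0 ∷ fac 606 3 0 ∷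
         sqr 6850 6 10007009010014015007013009016001003000 ∷
         sqr 8145 10 10011010016010010010000008014012011010 ∷
         sqr 1829 10 12012009016017012007000007014011012009 ∷
         sqr 3217 10 10011008015011010011000009007011012012 ∷
         sqr 2098 8 10008009018003013011000009007010008007 ∷
         sqr 956 10 11011011013011011003000020012016011008 ∷ fac 153 0 0 ∷ fac 4189 2 2 ∷ [])))
      (leaf (ran 51673 10 18 ∷ ran 11728 10 14 ∷ ran 5758 11 19 ∷ ran 4786 9 15 ∷ ran 6519 5 17 ∷
        ran 10479 9 19 ∷ ran 11211 8 17 ∷ ran 5946 10 16 ∷ ran 2840 4 19 ∷ ran 4291 7 16 ∷
        cel 54 0 158525920993134016000000080000000 ∷ cel 1 0 37032001041025039000000013000000 ∷
        cel 36 1 24987266000334000054163320867957 ∷ cel 1 1 1003020000025000023026035024014 ∷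
        cel 44 2 988000000078000023000 ∷ cel 1 2 23000000039000004000 ∷
        cel 77 3 51994805582409171000000000067079 ∷ cel 1 3 9025021011064048000000000010059 ∷
        cel 329 4 70000041129125197748997000000066261000 ∷ cel 1 4 60000183094322213029172000000152132000 ∷
        fac 70225 4 2 ∷ fac 59764 3 1 ∷ fac 17900 1 1 ∷ fac 142646 4 3 ∷ fac 45065 4 0 ∷ fac 1480 2 0 ∷
        sqr 3285 30 30035028032045031024000027041032039031 ∷
        sqr 1292 21 22000011026027033047051047022016022020 ∷
        sqr 452 30 14015016034000021026045035036039031043 ∷
        sqr 2441 5 2000006004006018008035005013001002000 ∷ sqr 1080 6 7000009000014015017036012004000001000 ∷
        sqr 2054 30 30034037019033029018000031029037030036 ∷
        sqr 1046 16 18025022046028039026005017017014009000 ∷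
        sqr 312 29 37048036001059000003001008033033031033 ∷
        sqr 938 9 10007013000039023022015019002005002003 ∷
        sqr 714 30 30035036036013035034000032028035031030 ∷
        sqr 174 12 14014013020029006001042000030020012002 ∷
        sqr 246 11 8016015028041031020004006012015006000 ∷
        sqr 152 30 32041039049014032009000018053048030026 ∷ [])))))
   -- The other half of the root: at most 212/410 of the vertices in the cells 0 to 5, so about half
   -- of all values are larger than t / 4. Here ranges of high sums such as those from 8t/24 on are
   -- the crowded ones.
   (branch 0 6 215
    (branch 0 1 129
     (branch 0 7 251
      (branch 0 9 286
       (branch 0 8 275
        (leaf (ran 5713 5 14 ∷ ran 8890 6 15 ∷ ran 3480 6 16 ∷ ran 2408 10 14 ∷ ran 4307 7 14 ∷
          ran 3042 9 16 ∷ ran 2394 11 14 ∷ ran 1693 6 17 ∷ ran 79 11 18 ∷ ran 3718 4 14 ∷ ran 2322 8 17 ∷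
          ran 1075 8 18 ∷ cel 12 0 323956000000000000 ∷ cel 1 0 2006000000000000 ∷
          cel 10 1 179145000000000000079388980663000000 ∷ cel 1 1 5007000000000000007004005001000000 ∷
          cel 15 2 990000000000000000 ∷ cel 1 2 5000000000000000 ∷
          cel 12 3 953615253000000000000171000000080058000 ∷ cel 1 3 7006011000000000000004000000000005000 ∷
          cel 15 5 379264073000000000000256331465948027000 ∷ cel 1 5 7004012000000000000001008009005013000 ∷
          cel 150 6 78000000017000062000000159298317995000 ∷
          cel 1 6 102000000143000074000000081121007129000 ∷ fac 5600 5 4 ∷ fac 10342 5 3 ∷ fac 2900 5 2 ∷
          fac 2023 4 1 ∷ fac 1059 4 0 ∷ fac 2188 6 2 ∷ fac 994 3 2 ∷ fac 1272 5 0 ∷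
          sqr 11121 10 12013012011011005000007007008007013012 ∷
          sqr 5847 7 10004003007012017012016017017008003000 ∷
          sqr 3097 6 4005007010013014010011016014006004000 ∷
          sqr 8059 4 2000001005004008014008008006003005002 ∷
          sqr 1191 7 3008008001014013017017015016000007000 ∷
          sqr 2660 10 11011008013007013000001007003011011013 ∷
          sqr 4135 4 2003002004008007014010008009006003000 ∷
          sqr 1341 8 18006006018012008000012012017011009005 ∷ []))
        (leaf (ran 3732 8 14 ∷ ran 2881 5 14 ∷ ran 1314 6 16 ∷ ran 2083 11 14 ∷ ran 2393 4 16 ∷
          ran 9235 9 15 ∷ ran 3642 6 17 ∷ ran 6722 6 14 ∷ ran 4515 7 14 ∷ ran 2399 10 15 ∷
          cel 16 0 190097000015000745984000000 ∷ cel 1 0 16010000010000015007000000 ∷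
          cel 18 1 38031000000000000000311992482123000 ∷ cel 1 1 11002000000000000000008017011002000 ∷
          cel 14 2 26000207000000933246000000000000 ∷ cel 1 2 2000001000000003011000000000000 ∷
          cel 10 3 921870392000000000000000186319445000000 ∷ cel 1 3 3009001000000000000000008002001000000 ∷
          cel 10 5 257286000000000000000280668942926128000 ∷ cel 1 5 5009000000000000000001009005006002000 ∷
          cel 150 6 199000000000000000000000137152528995000 ∷
          cel 1 6 67000000000000000000000093010056129000 ∷ fac 7018 5 4 ∷ fac 7502 5 3 ∷ fac 2268 5 2 ∷
          fac 2178 4 1 ∷ fac 8940 3 0 ∷ fac 3743 5 0 ∷ fac 5575 6 2 ∷ fac 2048 4 2 ∷ fac 2115 3 3 ∷
          sqr 12182 10 12013012011011005000007007008007013012 ∷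
          sqr 4741 7 10004003007012017012016017017008003000 ∷
          sqr 1177 7 3008008001014013017017015016000007000 ∷
          sqr 4593 8 8010008008000008018014011009006007002 ∷
          sqr 1154 10 11011008013007013000001007003011011013 ∷
          sqr 3004 10 14014013013012006010011012011008008 ∷
          sqr 1547 10 10011010011010014007013010000019012009 ∷
          sqr 7399 10 7006007016014014012015013013011010 ∷ sqr 1719 8 5010013018016004000006009014012006005 ∷
          [])))
       (leaf (ran 1184 7 15 ∷ ran 4140 11 14 ∷ ran 10528 6 15 ∷ ran 1324 8 16 ∷ ran 2268 5 19 ∷
         ran 2958 10 18 ∷ ran 836 4 14 ∷ ran 623 5 16 ∷ ran 10153 10 14 ∷ ran 2266 7 17 ∷ ran 579 7 18 ∷
         ran 3618 9 16 ∷ ran 4244 9 17 ∷ cel 17 0 37035000670436229000086000000944000000 ∷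
         cel 1 0 8012000011000014000007000000008000000 ∷ cel 16 1 52000087000000966525000000000000 ∷
         cel 1 1 10000003000000005011000000000000 ∷ cel 14 2 183304000931000000000000014000245026000 ∷
         cel 1 2 1006000001000000000000013000012009000 ∷ cel 4 3 808000000000000000000000 ∷
         cel 1 3 3000000000000000000000 ∷ cel 8 4 108153000277000000000488964689228023000 ∷
         cel 1 4 1006000003000000000008004004003004000 ∷ cel 116 5 146071000050000000000000305298662990000 ∷
         cel 1 5 40109000114000000000000049061084067000 ∷ fac 6555 4 3 ∷ fac 6408 5 3 ∷ fac 2345 4 2 ∷
         fac 7710 4 1 ∷ fac 20532 2 0 ∷ fac 4123 4 0 ∷ fac 3756 3 2 ∷ fac 4660 0 0 ∷ fac 3727 2 1 ∷
         fac 303 3 1 ∷ sqr 5780 8 7007013014015016018016016016002002 ∷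
         sqr 10036 5 3004009004000006011015012007005004000 ∷
         sqr 7939 7 6008008000009004013017008001006007005 ∷
         sqr 7212 4 2000001005004008014008008006003005002 ∷
         sqr 3136 9 9009011005014015000010009019003009008 ∷ [])))
      (branch 0 9 276
       (leaf (ran 536029 8 14 ∷ ran 66732 10 18 ∷ ran 7054 10 20 ∷ ran 67102 11 14 ∷ ran 172895 5 14 ∷
         ran 267048 7 16 ∷ ran 491686 6 14 ∷ ran 311970 8 15 ∷ ran 10288 7 20 ∷ ran 118042 10 17 ∷
         ran 108570 9 17 ∷ ran 181683 9 19 ∷ ran 86731 11 18 ∷
         cel 874 0 30001000000000000000133998637117000 ∷ cel 1 0 196253000000000000000209113499613000 ∷
         cel 905 1 462000000000998862000000 ∷ cel 1 1 44000000000229370000000 ∷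
         cel 467 2 787998627189000000000000018149459122000 ∷
         cel 1 2 354397150102000000000000142443110145000 ∷ cel 132 3 195000000000000992000000000000000 ∷
         cel 1 3 94000000000000041000000000000000 ∷ cel 555 4 245304985998269000 ∷
         cel 1 4 19445065303138000 ∷ cel 9950 5 263029023002000027000000102189146998000 ∷
         cel 10 5 318013358432000448000000529378907981000 ∷ fac 586442 4 3 ∷ fac 58146 4 2 ∷ fac 700363 2 1 ∷
         fac 234272 4 1 ∷ fac 48418 3 0 ∷ fac 233543 5 4 ∷ fac 286 3 2 ∷ fac 8351 3 1 ∷
         sqr 9892 61 4000014024031112129161128146096068065 ∷
         sqr 5148 92 46061071101177144192168117134105081 ∷
         sqr 4231 61 101061068079122161080104130047058044000 ∷
         sqr 3196 89 189121119104091078004000018066058090104 ∷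
         sqr 1765 88 51163159155188111092077115068107008000 ∷
         sqr 1543 98 49118095102159000198152190096133029043 ∷
         sqr 806 91 191131128117117124000002008030011108090 ∷
         sqr 714 82 141084097105182096150135176110019031000 ∷
         sqr 982 79 129104101122179152093090122085077018000 ∷
         sqr 1212 100 130125113067118064073050111087106116 ∷
         sqr 965 100 85098100070159098130106166127101111 ∷
         sqr 584 44 38024040052067141080114104144042010000 ∷
         sqr 609 100 103110100103101000108060085162094074118 ∷
         sqr 70 84 184158161157174144010009039097114000015 ∷
         sqr 47 100 130111107114187092160132189000157066039 ∷ []))
       (leaf (ran 381 8 14 ∷ ran 1395 9 16 ∷ ran 1141 10 14 ∷ ran 152 10 16 ∷ ran 500 8 18 ∷ ran 298 5 14 ∷
         ran 757 6 14 ∷ ran 353 7 14 ∷ ran 1701 10 15 ∷ ran 389 10 19 ∷ ran 500 8 17 ∷ ran 333 11 14 ∷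
         cel 2 0 192000238000536000000786000471 ∷ cel 1 0 1000001000000001000002 ∷
         cel 5 1 24000000000000000604919211000 ∷ cel 1 1 1000000000000000000000002000 ∷
         cel 4 2 117160000600000110000116281272757197164 ∷ cel 1 2 1001000002000003000001003000004004002 ∷
         cel 2 3 192000341506000664000000000000000 ∷ cel 1 3 2000000001000000000000000 ∷
         cel 2 4 70000000000366919069149000000 ∷ cel 1 4 1000000000002000001002000000 ∷
         cel 24 5 80053053000000000000000053495437991000 ∷ cel 1 5 2010010000000000000000010011024022000 ∷
         fac 1753 4 3 ∷ fac 2864 5 3 ∷ fac 875 2 1 ∷ fac 3586 2 0 ∷ fac 1193 4 0 ∷ fac 209 1 0 ∷
         fac 2598 5 1 ∷ fac 441 2 2 ∷ fac 967 3 3 ∷ fac 173 0 0 ∷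
         sqr 2919 5 3003006006015012014011005011004001 ∷ []))))
     (branch 0 3 155
      (branch 0 10 296
       (branch 0 9 286
        (leaf (ran 3821 11 14 ∷ ran 15625 6 16 ∷ ran 13891 10 15 ∷ ran 10057 7 17 ∷ ran 2018 5 14 ∷
          ran 4686 8 17 ∷ ran 14290 9 14 ∷ ran 4149 5 19 ∷ ran 19711 8 16 ∷ ran 9397 4 18 ∷ ran 5131 11 15 ∷
          ran 13163 6 14 ∷ cel 16 0 28301000000000000972489494000000000 ∷
          cel 1 0 16014000000000000011010009000000000 ∷ cel 18 1 154000000000000000000956000000173000 ∷
          cel 1 1 5000000000000000000005000000003000 ∷ cel 27 2 398727344000000967203000000000000 ∷
          cel 1 2 4019020000000020025000000000000 ∷ cel 7 3 255295000925093000000000000 ∷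
          cel 1 3 3005000002001000000000000 ∷ cel 16 4 953000000000000000000000000 ∷
          cel 1 4 9000000000000000000000000 ∷ cel 17 5 188000000749278000362942000494173000 ∷
          cel 1 5 10000000014013000005013000007016000 ∷ cel 253 6 203000034000000269000286229459000997000 ∷
          cel 1 6 189000042000000103000244198231000209000 ∷ fac 16478 5 4 ∷ fac 91099 6 4 ∷ fac 98307 6 3 ∷
          fac 20381 5 2 ∷ fac 15029 3 1 ∷ fac 1979 4 1 ∷ fac 9041 3 0 ∷ fac 934 4 0 ∷ fac 5562 6 1 ∷
          fac 34040 6 2 ∷ sqr 3152 14 4006001016028037044039027024005009000 ∷
          sqr 1885 18 14013018025024033042048042021015000003 ∷
          sqr 1969 30 35032038031028009007000014038032030044 ∷
          sqr 1839 30 23043023035036014004000013048031035036 ∷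
          sqr 1195 20 23000001017016041050047027036020009014 ∷
          sqr 958 30 15024026032041052048052047055029000014 ∷
          sqr 735 24 17007000021030028032052048054027024018 ∷
          sqr 699 15 26005019008025045031040031025015008000 ∷
          sqr 411 23 16020025038053036046038035017015014 ∷
          sqr 244 30 31043048046043047000028058045042031009 ∷
          sqr 314 30 30041036040031048000020042040030034022 ∷
          sqr 296 20 21005000015023031050031025032008020019 ∷ []))
        (leaf (ran 19690 9 16 ∷ ran 3954 7 14 ∷ ran 23946 8 16 ∷ ran 5702 9 18 ∷ ran 15797 11 18 ∷
          ran 20335 10 14 ∷ ran 5428 5 19 ∷ ran 7381 6 16 ∷ ran 24271 6 17 ∷ ran 21850 10 15 ∷
          ran 2031 4 18 ∷ ran 3576 5 15 ∷ cel 21 0 472000000967000170000000916000521000250 ∷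
          cel 1 0 10000000007000002000000007000019000002 ∷ cel 21 1 24000000000152000000981000000166000 ∷
          cel 1 1 5000000000012000000013000000019000 ∷ cel 59 2 998538000000183172000000000109 ∷
          cel 1 2 3022000000027044000000000001 ∷ cel 41 3 460981454000032000000000144059 ∷
          cel 1 3 40024026000030000000000038014 ∷ cel 23 4 347992345000186000000000000000 ∷
          cel 1 4 1015016000020000000000000000 ∷ cel 40 5 403981000016092000 ∷ cel 1 5 7008000037013000 ∷
          cel 329 6 467000000000111512000163000997000680000 ∷
          cel 1 6 29000000000300075000138000172000184000 ∷ fac 14231 5 4 ∷ fac 92905 6 4 ∷ fac 136442 6 3 ∷
          fac 13766 5 2 ∷ fac 17835 3 1 ∷ fac 9699 4 1 ∷ fac 46718 2 0 ∷ fac 2022 5 0 ∷ fac 3326 2 1 ∷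
          fac 6939 6 2 ∷ fac 8735 6 1 ∷ sqr 7780 18 14013018025024033042048042021015000003 ∷
          sqr 2412 26 28006000037028056044039027048029023024 ∷
          sqr 4873 11 41014018001016015017000000005005011007 ∷
          sqr 1245 19 21001000017033049040048024048014011011 ∷
          sqr 1128 24 28000008054016036030052042042032024023 ∷
          sqr 1717 30 36039040049019011000028044024033030031 ∷
          sqr 1472 28 29021021034031027000009037048037058038 ∷
          sqr 1256 13 12004009018018043015000013043013013009 ∷ [])))
       (leaf (ran 449 10 16 ∷ ran 7044 11 15 ∷ ran 9133 11 19 ∷ ran 678 11 14 ∷ ran 717 9 17 ∷
         ran 7493 6 16 ∷ ran 9498 8 16 ∷ ran 1071 7 17 ∷ ran 9142 10 14 ∷ ran 9412 11 17 ∷ ran 6624 9 18 ∷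
         ran 3351 5 16 ∷ cel 13 0 658985782793000030000000000389628 ∷
         cel 1 0 12002001011000007000000000004007 ∷ cel 29 1 993994138000000200223094000040000 ∷
         cel 1 1 9021011000000005015005000000000 ∷ cel 17 2 380993246000000000000000000084087 ∷
         cel 1 2 17005004000000000000000000011013 ∷ cel 13 3 268743339000941000000000000000 ∷
         cel 1 3 4012010000011000000000000000 ∷ cel 12 4 152000127000000970884000132349000 ∷
         cel 1 4 1000002000000002009000010009000 ∷ cel 150 5 325000228312199000000045337995242465000 ∷
         cel 1 5 150000021032069000000118137129024076000 ∷ fac 10839 4 3 ∷ fac 58609 5 3 ∷ fac 2051 4 1 ∷
         fac 16091 1 0 ∷ fac 1132 4 0 ∷ fac 343 3 1 ∷ sqr 4446 16 11022029034046039038023019010001002 ∷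
         sqr 2832 12 5004032031028042018023039014012007000 ∷
         sqr 571 28 38009041048032016000024058045041050038 ∷
         sqr 902 29 33000012028033040056059020049032021034 ∷
         sqr 865 30 39040039026000011012028032018033031035 ∷ fac 444 3 0 ∷ fac 8338 5 1 ∷ fac 8280 5 0 ∷ [])))
      (branch 0 10 300
       (branch 0 7 242
        (leaf (ran 199437 9 14 ∷ ran 94040 6 19 ∷ ran 73788 5 18 ∷ ran 109896 11 19 ∷ ran 102308 6 15 ∷
          ran 187589 7 18 ∷ ran 53260 8 18 ∷ ran 106474 8 16 ∷ ran 33633 4 17 ∷ ran 85543 6 20 ∷
          ran 64719 10 15 ∷ ran 126169 10 14 ∷ ran 4136 9 16 ∷ ran 66276 6 17 ∷
          cel 161 0 110998054000000762000810000000000 ∷ cel 1 0 89092019000000062000022000000000 ∷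
          cel 88 1 47000000996000000000015400863752000 ∷ cel 1 1 24000000046000000000062054074064000 ∷
          cel 220 2 155997124000 ∷ cel 1 2 197078123000 ∷ cel 198 3 736997000000695133000000000000 ∷
          cel 1 3 34123000000180050000000000000 ∷ cel 102 4 998000000071000164000000000000000 ∷
          cel 1 4 33000000001000018000000000000000 ∷ cel 134 5 407991678000454000 ∷
          cel 1 5 121101121000011000 ∷ cel 2680 6 139048000118386000338757155185000998000 ∷
          cel 3 6 296776000863410000055271157287000822000 ∷ fac 185423 5 4 ∷ fac 921410 6 3 ∷ fac 12935 4 2 ∷
          fac 129866 3 1 ∷ fac 96211 5 1 ∷ fac 182709 2 0 ∷ fac 99667 1 0 ∷ fac 118907 3 0 ∷ fac 984633 6 0 ∷
          fac 11947 4 3 ∷ fac 188008 6 2 ∷ fac 124911 6 4 ∷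
          sqr 1216 74 90067041091174135122149165150028075000 ∷
          sqr 1264 51 56011000003063061115151126105025018033 ∷
          sqr 917 51 65016025072151117097101143103031030000 ∷
          sqr 582 58 77015015084149137110132155158057055000 ∷
          sqr 1145 100 104081072095134143135164174134080000065 ∷
          sqr 930 39 48037044106139110021016066064029019000 ∷
          sqr 907 100 96124143157104103022000029068138101122 ∷
          sqr 472 100 101123125185179142037000043123087082095 ∷
          sqr 344 100 99125146163155117018000045083114108108 ∷
          sqr 116 100 101131148180174128023000062085130061091 ∷
          sqr 97 57 64008014082119106088072080157044000049 ∷ []))
        (branch 0 4 158
         (leaf (ran 5276480 8 18 ∷ ran 5695682 10 14 ∷ ran 2256743 9 16 ∷ ran 6582567 6 18 ∷
           ran 3140774 9 17 ∷ ran 2665260 7 14 ∷ ran 518053 9 14 ∷ ran 2063142 8 19 ∷ ran 1331460 5 19 ∷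
           ran 1132481 11 18 ∷ ran 4984495 6 15 ∷ ran 2236009 8 16 ∷ ran 1188046 9 20 ∷
           cel 3780 0 251998000000910000000000000000 ∷ cel 4 0 319770000000065000000000000000 ∷
           cel 13241 1 998000000000000000000000 ∷ cel 13 1 953000000000000000000000 ∷
           cel 7027 2 64000000122998000000000092402235000 ∷ cel 7 2 136000000010892000000000361286617000 ∷
           cel 7878 3 998000000 ∷ cel 8 3 954000000 ∷ cel 7356 4 303998909000142000000000000060 ∷
           cel 8 4 808889333000351000000000000772 ∷ cel 6231 5 372125000998000000000555000045000 ∷
           cel 7 5 17563000856000000000273000300000 ∷ cel 1317 6 699000234000998000 ∷
           cel 1 6 73000399000920000 ∷ cel 81165 7 803017000000027324000998000000000611000 ∷
           cel 81 7 67226000000520731000991000000000477000 ∷ fac 3034755 6 5 ∷ fac 38094808 7 5 ∷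
           fac 3922496 5 4 ∷ fac 25500335 7 4 ∷ fac 6101304 5 3 ∷ fac 3363464 4 2 ∷ fac 4457239 6 2 ∷
           fac 5856820 5 2 ∷ fac 1787842 5 1 ∷ fac 4177338 6 0 ∷ fac 316853 2 0 ∷ fac 453799 5 0 ∷
           fac 4020260 7 0 ∷ fac 5634803 7 3 ∷ fac 44824 6 4 ∷
           sqr 21401 171 199158111229253571289372310200061110000 ∷
           sqr 3778 294 389172210315592559657694582415096000047 ∷
           sqr 9283 400 437437481556513402388411419386425367 ∷
           sqr 2957 400 414307159312000635332338445538611571556 ∷
           sqr 1998 400 389511565481665211050000412117411662433 ∷
           sqr 2324 191 177084278415591360391363292029091014 ∷
           sqr 1673 400 409547488423000329209169073340470720517 ∷
           sqr 1146 215 160322304218183245502615232160003055000 ∷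
           sqr 814 400 774447552322605000494604485171157304269 ∷
           sqr 1114 400 402542571425601000462427199377161260336 ∷
           sqr 555 249 289224119291391534649645354430115075000 ∷
           sqr 582 357 437345480320757685679166623173417172 ∷
           sqr 1433 170 174231278235570052208227216082000080022 ∷
           sqr 419 317 511000057344667717169075680453557320390 ∷
           sqr 323 277 289195178386649627578584240677000322070 ∷
           sqr 714 400 712384481342532000450404309399319406413 ∷
           sqr 236 113 40000062141513134146089313133114022076 ∷
           sqr 541 400 318391340304000468495544403420462666458 ∷
           sqr 98 96 95036056130020496234313144181042121000 ∷
           sqr 93 366 333260452573766512564720205422341194 ∷ fac 5246 6 1 ∷ []))
         (branch 0 1 114
          (leaf (ran 5952 6 14 ∷ ran 1906 8 16 ∷ ran 311 11 15 ∷ ran 2118 8 20 ∷ ran 3610 9 18 ∷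
            ran 292 7 14 ∷ ran 3032 10 15 ∷ ran 1589 5 18 ∷ ran 1109 5 14 ∷ ran 5433 8 19 ∷ ran 625 8 17 ∷
            cel 3 0 813000619000 ∷ cel 1 0 2000000000 ∷ cel 8 1 165705920000000000 ∷
            cel 1 1 2008007000000000 ∷ cel 9 2 458913000000000000000000000 ∷
            cel 1 2 3008000000000000000000000 ∷ cel 6 3 57000000342860000000000154582080000 ∷
            cel 1 3 3000000002004000000000001003003000 ∷ cel 5 4 827051000 ∷ cel 1 4 4002000 ∷
            cel 3 5 854000000000000000000000000 ∷ cel 9 6 117179000261206006000943545000000176 ∷
            cel 1 6 9006000007003009000007000000000006 ∷ cel 3 7 356000000898000000 ∷ cel 1 7 3000000 ∷
            cel 69 8 140050000176291863000138000156000985000 ∷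
            cel 1 8 56056000011059048000029000016000027000 ∷ fac 1807 7 6 ∷ fac 29209 8 6 ∷ fac 1419 5 3 ∷
            fac 1645 7 3 ∷ fac 2788 6 3 ∷ fac 5790 6 1 ∷ fac 14901 8 1 ∷ fac 22006 8 5 ∷ fac 473 5 0 ∷
            fac 4556 2 0 ∷ sqr 12186 4 5001002007010014006008013011004003000 ∷
            sqr 7275 4 7005004003000014006009001001000005001 ∷
            sqr 7634 5 7005001004008013009015009007001002000 ∷ fac 669 7 5 ∷ fac 306 3 1 ∷ fac 4480 8 4 ∷
            fac 532 6 5 ∷ []))
          (leaf (ran 13603 8 18 ∷ ran 7681 10 16 ∷ ran 15451 6 19 ∷ ran 3953 5 21 ∷ ran 12078 9 20 ∷
            ran 1979 9 18 ∷ ran 1092 5 18 ∷ ran 10031 5 15 ∷ ran 2634 11 19 ∷ ran 2488 9 19 ∷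
            ran 10245 8 14 ∷ ran 2136 10 14 ∷ ran 4691 10 17 ∷ cel 20 0 377769986000000000000000000070 ∷
            cel 1 0 15017000000000000000000019 ∷ cel 16 1 81178982000839975912000000000 ∷
            cel 1 1 11007015000007015006000000000 ∷ cel 12 2 937959000000000000000000000 ∷
            cel 1 2 3009000000000000000000000 ∷ cel 10 3 87000403976836000000053300656160000 ∷
            cel 1 3 1000000000001000000003004008003000 ∷ cel 9 4 508973000000598000706081000 ∷
            cel 1 4 3004000000000000007007000 ∷ cel 18 6 448279000265325000000000949000000253 ∷
            cel 1 6 1000000000003000000000016000000005 ∷ cel 3 7 529000000721000000 ∷ cel 1 7 3000000 ∷
            cel 195 8 102015000202516995355303018210000618000 ∷
            cel 1 8 80155000021146167155030076103000001000 ∷ fac 3482 7 6 ∷ fac 26167 8 6 ∷ fac 11095 6 5 ∷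
            fac 5957 7 3 ∷ fac 10581 6 3 ∷ fac 2872 6 2 ∷ fac 6515 6 1 ∷ fac 3806 7 0 ∷
            sqr 4809 12 16004006020031042018025038032011009000 ∷ fac 19586 8 4 ∷ fac 1189 1 0 ∷
            fac 67483 8 5 ∷ fac 2784 3 0 ∷ fac 21639 6 4 ∷ [])))))
       (branch 0 8 255
        (branch 0 0 113
         (leaf (ran 18844 10 19 ∷ ran 4165 7 17 ∷ ran 15980 11 19 ∷ ran 29958 11 14 ∷ ran 23686 6 15 ∷
           ran 6166 8 20 ∷ ran 16782 8 16 ∷ ran 9359 5 18 ∷ ran 11241 9 18 ∷ ran 2120 8 15 ∷ ran 6172 10 20 ∷
           ran 12704 11 13 ∷ ran 6417 11 18 ∷ cel 12 0 928386926000 ∷ cel 1 0 2007003000 ∷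
           cel 15 1 969960000000000317000000000000000 ∷ cel 1 1 13008000000000008000000000000000 ∷
           cel 65 2 7492325105000113214000000478988194 ∷ cel 1 2 41011056026000043040000000055037025 ∷
           cel 31 3 969000000000000261000000 ∷ cel 1 3 10000000000000012000000 ∷
           cel 23 4 973000000000000000000000203000 ∷ cel 1 4 1000000000000000000000022000 ∷
           cel 56 5 132087000992000000073000000 ∷ cel 1 5 20007000014000000015000000 ∷
           cel 31 6 210000000000000987000000000000000 ∷ cel 1 6 8000000000000014000000000000000 ∷
           cel 253 7 68000116000000324866625000433887997456 ∷
           cel 1 7 77000133000000033086119000145019209156 ∷ fac 39665 6 5 ∷ fac 36740 7 5 ∷ fac 5446 5 2 ∷
           fac 26660 3 1 ∷ fac 5528 5 1 ∷ fac 560 6 4 ∷ fac 48367 2 0 ∷ fac 3950 5 0 ∷ fac 36767 7 0 ∷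
           fac 7722 3 2 ∷ fac 14907 2 2 ∷ sqr 3351 30 31035022035050050042043041040012000012 ∷
           sqr 1820 30 34046041054055051039034032042021016000 ∷
           sqr 1237 29 30035059037000030040039024004027055022 ∷
           sqr 1056 30 33042031039049054047051048022014015000 ∷
           sqr 1194 30 31034021023034031054053038045027000015 ∷
           sqr 631 30 34043046055052052036030047000021033004 ∷
           sqr 841 30 30040051030000033050055020019022032018 ∷
           sqr 795 25 27035000025055031010022029051028042015 ∷
           sqr 387 30 34047027052052051035036041047023025000 ∷
           sqr 235 25 27032055046000027054040018022028026007 ∷
           sqr 227 30 32038016053056039000010041027040051025 ∷ []))
         (leaf (ran 18051 11 14 ∷ ran 14714 6 20 ∷ ran 18108 10 19 ∷ ran 7275 7 17 ∷ ran 7240 9 19 ∷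
           ran 14948 11 15 ∷ ran 11422 11 16 ∷ ran 5576 5 19 ∷ ran 7960 7 19 ∷ ran 18117 8 18 ∷
           ran 1836 6 18 ∷ cel 33 0 971616000000000138000000000000042 ∷
           cel 1 0 19006000000000008000000000000008 ∷ cel 17 1 269729000000000000000945000000000 ∷
           cel 1 1 11009000000000000000015000000000 ∷ cel 19 2 271000956678000000000461000000000914556 ∷
           cel 1 2 13000004014000000000017000000000009018 ∷ cel 28 3 970000000000066113000000 ∷
           cel 1 3 4000000000019027000000 ∷ cel 26 4 972000000000000000000000099000 ∷
           cel 1 4 8000000000000000000000020000 ∷ cel 40 5 293017128066000998000000120000000 ∷
           cel 1 5 38038029012000040000000034000000 ∷ cel 19 6 978000000000000000 ∷
           cel 1 6 8000000000000000 ∷ cel 157 7 334000272266000995000876000508503743000 ∷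
           cel 1 7 6000111132000125000045000155146027000 ∷ fac 28014 6 5 ∷ fac 175120 7 6 ∷ fac 194192 7 5 ∷
           fac 11000 5 2 ∷ fac 23158 3 1 ∷ fac 18656 7 1 ∷ fac 2273 4 3 ∷ fac 1784 6 4 ∷ fac 2374 6 0 ∷
           fac 6003 3 0 ∷ fac 9994 1 0 ∷ fac 35747 7 0 ∷ fac 5679 2 2 ∷
           sqr 2448 19 10007018032047035049042036029013000006 ∷
           sqr 572 12 15005018032041038008019011042006002000 ∷
           sqr 763 26 30000039048048056035037040054038028022 ∷
           sqr 1029 30 30031059031000017032015024023039045039 ∷
           sqr 688 26 35028000032051008004015048056017016026 ∷
           sqr 539 25 55005044022002041039036000019031055030 ∷
           sqr 303 30 29031031027014045045033000023025038032 ∷ fac 1867 6 2 ∷ fac 717 5 3 ∷ fac 946 5 0 ∷ [])))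
        (branch 0 1 119
         (leaf (ran 2699 9 19 ∷ ran 5142 10 19 ∷ ran 4563 9 15 ∷ ran 2803 6 18 ∷ ran 10290 11 14 ∷
           ran 1198 9 18 ∷ ran 4563 11 16 ∷ ran 7426 8 19 ∷ ran 1159 6 17 ∷ ran 3884 9 14 ∷
           cel 8 0 933000169000000000840000714000000 ∷ cel 19 1 186000000409000204000372990120000 ∷
           cel 12 2 940000000218000323000000303 ∷ cel 8 3 983000000000000000000000 ∷
           cel 20 5 132000000000000991000257000000068 ∷ cel 6 6 436000000000000952000630000000000 ∷
           cel 116 7 935188000226226991051 ∷ fac 14565 6 5 ∷ fac 5563 7 5 ∷ fac 2822 5 3 ∷ fac 6772 5 2 ∷
           fac 3216 5 1 ∷ fac 2424 6 1 ∷ fac 9272 7 4 ∷ fac 1663 6 4 ∷ fac 11385 1 0 ∷ fac 4826 5 0 ∷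
           fac 9249 2 1 ∷ fac 1463 3 3 ∷ fac 5467 4 3 ∷ fac 1599 1 1 ∷ fac 14131 2 0 ∷ fac 2307 5 5 ∷
           fac 2424 3 2 ∷ fac 1903 6 2 ∷ []))
         (leaf (ran 8512 9 19 ∷ ran 412 8 18 ∷ ran 4889 11 19 ∷ ran 749 10 19 ∷ ran 2813 8 14 ∷
           ran 6134 6 18 ∷ ran 2799 10 17 ∷ ran 1776 11 16 ∷ ran 3862 11 15 ∷ ran 2922 10 20 ∷
           ran 1880 8 16 ∷ cel 10 0 155739983486000190000000000263214 ∷
           cel 1 0 8002002007000007000000000004002 ∷ cel 10 1 269000624945000000041052513000000 ∷
           cel 1 1 5000008003000000001009009000000 ∷ cel 6 2 875495000000000216000000053000507 ∷
           cel 1 2 1003000000000004000000001000005 ∷ cel 7 3 189000000881000100000000000271000 ∷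
           cel 1 3 5000000007000002000000000003000 ∷ cel 8 5 316636000388231000973000000000000358 ∷
           cel 1 5 4006000003000000004000000000000000 ∷ cel 5 6 850708236000000000 ∷ cel 1 6 2001000000000 ∷
           cel 69 7 321133405192000285985173000200448589045 ∷ cel 1 7 3029003036000011027044000037038046066 ∷
           fac 6010 6 5 ∷ fac 3515 5 3 ∷ fac 1210 5 2 ∷ fac 4746 5 1 ∷
           sqr 14791 5 2000006009015015009009011008007005003 ∷
           sqr 12771 10 3009008012017019020019015012008000005 ∷
           sqr 4453 7 5006000007017012010011009009003007006 ∷
           sqr 7383 4 1000014007004014012009005006008004000 ∷ fac 298 3 0 ∷ fac 2256 2 1 ∷ fac 2194 5 0 ∷ [])))))))
    (branch 0 1 135
     (branch 0 8 255
      (leaf (ran 491 6 14 ∷ ran 38681 7 14 ∷ ran 9071 10 16 ∷ ran 9122 8 14 ∷ ran 3477 11 16 ∷ ran 985 9 17 ∷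
        ran 7796 8 15 ∷ ran 7362 6 16 ∷ ran 9424 9 18 ∷ ran 3791 6 20 ∷ ran 12886 5 14 ∷ ran 3154 6 17 ∷
        cel 33 0 110000057037000000000012985933545088000 ∷ cel 1 0 3000020009000000000010023018006025000 ∷
        cel 31 1 518970678511256000000450204069427189000 ∷ cel 1 1 23023031019004000000026031014025014000 ∷
        cel 45 2 102058000000000000076993972946000000 ∷ cel 1 2 7026000000000000024007010026000000 ∷
        cel 32 3 246248846988240000 ∷ cel 1 3 10018001014028000 ∷
        cel 428 4 154000018000057000000095000531356996000 ∷ cel 1 4 171000419000137000000291000086085353000 ∷
        fac 35187 2 1 ∷ fac 3996 2 2 ∷ fac 7768 3 1 ∷ sqr 6710 14 10010012022026038041044026024009001 ∷
        sqr 1735 18 3021015024024048030047034010013013000 ∷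
        sqr 1755 14 6000008000014001044020029029028022021 ∷ sqr 1255 20 13009029008032029050031030026021014 ∷
        sqr 409 14 6003004000014022044036038014021023011 ∷ sqr 115 21 2002012000033008051029039035044038031 ∷
        sqr 968 15 45017014025021026015028015026033000001 ∷
        sqr 387 18 6000008011033029048042041032022029013 ∷
        sqr 310 17 37000001025020047014045022018027021010 ∷ []))
      (leaf (ran 301 6 14 ∷ ran 6153 7 14 ∷ ran 3903 8 14 ∷ ran 1707 9 20 ∷ ran 8819 9 14 ∷ ran 371 9 24 ∷
        ran 1050 10 18 ∷ ran 1297 10 19 ∷ ran 1249 11 15 ∷ ran 530 6 18 ∷ ran 1614 7 17 ∷ ran 1138 7 15 ∷
        ran 2328 6 16 ∷ cel 9 0 114000000000259095000907000000108000042 ∷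
        cel 1 0 2000000000008001000001000000009000006 ∷ cel 14 1 348294232000409000663372665916958000088 ∷
        cel 1 1 1002009000003000012012009013003000010 ∷ cel 20 2 201335985000000 ∷ cel 1 2 10003005000000 ∷
        cel 12 3 790967000182000 ∷ cel 1 3 1004000007000 ∷ cel 150 4 23000000018000072033054096112084995000 ∷
        cel 1 4 63000000135000100039085087125120129000 ∷ fac 13509 2 1 ∷ fac 7796 1 1 ∷ fac 13845 1 0 ∷
        fac 6117 3 0 ∷ sqr 7856 6 2000003004011010016014014011007010004 ∷
        sqr 4715 10 16015017012015015000006015012005001006 ∷
        sqr 5083 10 11009008013016014000009011010009011010 ∷ sqr 746 8 3000018014016012018015005013010 ∷
        sqr 1104 6 3008007007016006010000000001007008003 ∷ sqr 742 10 1009011014013018000014012011008011009 ∷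
        sqr 2819 10 12010010009017011007000010010012010010 ∷
        sqr 1221 10 7008008008012013013013019012000011010 ∷ [])))
     (branch 0 7 228
      (branch 0 4 152
       (branch 0 1 117
        (branch 0 9 280
         (branch 0 8 262
          (leaf (ran 16549 6 14 ∷ ran 11837 10 14 ∷ ran 13009 7 16 ∷ ran 8824 7 19 ∷ ran 10997 11 14 ∷
            ran 254 7 21 ∷ ran 9031 8 18 ∷ ran 3015 7 17 ∷ ran 16811 9 14 ∷ ran 14299 7 15 ∷ ran 9162 8 17 ∷
            ran 6858 7 20 ∷ cel 24 0 216000000032000992000000000000 ∷ cel 1 0 19000006000000000000 ∷
            cel 15 1 102000970000527000 ∷ cel 1 1 3000002000005000 ∷
            cel 11 2 327000000000000000924000503867697000 ∷ cel 1 2 1000000000000000000000008002001000 ∷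
            cel 19 3 80517948000000704000000000000000 ∷ cel 1 3 16001000000004000000000000000 ∷
            cel 31 4 39032000000994062000000000000 ∷ cel 1 4 16007000000022003000000000000 ∷
            cel 44 6 70079030047000000997000127249000000 ∷ cel 1 6 13016030036000000007000023038000000 ∷
            cel 14 7 390000293027954000 ∷ cel 1 7 9000006011006000 ∷
            cel 428 8 146073000075000000021005000106122996027 ∷
            cel 1 8 275083000195000000218126000398306353154 ∷ fac 27560 8 4 ∷ fac 25627 8 5 ∷ fac 12469 7 3 ∷
            fac 28341 6 3 ∷ fac 23007 3 2 ∷ fac 17927 6 2 ∷ fac 19041 5 1 ∷ fac 17024 8 1 ∷ fac 2363 5 0 ∷
            fac 1400 7 0 ∷ fac 10822 5 2 ∷ sqr 1502 30 9009009007008050051050050051052051 ∷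
            sqr 5736 20 9014023018033037040049050039037004000 ∷
            sqr 905 18 23003009035039044043048013036031007000 ∷
            sqr 3086 30 30031031035032022035033000030041034032 ∷
            sqr 615 26 1028036026042050051049047031056017000 ∷
            sqr 598 23 5021029012037038043046041053000019009 ∷
            sqr 221 30 28035034036028010000001030032033031045 ∷
            sqr 180 18 22006007009048043045044033040014005000 ∷ fac 5088 6 6 ∷ []))
          (leaf (ran 11232 7 14 ∷ ran 14047 9 14 ∷ ran 5812 8 18 ∷ ran 4982 6 16 ∷ ran 278 10 17 ∷
            ran 615 6 20 ∷ ran 5851 7 17 ∷ ran 3085 6 19 ∷ ran 4410 11 15 ∷ ran 1550 8 15 ∷ ran 2149 10 15 ∷
            ran 2049 10 20 ∷ ran 425 10 21 ∷ ran 877 10 22 ∷ cel 18 0 69000000963979000000 ∷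
            cel 1 0 6000000014010000000 ∷ cel 17 1 53000069047000952643227000 ∷
            cel 1 1 16000011014000005012002000 ∷ cel 7 2 517000000000000000000000775906000000 ∷
            cel 1 2 3000000000000000000000006000000000 ∷ cel 14 3 93000940000000315000000000000000 ∷
            cel 1 3 7000002000000010000000000000000 ∷ cel 15 4 69000020948224000000000000 ∷
            cel 1 4 12000006002008000000000000 ∷ cel 3 5 670000000000000000000000000103000 ∷ cel 1 5 2000 ∷
            cel 20 6 975000082436000000 ∷ cel 1 6 4000007004000000 ∷ cel 6 7 857000853000 ∷
            cel 1 7 3000004000 ∷ cel 195 8 65000012000097000000144182038000995000 ∷
            cel 1 8 36000185000188000000139037161000167000 ∷ fac 26927 8 4 ∷ fac 65070 8 5 ∷ fac 6124 7 3 ∷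
            fac 10365 6 3 ∷ fac 7200 3 2 ∷ fac 6445 6 2 ∷ fac 2428 6 6 ∷ fac 7535 5 1 ∷ fac 10952 8 1 ∷
            fac 1965 3 1 ∷ fac 1167 4 0 ∷ fac 15373 2 0 ∷ fac 255 1 1 ∷ fac 368 7 0 ∷ fac 1732 4 1 ∷
            fac 3723 4 3 ∷ fac 3577 2 2 ∷ sqr 4943 6 7000002003009013013014016015004001004 ∷
            sqr 6289 5 6002005005009011015014013003005003000 ∷
            sqr 1880 5 5001000007006009015013004010006007002 ∷
            sqr 4972 7 8004007005012013015017014011000006002 ∷
            sqr 7632 10 18015011014015011000005013009006002006 ∷ fac 645 5 4 ∷ [])))
         (branch 0 10 293
          (leaf (ran 2328 10 14 ∷ ran 985 8 17 ∷ ran 783 9 18 ∷ ran 527 9 15 ∷ ran 1098 6 14 ∷ ran 806 7 16 ∷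
            ran 310 9 16 ∷ ran 1219 7 20 ∷ ran 301 9 19 ∷ ran 514 11 15 ∷ ran 381 8 14 ∷ ran 208 7 13 ∷
            cel 3 0 27000000221000000086000000782154000 ∷ cel 1 0 2000000000000000001000000001000000 ∷
            cel 4 1 54000000060000000000000059902000133 ∷ cel 1 1 2000000000000000000000002001000000 ∷
            cel 3 2 871000000000086000192144031000 ∷ cel 1 2 1000000000002000001001000000 ∷
            cel 2 3 885000000034000000000000000 ∷ cel 1 3 2000000000000000 ∷
            cel 3 4 221100000000738412208000000000 ∷ cel 1 4 2000000003001001000000000 ∷
            cel 3 6 692000309102000000 ∷ cel 1 6 2000001003000000 ∷ cel 2 7 223000000000585000 ∷
            cel 1 7 1000000000001000 ∷ cel 31 8 45000000000054157000092097096000998105 ∷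
            cel 1 8 13000000000024022000007022028000010020 ∷ fac 4539 8 4 ∷ fac 6836 8 5 ∷ fac 1131 7 3 ∷
            fac 1448 6 3 ∷ fac 1269 3 2 ∷ fac 3724 2 1 ∷ fac 240 6 1 ∷ fac 761 8 3 ∷ fac 248 3 0 ∷
            fac 404 5 0 ∷ fac 146 4 3 ∷ fac 233 4 2 ∷ sqr 3815 4 5003005000004007014012010007002001000 ∷
            sqr 782 7 9006008005014017013012016013006001000 ∷ sqr 769 10 4003012007011018015012012009018014 ∷
            sqr 349 7 7011007017012008011013009012004002 ∷ sqr 316 7 4000004012011001013013008009017016009 ∷
            sqr 581 10 10011011012010009002009000006012015013 ∷
            sqr 413 10 10011014015011000017011013010019008007 ∷ []))
          (leaf (ran 4162 8 17 ∷ ran 6773 11 15 ∷ ran 7040 9 14 ∷ ran 3454 10 16 ∷ ran 451 8 16 ∷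
            ran 1032 6 16 ∷ ran 3283 10 20 ∷ ran 1626 8 24 ∷ ran 319 11 14 ∷ ran 7072 7 14 ∷
            cel 3 0 755000000000000000000000000556 ∷ cel 1 0 1 ∷ cel 9 1 314000000066000285907000082 ∷
            cel 1 1 8000000001000003008000009 ∷ cel 9 2 959000000209696000286066286000 ∷
            cel 1 2 5000000000003000005001005000 ∷ cel 7 3 85116970000000124000000000000000 ∷
            cel 1 3 5002000000001000000000000000 ∷ cel 8 4 102964664000000000000 ∷
            cel 1 4 1007001000000000000 ∷ cel 9 6 964057000000000000 ∷ cel 1 6 5002000000000000 ∷
            cel 5 7 667000000000879000 ∷ cel 1 7 2000000000004000 ∷
            cel 116 8 8000000017068192000034000034087990000 ∷
            cel 1 8 64000000012047105000023000023060067000 ∷ fac 7981 8 4 ∷ fac 24934 8 5 ∷ fac 2456 7 3 ∷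
            fac 8132 6 3 ∷ fac 6374 3 2 ∷ fac 12897 2 1 ∷ fac 3856 6 1 ∷ fac 21218 8 3 ∷ fac 5504 8 6 ∷
            fac 1998 7 0 ∷ fac 4732 2 0 ∷ fac 1414 4 0 ∷ fac 1414 1 0 ∷ fac 156 6 6 ∷
            sqr 81329 2 2002002000002003006005004003001001000 ∷
            sqr 40665 3 3002002003006007004006005004000003001 ∷ fac 363 4 2 ∷ fac 152 1 1 ∷ fac 186 2 2 ∷
            fac 429 4 1 ∷ []))))
        (branch 0 8 271
         (leaf (ran 198196 10 21 ∷ ran 124893 7 14 ∷ ran 183571 7 16 ∷ ran 88745 6 21 ∷ ran 201254 11 18 ∷
           ran 148278 8 17 ∷ ran 3752 9 16 ∷ ran 43732 10 17 ∷ ran 78792 7 20 ∷ ran 144678 8 19 ∷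
           ran 97961 6 16 ∷ ran 175398 7 15 ∷ ran 21373 11 16 ∷ cel 652 0 38000000000132997516229000000000 ∷
           cel 1 0 312000000000395507392295000000000 ∷ cel 485 1 488803000000638997080000000069037 ∷
           cel 1 1 465380000000397046007000000152427 ∷ cel 177 2 997000000717000000000000000 ∷
           cel 1 2 162000000119000000000000000 ∷ cel 202 3 12000000000000000000996000 ∷
           cel 1 3 15000000000000000000025000 ∷ cel 147 5 398000241000000340996415992000000769 ∷
           cel 1 5 4000071000000095042142009000000020 ∷ cel 311 6 280000000369998000 ∷
           cel 1 6 211000000051239000 ∷ cel 2062 7 211000166698389000453616998885000528047 ∷
           cel 2 7 37000136157405000347802719938000805199 ∷ fac 17854 6 3 ∷ fac 47114 5 3 ∷ fac 133756 6 2 ∷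
           fac 82324 5 2 ∷ fac 115109 6 1 ∷ fac 358882 6 0 ∷ fac 157188 1 0 ∷ fac 1465067 7 0 ∷
           fac 9551 7 2 ∷ fac 1137342 7 4 ∷ sqr 1661 59 74011051158077111144133159091052000015 ∷
           sqr 2646 58 61034059051063099063066158079048000040 ∷
           sqr 3614 21 28001026032026057029020121032018020000 ∷
           sqr 1154 37 47015027084046092136137006048023039000 ∷
           sqr 905 46 57012033034064146121110108060023046000 ∷
           sqr 766 34 47000026089056084054058134106010034006 ∷
           sqr 191 52 64001000102090152116114114137003011021 ∷
           sqr 273 100 99111088104131111095104000139063131109 ∷
           sqr 195 44 50000030066060066053057144075050010040 ∷
           sqr 89 100 105100102123084120179164129000147100053 ∷
           sqr 212 64 66049025088091097068066021164000061078 ∷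
           sqr 13 60 71000024160112077083090110154051008062 ∷
           sqr 84 67 82000023154117156111125113167024065054 ∷ []))
         (branch 0 1 108
          (branch 0 5 176
           (leaf (ran 1645 9 21 ∷ ran 216 8 16 ∷ ran 3336 7 18 ∷ ran 1180 10 20 ∷ ran 1239 7 14 ∷
             ran 7610 9 15 ∷ ran 3007 6 20 ∷ ran 6195 8 17 ∷ ran 258 8 24 ∷ ran 4755 7 16 ∷ ran 858 8 22 ∷
             ran 1977 9 16 ∷ ran 6788 11 14 ∷ ran 2301 10 18 ∷ ran 5307 10 19 ∷
             cel 2 0 438861714000000000000000683000000 ∷ cel 1 0 2001000000000000000000000000 ∷
             cel 4 1 330000786000 ∷ cel 1 1 4000002000 ∷ cel 8 2 128000000000000142892000000 ∷
             cel 1 2 2000000000 ∷ cel 17 3 547948845000038000020000000000000 ∷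
             cel 1 3 11013017000016000013000000000000 ∷ cel 6 4 55222974000000283000000000000000 ∷
             cel 1 4 3002001000000001000000000000000 ∷ cel 4 5 633000366000151914804000000267000 ∷
             cel 1 5 3000004000003001004000000003000 ∷ cel 3 7 77000000000000888772000000 ∷
             cel 1 7 1000000000000002001000000 ∷ cel 5 8 953000 ∷ cel 1 8 5000 ∷
             cel 69 9 185000113364775000255639526462294985000 ∷
             cel 1 9 32000066053003000020007031039045027000 ∷ fac 38145 9 5 ∷ fac 2965 7 4 ∷ fac 7905 5 3 ∷
             fac 27255 9 3 ∷ fac 1462 5 2 ∷ fac 4466 4 1 ∷ fac 6994 2 1 ∷ fac 2654 8 0 ∷ fac 4225 7 0 ∷
             fac 2382 1 0 ∷ fac 1988 4 2 ∷ fac 392 3 1 ∷ fac 4961 9 8 ∷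
             sqr 1524 13 4005018023043042030033020009009000 ∷
             sqr 563 21 24000015028051038046044044037025021010 ∷
             sqr 1762 10 12002000007017020024040027016002006004 ∷ fac 737 8 4 ∷ []))
           (leaf (ran 3960 8 14 ∷ ran 776 7 17 ∷ ran 2120 9 19 ∷ ran 394 6 14 ∷ ran 1025 10 21 ∷
             ran 1867 9 18 ∷ ran 1298 11 13 ∷ ran 1439 11 17 ∷ ran 491 6 24 ∷ ran 3579 6 15 ∷ ran 1508 7 16 ∷
             ran 2486 7 24 ∷ ran 720 8 20 ∷ ran 3649 10 20 ∷ ran 1666 9 16 ∷
             cel 5 0 56050000000000186540000178208834000 ∷ cel 1 0 4000000000000002002000001004002000 ∷
             cel 1 1 926000 ∷ cel 5 2 119000000000000000831000000 ∷ cel 1 2 1000000000000000004000000 ∷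
             cel 8 3 458890773000000000538252000000000 ∷ cel 1 3 4003005000000000003006000000000 ∷
             cel 1 4 492000122000000330000000000000000 ∷ cel 5 5 240000188000000811616000000749000 ∷
             cel 1 5 3000001000000001003000000002000 ∷ cel 2 7 96000000000000533000150300000000 ∷
             cel 1 7 1000000000000001000002000000000 ∷ cel 41 9 189000104577981000294346547500524746000 ∷
             cel 1 9 39000014022011000037012020035008021000 ∷ fac 35726 9 5 ∷ fac 16369 9 7 ∷ fac 2957 7 4 ∷
             fac 5565 5 3 ∷ fac 6818 9 3 ∷ fac 577 5 2 ∷ fac 5882 4 1 ∷ fac 4233 2 1 ∷ fac 3009 4 0 ∷
             fac 384 2 0 ∷ fac 1578 5 0 ∷ fac 1007 3 1 ∷ sqr 4466 10 11012014013012003000004006008018012011 ∷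
             sqr 2525 7 8000005009017013015015015012008007003 ∷
             sqr 3353 4 4000001006009004008008014005010004002 ∷
             sqr 2032 6 7000002016014009006009012012013007004 ∷ fac 137 7 2 ∷ [])))
          (leaf (ran 7223 11 15 ∷ ran 4434 6 21 ∷ ran 1790 9 20 ∷ ran 1829 11 24 ∷ ran 12187 7 19 ∷
            ran 1459 10 15 ∷ ran 13900 10 18 ∷ ran 2508 7 15 ∷ ran 7754 10 17 ∷ ran 6352 6 17 ∷
            ran 10334 7 20 ∷ ran 19429 9 16 ∷ ran 6349 11 14 ∷ ran 17873 8 20 ∷
            cel 30 0 490796986000046623050000000061103 ∷ cel 1 0 3002001000005020013000000006025 ∷
            cel 5 1 842000000000000000535000000 ∷ cel 1 1 4000000000000000001000000 ∷
            cel 3 3 732000000000000240000000000000000 ∷ cel 1 3 2000000000000001000000000000000 ∷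
            cel 24 4 158000000989790282000636000 ∷ cel 1 4 15000000019013005000011000 ∷
            cel 8 6 358000000322953000787070000000 ∷ cel 1 6 5000000004007000007003000000 ∷
            cel 17 7 438000000000946000 ∷ cel 1 7 2000000000016000 ∷
            cel 202 8 998000049138508000000327380548000196000 ∷
            cel 1 8 30000115049075000000102138153000151000 ∷ fac 14253 7 4 ∷ fac 3205 6 4 ∷ fac 221431 8 4 ∷
            fac 75571 8 6 ∷ fac 7931 7 3 ∷ fac 12387 6 3 ∷ fac 8918 4 1 ∷ fac 4774 3 1 ∷ fac 15261 7 0 ∷
            fac 18641 4 0 ∷ fac 54886 8 0 ∷ fac 937330 8 8 ∷ fac 55127 8 7 ∷
            sqr 2068 18 9015047048026032042043020020018006 ∷
            sqr 1801 22 25000009010029049052039047041018013023 ∷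
            sqr 1294 22 4016025021052047045037042029012000009 ∷
            sqr 836 21 24000015028051038046044044037025021010 ∷
            sqr 927 25 24019020049047050055052041027022000003 ∷
            sqr 692 16 19007016016029034046044040009017010000 ∷
            sqr 218 21 23014017051048048042035044030011014000 ∷
            sqr 1057 30 16019026000025043042040038043033030037 ∷
            sqr 218 16 18016015013021046038042005013015020000 ∷ [])))))
       (branch 0 1 120
        (branch 0 8 259
         (leaf (ran 21349 5 14 ∷ ran 5001 9 14 ∷ ran 652 10 21 ∷ ran 3579 11 16 ∷ ran 717 6 16 ∷
           ran 7716 6 15 ∷ ran 6021 6 18 ∷ ran 15808 8 20 ∷ ran 4360 11 24 ∷ ran 45083 7 14 ∷ ran 4977 5 15 ∷
           ran 11037 10 19 ∷ ran 411 8 24 ∷ ran 2634 6 21 ∷ cel 51 0 207129065000037121998934497052000 ∷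
           cel 1 0 21009016000017005048003021003000 ∷ cel 32 1 665828387000000000000000000327978039000 ∷
           cel 1 1 24025030000000000000000000002021021000 ∷ cel 61 2 107261874985214000 ∷
           cel 1 2 50018015008024000 ∷ cel 46 3 28000077053000027981040000006197000 ∷
           cel 1 3 27000031045000045012021000027005000 ∷ cel 3 4 911000000000000000000000000000 ∷
           cel 1 4 1000000000000000000000000000 ∷ cel 45 5 998439199144000000 ∷ cel 1 5 24042008032000000 ∷
           cel 9 6 396075000000000653971000777012000 ∷ cel 1 6 6005000000000001005000006004000 ∷
           cel 556 7 82000033195000000000000007165343997000 ∷
           cel 1 7 480000050080000000000000408294242301000 ∷ fac 4671 4 3 ∷ fac 27969 5 1 ∷ fac 20177 2 1 ∷
           fac 14596 1 1 ∷ fac 3007 3 2 ∷ fac 2169 4 0 ∷ fac 78049 7 0 ∷ fac 38557 7 6 ∷ fac 2485 6 1 ∷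
           fac 42640 7 5 ∷ sqr 1877 18 14016020026030031000010036035048017015 ∷
           sqr 1657 24 44014020053054025000003031038047027025 ∷
           sqr 4474 30 32038037033032035000012032037026029031 ∷
           sqr 4641 30 36029036035027022008000008036036043044 ∷
           sqr 183 19 20023018034000028040049013023004006005 ∷ []))
         (branch 0 10 296
          (leaf (ran 10339 9 14 ∷ ran 3502 6 15 ∷ ran 13111 5 14 ∷ ran 4627 8 19 ∷ ran 12114 7 24 ∷
            ran 2254 10 14 ∷ ran 2859 10 18 ∷ ran 3189 7 20 ∷ ran 133 11 18 ∷ ran 1944 8 21 ∷ ran 1093 6 14 ∷
            ran 1705 11 20 ∷ cel 10 0 70000000213000100000000000914022000 ∷
            cel 1 0 9000000009000004000000000003006000 ∷ cel 18 1 80000000000000000957000000 ∷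
            cel 1 1 5000000000000000004000000 ∷ cel 23 2 16128000146000000047000577958303000 ∷
            cel 1 2 18005000020000000009000023014021000 ∷ cel 39 3 11000000000000134404794974208000 ∷
            cel 1 3 18000000000000028033022001033000 ∷ cel 18 4 52000023000015970142000000070000 ∷
            cel 1 4 3000013000012017013000000017000 ∷ cel 17 6 65000000970197164000000000 ∷
            cel 1 6 13000000003014000000000000 ∷ cel 3 7 719000000000000000 ∷ cel 1 7 1000000000000000 ∷
            cel 195 8 148049000031000065041000000156306995000 ∷
            cel 1 8 1148000109000065110000000125181167000 ∷ fac 9029 6 2 ∷ fac 3198 4 1 ∷ fac 13591 2 1 ∷
            fac 1036 7 1 ∷ fac 8014 3 1 ∷ fac 6353 3 2 ∷ fac 5412 8 7 ∷ fac 878 5 2 ∷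
            sqr 14899 8 7008008012014016016018014013005002 ∷
            sqr 20052 5 6005004005006008014015008003002000000 ∷
            sqr 35368 2 1000002005004003004001003012011002000 ∷
            sqr 28543 6 5005007009010010000003012012016006005 ∷ fac 22558 8 3 ∷ fac 870 4 0 ∷ fac 2617 3 0 ∷
            fac 946 6 1 ∷ fac 40022 8 2 ∷ fac 236 7 0 ∷ []))
          (leaf (ran 2760 9 14 ∷ ran 3577 7 14 ∷ ran 2772 5 24 ∷ ran 1814 11 15 ∷ ran 525 6 14 ∷
            ran 1668 10 20 ∷ ran 131 10 19 ∷ ran 131 8 18 ∷ ran 1792 8 24 ∷
            cel 4 0 176000000000000000971000000000211 ∷ cel 1 0 1000000000000000003000000000004 ∷
            cel 6 1 48000000000000529991000000 ∷ cel 1 1 5004000000 ∷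
            cel 6 2 104878000000000000179000069280000000 ∷ cel 1 2 2002000000000000001000001002000000 ∷
            cel 7 3 555000000000000111427933903057000 ∷ cel 1 3 2000000000000005006002000004000 ∷
            cel 4 4 176000000000000941310000000157000 ∷ cel 1 4 1000000000000002000000000003000 ∷
            cel 6 6 879464031154000000 ∷ cel 1 6 1005004005000000 ∷ cel 2 7 348000321000537000 ∷
            cel 1 7 1000001000001000 ∷ cel 53 8 222000000000000242995000 ∷ cel 1 8 45000000000000043014000 ∷
            fac 630 8 4 ∷ fac 165 6 2 ∷ fac 252 4 1 ∷ fac 3960 2 1 ∷ fac 879 7 1 ∷ fac 1764 3 1 ∷
            fac 3703 3 2 ∷ fac 423 1 0 ∷ fac 4112 2 0 ∷ fac 863 4 0 ∷ fac 3298 3 0 ∷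
            sqr 88390 2 2002002002002003006006003001001000000 ∷ fac 4536 8 5 ∷ fac 915 2 2 ∷ fac 220 0 0 ∷
            fac 250 4 3 ∷ []))))
        (branch 0 5 175
         (branch 0 10 295
          (leaf (ran 15527 8 14 ∷ ran 1754 5 20 ∷ ran 13957 10 20 ∷ ran 5824 8 20 ∷ ran 1102 7 21 ∷
            ran 11914 6 19 ∷ ran 2502 11 19 ∷ ran 3395 9 19 ∷ ran 6818 9 16 ∷ ran 10654 7 15 ∷
            ran 8988 7 18 ∷ ran 157 5 24 ∷ ran 3193 9 18 ∷ ran 4783 7 14 ∷
            cel 10 0 67000000995000000000364497808248000 ∷ cel 1 0 3000000002000000000006007006002000 ∷
            cel 4 1 460000000000705928000000000 ∷ cel 1 1 2000000000002003000000000 ∷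
            cel 22 2 541967000498000388000000000015 ∷ cel 1 2 11013000020000020000000000020 ∷
            cel 15 3 27000179971488448000 ∷ cel 1 3 4000002013014008000 ∷
            cel 22 4 671502000000110000988641000078000 ∷ cel 1 4 18020000000019000006003000017000 ∷
            cel 2 6 936000000000000000000 ∷ cel 1 6 2000000000000000000 ∷
            cel 195 8 98000024140000000000000000521711995269 ∷
            cel 1 8 4000033013000000000000000183081167054 ∷ fac 100927 8 4 ∷ fac 18302 4 3 ∷ fac 16891 4 2 ∷
            fac 48693 8 6 ∷ fac 1518 7 1 ∷ fac 9255 6 1 ∷ fac 8696 4 1 ∷ fac 13406 3 2 ∷ fac 49119 8 3 ∷
            fac 2985 2 0 ∷ fac 5995 7 0 ∷ fac 1338 6 0 ∷ fac 2949 8 0 ∷ fac 1899 2 1 ∷ fac 7679 3 1 ∷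
            fac 27658 8 7 ∷ sqr 28065 6 3002008012010011014016010004005003 ∷
            sqr 8500 8 10003006018011013000002009016013008011 ∷
            sqr 7403 10 10009009018014012002006000012014010012 ∷
            sqr 3876 3 4001004009010005004002009013003003000 ∷
            sqr 1905 4 6000001013014008003011005008002004001 ∷
            sqr 3740 7 7006012010017003000004010007006007008 ∷ []))
          (leaf (ran 17885 8 14 ∷ ran 15019 7 20 ∷ ran 31155 11 24 ∷ ran 12639 11 19 ∷ ran 10483 10 16 ∷
            ran 4258 9 19 ∷ ran 21577 11 18 ∷ ran 4012 7 19 ∷ ran 4692 10 15 ∷ ran 1663 6 21 ∷
            ran 3580 7 14 ∷ ran 582 6 15 ∷ ran 7802 7 15 ∷ cel 37 0 189189000000000000047000000782974 ∷
            cel 1 0 11000000000000015000000002022 ∷ cel 9 1 965510000000 ∷ cel 1 1 6005000000 ∷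
            cel 39 2 558986062000378000355000000022079 ∷ cel 1 2 7017022000032000029000000032015 ∷
            cel 45 3 983000230000183572386000000 ∷ cel 1 3 4000022000042037002000000 ∷
            cel 67 4 109230000000000000991111000145000 ∷ cel 1 4 46007000000000000062021000042000 ∷
            cel 36 6 354000000000000975000000000000 ∷ cel 1 6 1000000000000026000000000000 ∷
            cel 13 7 163000000942000 ∷ cel 1 7 9000000000000 ∷
            cel 150 8 298000166560786000025463000775436995158 ∷
            cel 1 8 69000140113007000119148000146096129144 ∷ fac 116343 8 4 ∷ fac 49759 4 3 ∷ fac 1375 4 2 ∷
            fac 19413 7 1 ∷ fac 7062 6 1 ∷ fac 5501 4 1 ∷ fac 9342 3 2 ∷ fac 9511 1 0 ∷ fac 5277 3 0 ∷
            fac 3585 0 0 ∷ fac 1076 6 0 ∷ fac 11877 7 3 ∷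
            sqr 4783 30 37050052045049047047032006000000009003 ∷
            sqr 1002 17 9006024035028033042047029012015007 ∷
            sqr 2230 21 22010020022042032010025051033000006023 ∷
            sqr 965 11 16000002038041022007032013023006010002 ∷
            sqr 714 21 23000019039051031032016016048020021023 ∷ fac 1107 4 4 ∷ fac 4076 8 1 ∷ fac 937 6 4 ∷
            fac 22705 8 5 ∷ [])))
         (leaf (ran 97333 6 24 ∷ ran 1988 6 18 ∷ ran 10314 7 15 ∷ ran 2044 7 24 ∷ ran 6211 6 16 ∷
           ran 5024 5 13 ∷ ran 3223 11 24 ∷ ran 9178 8 24 ∷ ran 4377 6 13 ∷ ran 4079 6 19 ∷ ran 3932 6 14 ∷
           ran 2186 6 21 ∷ ran 2190 9 24 ∷ ran 5541 9 20 ∷ ran 7177 10 14 ∷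
           cel 74 0 98084009000000087213101237000000986 ∷ cel 1 0 57040005000000038044017004000000029 ∷
           cel 45 1 225507538000000270978000000000031 ∷ cel 1 1 17008015000000042016000000000010 ∷
           cel 79 2 136326951993000 ∷ cel 1 2 48021007074000 ∷ cel 12 3 364327000000128000959139000899000 ∷
           cel 1 3 2012000000009000003004000002000 ∷ cel 5 5 264000000590000000945000000000 ∷
           cel 1 5 1000000000000000005000000000 ∷ cel 195 7 559017000166292000000164214995301387195 ∷
           cel 1 7 9153000085180000000111185167142122120 ∷ fac 50225 7 3 ∷ fac 2744 3 2 ∷ fac 16500 3 1 ∷
           fac 6253 2 1 ∷ fac 493 3 0 ∷ sqr 5462 11 21012010009014017020028021041001011000 ∷
           sqr 2227 14 19015010013017020028044016039004014000 ∷
           sqr 2018 11 21005006010017018031028022041011003000 ∷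
           sqr 1897 26 27028027024029030026038028056018000020 ∷
           sqr 736 26 27019020031040027035045049056024000019 ∷
           sqr 770 30 30030041042045021011000025052035030034 ∷
           sqr 811 28 26016028044043023014000031058045028039 ∷
           sqr 1865 30 28028028031030034039038033035030033 ∷
           sqr 718 30 31027024021035032058050051000037030020 ∷
           sqr 541 30 57020023039024021010000037038042037046 ∷
           sqr 1260 30 28027030029029030041035035036036033 ∷ [])))))
      (branch 0 7 220
       (branch 0 10 283
        (branch 0 5 182
         (branch 0 1 117
          (leaf (ran 4711 10 18 ∷ ran 23196 8 14 ∷ ran 5981 9 14 ∷ ran 8526 8 16 ∷ ran 11091 7 18 ∷
            ran 347 11 21 ∷ ran 2059 11 20 ∷ ran 938 5 20 ∷ ran 2167 10 19 ∷ ran 3116 9 19 ∷ ran 5301 8 15 ∷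
            ran 3558 10 17 ∷ ran 2120 10 20 ∷ cel 28 0 381000000000000000340965693045000 ∷
            cel 1 0 9000000000000000018012011003000 ∷ cel 13 1 36000000959268000000000000 ∷
            cel 1 1 3000000013005000000000000 ∷ cel 17 2 46000000000000000000104000985083000 ∷
            cel 1 2 15000000000000000000017000010007000 ∷ cel 19 3 111000000000000000000000962000 ∷
            cel 1 3 8000000000000000000000009000 ∷ cel 36 4 134038000012000000000000394971000000 ∷
            cel 1 4 7018000034000000000000005033000000 ∷ cel 1 5 428000000000000000000000000 ∷
            cel 16 6 414133952000 ∷ cel 1 6 10002010000 ∷ cel 5 7 738880000 ∷ cel 1 7 3000 ∷
            cel 253 8 129002000037150000000249000078000997000 ∷
            cel 1 8 62231000025027000000018000009000209000 ∷ fac 5717 4 3 ∷ fac 42747 8 5 ∷ fac 74901 8 3 ∷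
            fac 7908 5 2 ∷ fac 15528 7 1 ∷ fac 11412 6 1 ∷ fac 9302 1 0 ∷ fac 34695 4 0 ∷ fac 7139 0 0 ∷
            fac 6814 3 1 ∷ fac 772 6 0 ∷ fac 4048 6 4 ∷ fac 18327 8 6 ∷ fac 5702 8 7 ∷ fac 2841 7 4 ∷
            sqr 11888 10 1001000001000013015020013018018018018 ∷
            sqr 14541 9 7007009012018015019016012019000002003 ∷
            sqr 10128 10 20014013015015015012001000006005009005 ∷
            sqr 13912 7 8006007011012017015009013007010007000 ∷
            sqr 7179 5 9004007004014000013012015009008000000 ∷
            sqr 7607 10 10009012010010012013004000008020011011 ∷
            sqr 7095 3 2005007009006013000000006008001000 ∷
            sqr 5589 3 3000002005012013000000002008006006001 ∷
            sqr 2558 8 7010009009012005003015005018014000004 ∷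
            sqr 2690 7 8005004011009017003012004014000011003 ∷
            sqr 1529 6 16006008007010012001000010003009003004 ∷
            sqr 2115 10 14013013012010019011000010014007006 ∷
            sqr 2418 5 5003003007011015012012009006004004000 ∷ []))
          (leaf (ran 160283 8 17 ∷ ran 255535 11 18 ∷ ran 233346 10 14 ∷ ran 305489 8 20 ∷ ran 7050 10 21 ∷
            ran 140779 5 24 ∷ ran 355628 10 24 ∷ ran 191680 9 24 ∷ ran 262835 9 19 ∷ ran 80666 10 17 ∷
            ran 17395 7 24 ∷ ran 617409 8 16 ∷ ran 349460 8 15 ∷ ran 543143 7 18 ∷
            cel 401 0 996998000472758150000086745483 ∷ cel 1 0 57028000111032040000043079265 ∷
            cel 561 1 34000000000000998251000000000000 ∷ cel 1 1 190000000000000497358000000000000 ∷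
            cel 181 2 116000000000000000000778615000994000 ∷ cel 1 2 16000000000000000000052146000180000 ∷
            cel 435 3 998000 ∷ cel 1 3 229000 ∷ cel 803 4 285078000269000000000238384998000190 ∷
            cel 1 4 115450000028000000000345184752000588 ∷ cel 614 6 89000000429000270596000998000 ∷
            cel 1 6 217000000355000188021000039000 ∷ cel 40 7 985000 ∷ cel 1 7 14000 ∷
            cel 5888 8 245000000099270104000998272468000034000 ∷
            cel 6 8 851000000585466064000897004762000522000 ∷ fac 281947 4 3 ∷ fac 3831637 8 3 ∷
            fac 777370 7 1 ∷ fac 237808 6 1 ∷ fac 568529 7 0 ∷ fac 182938 2 0 ∷ fac 851743 3 0 ∷
            fac 1098065 8 0 ∷ fac 159631 6 4 ∷ fac 469196 8 1 ∷ fac 15708 8 2 ∷ fac 604125 8 5 ∷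
            sqr 9120 100 105062068099126127139195188122099000080 ∷
            sqr 5395 92 95143156152192134166029000045054029017 ∷
            sqr 8022 52 47034028070108152120124091059046042000 ∷
            sqr 10422 41 19032031069058141111061065043049038000 ∷
            sqr 4751 55 28041055088112095155103100068000052013 ∷
            sqr 4175 40 32015046043140084135078085043029036000 ∷
            sqr 2136 100 102111091081040010000115105108107107142 ∷
            sqr 4921 30 18032023032041017038079130031006000013 ∷
            sqr 1233 58 66030036082105035067153158092000015039 ∷
            sqr 1378 100 7123105096071000036116111102103107131 ∷
            sqr 1958 100 132115112104073119023000053086115099126 ∷
            sqr 628 100 66130115132058162067005000084119107105 ∷
            sqr 216 95 97146114138016195001000091061164147066 ∷
            sqr 55 51 68070058068000077023056151030076053029 ∷ fac 11841 4 1 ∷ [])))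
         (branch 0 1 120
          (branch 0 9 277
           (leaf (ran 518 10 19 ∷ ran 1406 6 15 ∷ ran 2618 6 14 ∷ ran 341 8 21 ∷ ran 3049 7 14 ∷
             ran 769 9 18 ∷ ran 4675 8 24 ∷ ran 291 11 18 ∷ ran 503 8 13 ∷ ran 155 8 19 ∷ ran 652 9 14 ∷
             ran 318 7 20 ∷ cel 4 0 30000029000000000000000206785025043000 ∷
             cel 1 0 2000002000000000000000002003003003000 ∷ cel 7 1 75164000000000000352993741000000 ∷
             cel 1 1 6005000000000000007002006000000 ∷ cel 8 2 71000000000263481927637323000 ∷
             cel 1 2 3000000000007000006005004000 ∷ cel 5 3 216921122000 ∷ cel 1 3 1001000000 ∷
             cel 4 4 764000 ∷ cel 1 4 1000 ∷ cel 6 5 128000000000158846917000150 ∷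
             cel 1 5 5000000000002005006000006 ∷ cel 5 7 48102000000000322342275923354000 ∷
             cel 1 7 4000000000000003003003001004000 ∷ cel 45 9 140083000000000000062237000000354993000 ∷
             cel 1 9 3035000000000000018035000000019028000 ∷ fac 574 5 4 ∷ fac 2829 5 2 ∷ fac 4720 5 1 ∷
             fac 3249 2 1 ∷ fac 1620 1 1 ∷ fac 1547 9 2 ∷ fac 1684 9 5 ∷
             sqr 52302 2 1002002003004004002004005006002000000 ∷
             sqr 51551 2 1002003003003004006003003003004000000 ∷ fac 15089 9 1 ∷ fac 199 4 0 ∷ fac 3197 7 1 ∷
             fac 361 7 5 ∷ fac 444 7 7 ∷ []))
           (leaf (ran 291 8 14 ∷ ran 176 9 24 ∷ ran 638 7 14 ∷ ran 429 8 15 ∷ ran 780 10 24 ∷ ran 379 8 24 ∷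
             ran 481 6 14 ∷ ran 101 10 13 ∷ cel 2 0 450285000542000106 ∷
             cel 2 1 198000000000000270515760000000 ∷ cel 2 2 131000000000175420326504245000 ∷
             cel 2 3 165542000000 ∷ cel 1 4 421000 ∷ cel 2 5 450788000145 ∷ cel 2 7 159324663392178000 ∷
             cel 11 9 300985070 ∷ fac 356 5 2 ∷ fac 909 5 1 ∷ fac 363 2 1 ∷ fac 758 1 1 ∷ fac 1099 1 0 ∷
             fac 725 2 0 ∷ fac 206 7 5 ∷ fac 711 7 1 ∷ fac 99 7 7 ∷ [])))
          (leaf (ran 11932 8 24 ∷ ran 871 8 20 ∷ ran 8089 7 24 ∷ ran 2940 8 19 ∷ ran 3829 8 13 ∷
            ran 6917 8 16 ∷ ran 7684 8 14 ∷ ran 11611 6 24 ∷ ran 1672 8 18 ∷ ran 4628 10 24 ∷ ran 1800 8 17 ∷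
            ran 2804 9 15 ∷ ran 2242 11 15 ∷ ran 1972 9 18 ∷ cel 15 0 509615000175989430000000058010 ∷
            cel 1 0 6000000008009001000000013012 ∷ cel 32 1 25000000000005223414830995076000 ∷
            cel 1 1 5000000000024008007028003008000 ∷ cel 5 2 57000000013000000000450507530919000 ∷
            cel 1 2 5000000003000000000000002003005000 ∷ cel 9 3 952000 ∷ cel 1 3 6000 ∷
            cel 19 4 259110000016000000000024341590000948 ∷ cel 1 4 2002000001000000000001015016000011 ∷
            cel 25 6 84000219123000993000 ∷ cel 1 6 24000013006000002000 ∷
            cel 53 8 242000000124439000327779709986354924278 ∷
            cel 1 8 45000000044041000020050031044007044039 ∷ fac 45564 8 3 ∷ fac 380 6 4 ∷ fac 2285 2 0 ∷
            fac 17397 3 0 ∷ fac 426 1 0 ∷ fac 1065 4 1 ∷ fac 80 4 3 ∷ fac 5324 8 5 ∷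
            sqr 14541 4 5004005003008006014007007003000004000 ∷
            sqr 6599 5 9006007006009006006008015000001001001 ∷
            sqr 3904 8 7010009010010010015018018011001000001 ∷
            sqr 5154 6 6000002006009005002014016015009006008 ∷
            sqr 6050 8 9007006008014010014018017013004000003 ∷
            sqr 3054 5 12005002004003012011015007010000005000 ∷
            sqr 7076 1 2000000001001002001003011000002001001 ∷
            sqr 7655 4 5004006003006004007002014000004004003 ∷
            sqr 894 5 5000003006015002008004005012006005006 ∷
            sqr 975 8 9008007008011010012013000015005018005 ∷ []))))
        (leaf (ran 3309 11 16 ∷ ran 5568 11 15 ∷ ran 24844 11 24 ∷ ran 172 11 18 ∷ ran 1259 11 13 ∷
          ran 2969 8 17 ∷ ran 5201 8 16 ∷ ran 5549 10 18 ∷ ran 1701 9 24 ∷ ran 4495 7 15 ∷ ran 884 8 14 ∷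
          cel 24 0 193316789000000000000000785798957 ∷ cel 1 0 15004023000000000000000011014014 ∷
          cel 4 1 340724000000991000 ∷ cel 1 1 2003000000003000 ∷
          cel 25 2 172000000000000000000971524000000 ∷ cel 1 2 24000000000000000000024009000000 ∷
          cel 9 3 60979000000000000000000000092089 ∷ cel 1 3 7008000000000000000000000000006 ∷
          cel 26 4 208048986115000251000 ∷ cel 1 4 23005003000000000000 ∷
          cel 17 5 74000000000000981000000000000000 ∷ cel 1 5 16000000000000008000000000000000 ∷
          cel 53 6 838000226000253000202571000740986173000 ∷ cel 1 6 16000002000019000045008000035044009000 ∷
          fac 18604 6 3 ∷ fac 32072 6 1 ∷ fac 1660 4 0 ∷ fac 3229 5 3 ∷ fac 9043 3 1 ∷ fac 213 4 2 ∷
          fac 3007 6 4 ∷ fac 2520 2 1 ∷ sqr 8794 5 1002006006013011015014010005005000002 ∷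
          sqr 12693 6 8000008011016011010011015010006005005 ∷
          sqr 9994 3 4001005001008009013006002003003001000 ∷ sqr 12136 6 3006008015011016012010008005004004 ∷
          sqr 6082 10 7010016017013009013016013011009010 ∷
          sqr 9419 10 18011005003000014016011005008012011009 ∷
          sqr 2431 4 6002003004014013014010007003000002000 ∷
          sqr 2870 10 8009019012006003000003013011011013015 ∷ [])))
       (branch 0 5 184
        (branch 0 9 270
         (leaf (ran 48857 8 24 ∷ ran 8644 8 16 ∷ ran 4407 8 17 ∷ ran 17610 8 18 ∷ ran 6115 9 16 ∷
           ran 8624 10 14 ∷ ran 1175 11 18 ∷ ran 810 7 14 ∷ ran 4569 7 16 ∷ ran 3712 5 24 ∷ ran 1656 8 15 ∷
           cel 5 0 344227000000000851259000000000649000 ∷ cel 1 0 1001000000000002001000000000000000 ∷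
           cel 15 1 110000000000000954410000000000000 ∷ cel 1 1 11000000000000013010000000000000 ∷
           cel 44 2 283231230000032147048000000000092000986 ∷
           cel 1 2 39037021000017023024000000000021000010 ∷ cel 18 4 81000000913989000000000000000055 ∷
           cel 1 4 8000000010005000000000000000009 ∷ cel 48 5 97000000113065986000 ∷
           cel 1 5 7000000018044034000 ∷ cel 3 6 745737000000 ∷ cel 1 6 3000000 ∷
           cel 150 7 550000083000070000028397000995000529000 ∷
           cel 1 7 11000002000041000065097000129000021000 ∷ fac 25519 6 1 ∷ fac 3141 5 1 ∷ fac 5172 2 1 ∷
           fac 25320 6 4 ∷ fac 9863 7 4 ∷ fac 8497 4 0 ∷ fac 815 7 0 ∷
           sqr 2579 11 28005009015030034041017019013006011000 ∷
           sqr 2874 15 14016020023019030045038009010011008 ∷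
           sqr 3747 30 28036033032045036039004000029033030029 ∷
           sqr 1585 22 14015011012038023037051052024023000017 ∷
           sqr 2011 30 47034036027030000025009003031032032034 ∷
           sqr 1804 30 29032032031031033036015000035030030032 ∷
           sqr 448 8 9000006008013025028037038016010007000 ∷
           sqr 921 30 45033035029034035032000024027033037031 ∷
           sqr 1488 30 37033031028035014028000017030033030037 ∷
           sqr 426 30 36034033046045053052027031021030013 ∷
           sqr 206 25 11019027018049000043025055026024025026 ∷
           sqr 366 30 32034028026005039012000011032031034042 ∷
           sqr 133 30 47025021038014033016000004033045037045 ∷
           sqr 280 30 39028026038034059049035000034031012021 ∷ []))
         (leaf (ran 3251 8 24 ∷ ran 5986 8 16 ∷ ran 2706 8 17 ∷ ran 4005 8 18 ∷ ran 512 6 18 ∷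
           ran 14330 10 24 ∷ ran 2189 9 24 ∷ ran 1790 7 24 ∷ ran 476 11 24 ∷ ran 2840 8 14 ∷ ran 1056 8 15 ∷
           ran 474 8 13 ∷ cel 8 0 29104073000000000000000000904985 ∷
           cel 1 0 2004002000000000000000000005007 ∷ cel 2 1 519000000000000000000000574000000 ∷
           cel 1 1 1000000000000000000000000000000 ∷ cel 13 2 96000000000000187095000074000823000982 ∷
           cel 1 2 9000000000000012001000003000006000002 ∷ cel 7 4 113603888950898028000000000000134 ∷
           cel 1 4 1002002002004006000000000000006 ∷ cel 14 5 45000000130000000631000983000 ∷
           cel 1 5 3000000002000000009000005000 ∷ cel 3 6 849000000000000 ∷ cel 1 6 3000000000000 ∷
           cel 53 7 678000000000242000214000000986166366000 ∷
           cel 1 7 16000000000019000001000000044031002000 ∷ fac 5253 6 1 ∷ fac 2240 5 1 ∷ fac 793 2 1 ∷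
           fac 5949 6 4 ∷ fac 561 1 0 ∷ fac 668 2 0 ∷ fac 1612 5 0 ∷
           sqr 1677 15 14016020023019030045038009010011008 ∷
           sqr 667 11 28005009015030034041017019013006011000 ∷
           sqr 814 30 47034036027030000025009003031032032034 ∷
           sqr 684 8 9000006008013025028037038016010007000 ∷
           sqr 967 30 45033035029034035032000024027033037031 ∷
           sqr 197 19 28013015024016049048024031019026000013 ∷
           sqr 282 30 19035036033023043041007000030043041029 ∷
           sqr 97 30 36020030026007000031054046032036024041 ∷
           sqr 391 30 31030030025033034036000030028038030037 ∷
           sqr 150 25 49016011027000035023055019033028021026 ∷
           sqr 306 11 22008006013015018032041011008019006000 ∷
           sqr 99 22 29043052002028014033006024034026014 ∷
           sqr 319 17 11017015017033047032028000021017011006 ∷ [])))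
        (leaf (ran 51572 8 24 ∷ ran 426 8 16 ∷ ran 1412 8 13 ∷ ran 552 7 15 ∷ ran 2197 6 15 ∷ ran 6382 8 14 ∷
          ran 453 9 18 ∷ ran 963 7 18 ∷ ran 1975 9 16 ∷ ran 1060 6 17 ∷ ran 1474 11 17 ∷ ran 1308 10 16 ∷
          ran 1174 7 19 ∷ ran 346 7 20 ∷ cel 31 0 42000000000000032405579938996073000 ∷
          cel 1 0 14000000000000025022020009008018000 ∷ cel 43 1 54000005000000020013038077000000000980 ∷
          cel 1 1 10000042000000042033029021000000000021 ∷ cel 11 3 167294483696947665118000000000146 ∷
          cel 1 3 4005007008008010006000000000004 ∷ cel 41 4 15000000000000000000000067000051995000 ∷
          cel 1 4 3000000000000000000000031000019028000 ∷ cel 53 6 171000058108218000071729614622000986000 ∷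
          cel 1 6 38000007035007000050043021012000044000 ∷ fac 4430 3 0 ∷
          sqr 2414 8 9000006008013025028037038016010007000 ∷
          sqr 919 30 27030030029029034034034000041032033027 ∷
          sqr 1227 12 14012005013017016018042031008000012008 ∷
          sqr 1044 24 34025028024021028025054024034000024016 ∷
          sqr 1630 11 4011011011013022021022041008015000006 ∷ fac 4306 6 3 ∷ []))))))))

-- For largest value between 13t/24 and 14t/24, with cells 0 to 13. Two bounds on the top cells are
-- available, and both occur in the leaves as the facts with the two largest indices.
treeB : Tree
treeB =
  (branch 0 4 198
   (branch 0 4 214
    -- At this depth fact 0 is the inner branching, and facts 2 and 3 are the initial bounds on the
    -- cells 11 to 13 and 12 to 13. The final `fac` row is the product of these two bounds.
    (leaf (ran 11368 0 16 ∷ ran 1066 4 16 ∷ ran 265 7 16 ∷ ran 590 8 17 ∷ ran 708 6 18 ∷ ran 78 6 15 ∷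
      ran 240 3 16 ∷ ran 390 6 19 ∷ ran 347 2 16 ∷ ran 578 9 17 ∷ ran 566 10 16 ∷ ran 249 8 14 ∷
      ran 189 0 17 ∷ ran 352 5 14 ∷ ran 81 9 18 ∷ cel 9 0 911960921968922838670575373141031000000000 ∷
      cel 1 0 2006000002001006008001007006007000000000 ∷ cel 108 2 23089108224991020040000000 ∷
      cel 1 2 77084034098030081057000000 ∷ cel 116 3 56035053000000000000018000129990908007000 ∷
      cel 1 3 93089013000000000000108000113067051093000 ∷
      sqr 2879 4 2007004004005004000006005004004004004004 ∷
      sqr 14394 2 1002001000001002005006004004004002000002 ∷
      sqr 6052 4 4006004004004004004000006004004004004004 ∷
      sqr 6046 3 1003002000002005007004007005007006003001 ∷ fac 36275 2 3 ∷ []))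
    (branch 0 6 237
     (leaf (ran 14678 0 16 ∷ ran 2558 4 16 ∷ ran 2558 10 16 ∷ ran 329 6 16 ∷ ran 7320 8 16 ∷ ran 3035 5 15 ∷
       ran 1656 4 15 ∷ ran 6528 9 16 ∷ ran 245 9 13 ∷ ran 3055 0 14 ∷ ran 3274 7 17 ∷ ran 4585 6 17 ∷
       ran 6878 0 18 ∷ ran 1039 9 12 ∷ cel 20 0 66989263000000375087000000000 ∷
       cel 1 0 9012002000000008009000000000 ∷ cel 10 1 944292000000000000000034000 ∷
       cel 1 1 5008000000000000000007000 ∷ cel 21 2 164266962853000000406000042000000000000 ∷
       cel 1 2 2011016020000000016000003000000000000 ∷ cel 258 3 88000000055084000000995109073000000 ∷
       cel 1 3 250000000028222000000220010209000000 ∷ cel 329 4 80000000000032051159000140368997864124000 ∷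
       cel 1 4 275000000000138012082000310254172312112000 ∷ fac 698 2 1 ∷ fac 48215 4 1 ∷ fac 9076 1 0 ∷
       fac 48283 3 0 ∷ fac 35055 4 0 ∷ fac 122996 3 1 ∷
       sqr 8346 7 10006004000008009017015017016012009009005 ∷
       sqr 17038 3 1003002001000004013009006006008004003002 ∷
       sqr 15670 4 4003000002005003011014008006009005003002 ∷
       sqr 4821 7 7007009003000011007017007007007011005008 ∷
       sqr 5025 10 14010013011012008000006006010010007012013 ∷
       sqr 1435 9 2009005006009012016019018016012014000006 ∷
       sqr 5314 4 4000003007007005009014011004002005001 ∷ []))
     (leaf (ran 449 0 16 ∷ ran 1373 10 16 ∷ ran 3499 6 16 ∷ ran 2129 7 14 ∷ ran 4060 8 16 ∷ ran 2594 7 15 ∷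
       ran 87 8 12 ∷ ran 146 8 18 ∷ ran 437 0 2 ∷ ran 969 7 16 ∷ ran 1238 4 13 ∷ ran 1675 5 16 ∷
       ran 3212 0 17 ∷ ran 339 4 18 ∷ ran 1465 9 18 ∷ cel 6 0 288000000000000148952000000000032352 ∷
       cel 1 0 1000000000000003001000000000004004 ∷ cel 3 1 429000000000000572690000 ∷
       cel 1 1 2000000000000003002000 ∷ cel 6 2 222995796736589000000000531000000000000 ∷
       cel 1 2 1001004003002000000000006000000000000 ∷ cel 96 3 76033000000066000183996199183064000 ∷
       cel 1 3 81037000000086000035069046046084000 ∷ cel 116 4 47000000000007000105310359282990899215113 ∷
       cel 1 4 2000000000067000012050107061067039082032 ∷ fac 3432 2 1 ∷ fac 18728 4 1 ∷ fac 2469 2 0 ∷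
       sqr 22837 2 1001001000002005005006012006004003000000 ∷
       sqr 6318 3 1003002001000004013009006006008004003002 ∷
       sqr 9049 4 4003000002005003011014008006009005003002 ∷
       sqr 2905 4 4000003007007005009014011004002005001 ∷
       sqr 7031 2 1002001000000002008009006012004004000001 ∷ []))))
   -- From here on at most 198/410 of the vertices lie in the cells 0 to 4.
   (branch 0 6 221
    (branch 0 3 152
     (branch 0 9 283
      (leaf (ran 1100 5 18 ∷ ran 907 10 15 ∷ ran 1489 5 16 ∷ ran 1364 5 14 ∷ ran 1586 8 17 ∷ ran 1678 4 15 ∷
        ran 1376 6 15 ∷ ran 1115 5 13 ∷ ran 1514 7 16 ∷ ran 396 8 19 ∷ ran 337 9 17 ∷ ran 453 9 12 ∷
        ran 837 9 18 ∷ cel 1 0 404000000000000000746000675519000 ∷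
        cel 3 1 40000000000000000038000770655118000000 ∷ cel 1 1 1000000000000000001000000002002000000 ∷
        cel 3 2 205289511000000698403117000000 ∷ cel 1 2 3003000000000000003000000000 ∷
        cel 4 3 280917000367509000000000000 ∷ cel 1 3 1000000000002000000000000 ∷
        cel 28 4 982301150000212000000431967000052000 ∷ cel 1 4 15008019000015000000013008000000000 ∷
        cel 69 5 227197000000092244310000171985534728398000 ∷
        cel 1 5 42036000000002000064000047027065017068000 ∷ fac 3848 3 2 ∷ fac 15443 5 2 ∷ fac 15938 4 5 ∷
        fac 5210 4 3 ∷ fac 2957 3 1 ∷ fac 12346 4 2 ∷ fac 20625 5 3 ∷ fac 15809 5 1 ∷
        sqr 2708 9 10008000008012016019015018018011010005004 ∷
        sqr 2432 6 8006004005005013015015014016012007004000 ∷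
        sqr 6108 10 7011000007008009010014010015013013012011 ∷
        sqr 4464 3 4003004000004006008008006013012006001000 ∷
        sqr 1394 8 8009013000003005012018015015011007007008 ∷
        sqr 895 6 7006007007013009016008015014008000006000 ∷ fac 246 3 0 ∷ []))
      (leaf (ran 882 10 15 ∷ ran 336 5 16 ∷ ran 372 9 15 ∷ ran 364 8 15 ∷ ran 131 6 13 ∷ ran 99 6 16 ∷
        ran 1047 10 18 ∷ ran 329 7 16 ∷ ran 107 6 12 ∷ cel 1 0 713679000658000000000246599940 ∷
        cel 2 1 502030000000000268000000000129 ∷ cel 1 2 623531567000000000000000000 ∷
        cel 1 3 805000344000499253000000 ∷ cel 19 4 424000309964000053043 ∷ cel 19 5 424424000964655053 ∷
        fac 1077 3 2 ∷ fac 1333 1 0 ∷ fac 435 0 0 ∷ fac 342 1 1 ∷ fac 57 2 0 ∷ fac 356 2 1 ∷ [])))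
     (leaf (ran 2593 8 18 ∷ ran 4753 9 15 ∷ ran 4775 7 18 ∷ ran 487 5 18 ∷ ran 7445 4 16 ∷ ran 4902 4 19 ∷
       ran 7006 6 18 ∷ ran 2615 7 12 ∷ ran 5753 5 14 ∷ ran 6737 9 18 ∷ ran 3031 10 15 ∷ ran 2245 8 17 ∷
       ran 2740 8 13 ∷ ran 947 10 19 ∷ ran 2330 7 20 ∷ cel 20 0 148652998000264148439364220022 ∷
       cel 1 0 4008015000001000008012018008 ∷ cel 21 1 16110224235254249056000000980691264000 ∷
       cel 1 1 12017003001014019002000000018009003000 ∷ cel 5 2 741000000909747608000000 ∷
       cel 1 2 5004004000000 ∷ cel 148 3 356169049105137994000054000191115136 ∷
       cel 1 3 88016050038124122000027000049105029 ∷ cel 232 4 998968806000122281451128796839483337213000 ∷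
       cel 1 4 40199069000064023067091224058097143159000 ∷ fac 5222 2 1 ∷ fac 26820 4 1 ∷ fac 1218528 3 4 ∷
       fac 19723 1 0 ∷ sqr 20044 6 5006000004008014016007010010010006005003 ∷
       sqr 6103 5 10003000003005015011006008013015006003002 ∷
       sqr 7623 10 8012000009009008010012008013018012011011 ∷
       sqr 4167 5 6005007002003015011007008000011006008004 ∷
       sqr 4483 10 13009006009011000011010009013018010010011 ∷
       sqr 1996 5 5005006006006006005005005005005015000004 ∷ [])))
    (branch 0 1 141
     (leaf (ran 407 6 18 ∷ ran 5416 7 13 ∷ ran 711 9 16 ∷ ran 304 9 19 ∷ ran 1190 5 17 ∷ ran 102 4 13 ∷
       ran 370 8 13 ∷ ran 1393 6 15 ∷ ran 400 8 14 ∷ ran 711 6 16 ∷ ran 412 6 14 ∷ ran 713 10 13 ∷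
       cel 5 0 745660524149000823000000405857000000 ∷ cel 1 0 3003001002000005000000001002000000 ∷
       cel 3 1 653461312000000345000000457892000275 ∷ cel 1 1 2000001000000001000000003001000002 ∷
       cel 5 2 140514864165000 ∷ cel 1 2 3003000002000 ∷ cel 53 3 20079000128170134067986000 ∷
       cel 1 3 32025000020017051006044000 ∷ cel 46 4 35000000000027037071582684828963997085887 ∷
       cel 1 4 33000000000010021020026022010045044031042 ∷ fac 5776 1 0 ∷ fac 962 2 0 ∷ fac 2228 0 0 ∷
       fac 2804 4 2 ∷ sqr 16019 2 4002002001003003004005006003002002002000 ∷ fac 1737 3 2 ∷ fac 379 1 1 ∷ []))
     (branch 0 7 229
      (branch 0 5 189
       (leaf (ran 5008 7 18 ∷ ran 3158 9 19 ∷ ran 663 6 15 ∷ ran 2126 8 16 ∷ ran 1308 6 13 ∷ ran 2192 7 15 ∷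
         ran 1519 8 14 ∷ ran 2169 8 20 ∷ ran 192 10 12 ∷ ran 1459 10 17 ∷ ran 1210 5 17 ∷ ran 1560 5 19 ∷
         cel 1 0 383000000000709000000000000000000 ∷ cel 5 1 271000000545622000324000000000000923000 ∷
         cel 1 1 3000000004003000002000000000000002000 ∷ cel 5 2 132851000859176000196000056036 ∷
         cel 1 2 1001000003003000002000000002 ∷ cel 3 3 654000984936000264000472000616984000 ∷
         cel 1 3 2000001003000002000003000003002000 ∷ cel 4 4 256000000000000673757354000 ∷
         cel 1 4 3000000000000002001001000 ∷ cel 29 5 386000096000193961965558000933534000295000 ∷
         cel 1 5 16000019000008015020025000026028000025000 ∷ cel 90 6 62000000683988875442396281149 ∷
         cel 1 6 25000000037018046044007090078 ∷ fac 9872 5 2 ∷ fac 2746 3 1 ∷ fac 1093 4 1 ∷ fac 4326 2 1 ∷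
         fac 12158 5 1 ∷ fac 16019 5 4 ∷ fac 17411 6 1 ∷ fac 1771 4 0 ∷ fac 1390 3 0 ∷
         sqr 114907 1 2001001000001001002003004005002001000000 ∷ fac 848 4 2 ∷ []))
       (leaf (ran 1075 7 22 ∷ ran 313 10 22 ∷ ran 515 9 19 ∷ ran 802 6 15 ∷ ran 167 6 13 ∷ ran 1084 8 20 ∷
         ran 771 9 17 ∷ ran 40 6 12 ∷ ran 811 6 18 ∷ ran 1649 6 22 ∷ ran 26 10 16 ∷
         cel 3 0 198389353000074077309943614641365 ∷ cel 1 1 638383000000738789278000955000 ∷
         cel 3 2 93465000305929721000000000000 ∷ cel 2 3 302000156000000175539000000 ∷
         cel 24 5 506992000366000000406000240000000000 ∷
         cel 24 6 506506506000973973000260000250000000307104 ∷ fac 1237 2 1 ∷ fac 4178 5 1 ∷ fac 3784 6 1 ∷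
         fac 1201 1 0 ∷ fac 4533 6 2 ∷ [])))
      (leaf (ran 3893 8 22 ∷ ran 87 9 22 ∷ ran 729 8 17 ∷ ran 21 5 13 ∷ ran 44 8 16 ∷ ran 59 8 14 ∷
        ran 37 8 18 ∷ ran 180 10 12 ∷ ran 311 7 22 ∷ ran 119 10 15 ∷
        cel 4 0 31027000000000000000000056000761 ∷ cel 1 0 1001000000000000000000004000002 ∷
        cel 2 1 123211532833000000000000000000 ∷ cel 1 1 1000000000000000000000 ∷
        cel 3 2 24000000000000000111000125074121808969000 ∷
        cel 1 2 2000000000000000001000000002001001001000 ∷ cel 3 3 617763687000000000 ∷
        cel 1 3 3001000000000 ∷ cel 31 4 290456466998000000000000155000000000000019 ∷
        cel 1 4 22029006010000000000000009000000000000004 ∷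
        cel 31 5 175000175000998998000000000157113009000000 ∷
        cel 1 5 14000014000010010000000000000017009000000 ∷ fac 74 0 0 ∷ fac 149 3 1 ∷ []))))))

-- For largest value above 14t/24, with cells 0 to 10. The last cell reaches from 10t/24 up to t,
-- but it holds at most three vertices.
treeC : Tree
treeC =
  (branch 0 4 189
   (branch 0 3 189
    (branch 0 7 251
     (branch 0 1 135
      (leaf (ran 8010 0 14 ∷ ran 1962 7 14 ∷ ran 1722 6 14 ∷ ran 9436 0 12 ∷ ran 497 9 11 ∷ ran 191 8 13 ∷
        ran 1209 5 13 ∷ ran 555 0 15 ∷ ran 2653 8 12 ∷ cel 9 0 905782000000000044000097000000 ∷
        cel 1 0 3005000000000000000002000000 ∷ cel 7 1 60021000000561937558352171000 ∷
        cel 1 1 2006000000001003006002002000 ∷ cel 13 2 475566959778393063031000000070 ∷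
        cel 1 2 4005004007008004013000000002 ∷ cel 732 4 998000000000034032034054062069073 ∷
        cel 1 4 625000729000026591192190611210150 ∷ fac 4524311 4 4 ∷ fac 2373 4 1 ∷
        sqr 9202 3 5000002004010013012006004001001 ∷ sqr 9779 3 4002000001013005004004004004003 ∷
        fac 338 0 0 ∷ []))
      (leaf (ran 33182 0 14 ∷ ran 8832 7 14 ∷ ran 2564 0 12 ∷ ran 94 4 14 ∷ ran 2174 8 14 ∷ ran 757 3 16 ∷
        ran 459 9 11 ∷ ran 443 9 16 ∷ ran 2981 6 13 ∷ ran 893 9 13 ∷ ran 2239 6 14 ∷ ran 111 5 13 ∷
        ran 256 2 16 ∷ ran 3023 0 15 ∷ cel 6 0 537000294965000000000097029 ∷
        cel 1 0 4000005000000000000005003 ∷ cel 15 1 19000000000959384026000074000 ∷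
        cel 1 1 5000000000008009001000008000 ∷ cel 31 2 919974057621091100000000087092 ∷
        cel 1 2 16016011024021026000000031002 ∷ cel 28 3 985000096000000000000000 ∷
        cel 1 3 23000003000000000000000 ∷ cel 556 4 47000013000178124000070063989997 ∷
        cel 1 4 115000365000396134000142365189301 ∷ fac 13803 4 1 ∷ fac 3340 1 0 ∷ fac 313285 4 0 ∷
        sqr 1240 15 18000006010030027045033015012016 ∷ sqr 2361 9 12005000004039016012011011011009 ∷
        sqr 889 14 19000008012036030044031015013012 ∷ sqr 1460 6 9000006000036015012006009008006 ∷
        sqr 846 9 12014015010039023013000012001000 ∷ sqr 351 12 17000002014036033042023013006008 ∷
        sqr 230 10 13005000012040021015008013012009 ∷ fac 75678 4 3 ∷ [])))
     (leaf (ran 2043 0 14 ∷ ran 9124 8 14 ∷ ran 2198 8 13 ∷ ran 44 9 15 ∷ ran 1393 5 15 ∷ ran 254 2 13 ∷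
       ran 1484 7 12 ∷ ran 1200 6 14 ∷ ran 502 7 11 ∷ ran 1019 3 14 ∷ ran 744 0 15 ∷
       cel 7 0 937642000000000411785949 ∷ cel 1 0 2001000000000002007002 ∷
       cel 12 1 163253246952500120000000044108193 ∷ cel 1 1 1007009001010009000000001008011 ∷
       cel 150 3 23000003000143074175792894981995 ∷ cel 1 3 18000001000149131071046009048129 ∷ fac 9781 1 0 ∷
       fac 4058 0 0 ∷ fac 823 2 0 ∷ fac 1983 1 1 ∷ sqr 4897 4 5000001002014009008008005006005 ∷
       sqr 4946 10 9011012014000010011010010009010 ∷ sqr 837 10 11011012011011014006020018000006 ∷ [])))
    (branch 9 9 119
     (leaf (ran 4745 9 15 ∷ ran 2578 9 16 ∷ ran 1337 7 14 ∷ ran 52 1 14 ∷ ran 110 2 14 ∷ ran 613 8 14 ∷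
       ran 1479 9 12 ∷ ran 1073 6 11 ∷ ran 821 6 15 ∷ ran 1488 8 13 ∷ ran 351 7 15 ∷ ran 317 4 15 ∷
       cel 6 0 395311257000059000287521987 ∷ cel 1 0 4001000005000004001003 ∷ cel 2 1 837000669100000000 ∷
       cel 1 1 1000001001000000 ∷ cel 9 2 983578243000000000000059243 ∷ cel 1 2 1007006000000000000004003 ∷
       cel 69 3 233000000350657961435985797655421 ∷ cel 1 3 16000000064035001029027026029023 ∷ fac 5703 2 0 ∷
       fac 24714 3 1 ∷ sqr 8146 7 9000007012017013016010008006007 ∷ fac 244 1 1 ∷ []))
     (branch 0 2 154
      (branch 0 0 114
       (leaf (ran 50435 4 16 ∷ ran 377537 4 11 ∷ ran 350423 0 13 ∷ ran 91008 6 11 ∷ ran 136844 7 14 ∷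
         ran 17601 9 13 ∷ ran 221334 8 11 ∷ ran 77357 9 12 ∷ ran 169856 5 14 ∷ ran 37771 9 15 ∷
         ran 125057 7 12 ∷ ran 119684 6 15 ∷ cel 479 0 558370000000000000000997507000 ∷
         cel 1 0 342336000000000000000477460000 ∷ cel 591 1 130072000000000997000000000 ∷
         cel 1 1 547013000000000439000000000 ∷ cel 64 2 993000000000000000000460000000 ∷
         cel 1 2 9000000000000000000023000000 ∷ cel 62 3 776000990000360000 ∷ cel 1 3 17000004000005000 ∷
         cel 98 4 998641000000000000000000 ∷ cel 1 4 83027000000000000000000 ∷
         cel 9950 5 37148000054171278498761998977987 ∷ cel 10 5 216054000111168977656331981064018 ∷
         fac 263604 4 3 ∷ fac 311988 3 1 ∷ fac 105184 3 0 ∷ fac 69242 4 2 ∷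
         sqr 7932 58 81046077083127148158144054030000 ∷ sqr 3819 57 83038076083103125119157098094000 ∷
         sqr 8196 18 29000003028044027023011118069002 ∷ sqr 1752 79 95082061110130179168137105000023 ∷
         sqr 1405 56 81032067080104156104137141059000 ∷ sqr 1685 27 42000014032053037043057127090009 ∷
         sqr 1336 45 61037041060091130100145039020000 ∷ sqr 1527 100 90121041106106050043000178122114 ∷
         sqr 552 55 78033036083116117145112155059000 ∷ sqr 459 37 49037015059091058023066137076000 ∷
         fac 815715 5 2 ∷ []))
       (branch 0 7 267
        (leaf (ran 2769 6 11 ∷ ran 2224 7 14 ∷ ran 2176 3 13 ∷ ran 6543 4 12 ∷ ran 2697 0 14 ∷
          ran 2550 0 15 ∷ ran 2170 9 13 ∷ ran 732 6 13 ∷ ran 3024 5 13 ∷ ran 2994 7 13 ∷ ran 1545 2 14 ∷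
          ran 1952 8 14 ∷ ran 2322 4 15 ∷ cel 6 0 342139000000784449754897000000 ∷
          cel 6 1 447185000000000941000000000 ∷ cel 10 2 210000990000000000 ∷ cel 3 4 490000673000000000 ∷
          cel 9 5 622908767000000000000000000 ∷ cel 329 6 18000000000049071000168000118998 ∷ fac 35017 6 5 ∷
          fac 2373 5 4 ∷ fac 9815 4 2 ∷ fac 72648 6 2 ∷ fac 130 3 1 ∷ fac 175375 6 1 ∷ fac 886 4 0 ∷
          sqr 11213 10 12013016014015015016013000006005 ∷ sqr 13403 6 7005004010016015014010006002000 ∷
          sqr 19851 6 8005008010013016015013004003000 ∷ fac 2788 2 1 ∷ []))
        (leaf (ran 202 9 15 ∷ ran 665 3 12 ∷ ran 2221 7 15 ∷ ran 134 2 14 ∷ ran 2079 4 14 ∷ ran 706 8 14 ∷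
          ran 933 4 16 ∷ ran 1467 8 11 ∷ ran 1464 9 12 ∷ ran 1785 6 13 ∷ ran 1835 0 13 ∷ ran 359 0 12 ∷
          ran 1622 5 13 ∷ ran 827 8 15 ∷ cel 1 0 178567000000000000868000 ∷
          cel 2 1 743190000000587000000038 ∷ cel 1 1 2001000000001000000001 ∷
          cel 3 2 79234087000000974555000000 ∷ cel 1 2 2001001000000002000000000 ∷
          cel 2 3 204000000000800000000000000000 ∷ cel 1 3 1000000000000000 ∷ cel 2 4 556000121000000000 ∷
          cel 1 4 2000002000000000 ∷ cel 5 5 343806638000000000000000000 ∷
          cel 1 5 4002000000000000000000000 ∷ cel 556 6 2000000008030072000997000013000 ∷
          cel 1 6 254000000553213547000301000476000 ∷ fac 28367 6 5 ∷ fac 2179 5 4 ∷ fac 2211 4 2 ∷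
          fac 364167 6 2 ∷ fac 331872 6 4 ∷ fac 1409 3 1 ∷ fac 4365 6 1 ∷ fac 1565 2 0 ∷
          sqr 2543 6 8005008010013016015013004003000 ∷ sqr 5801 6 7005004010016015014010006002000 ∷
          sqr 2757 5 8000008008015015012015009001000 ∷ sqr 948 10 11012013014018019018008000004006 ∷ []))))
      (branch 0 0 110
       (leaf (ran 1252 3 16 ∷ ran 4019 4 13 ∷ ran 2934 9 14 ∷ ran 3546 4 14 ∷ ran 5538 8 12 ∷ ran 4701 3 15 ∷
         ran 6882 7 11 ∷ ran 1630 5 11 ∷ ran 4678 6 11 ∷ ran 1462 5 16 ∷ ran 359 6 14 ∷ ran 752 5 12 ∷
         cel 12 0 183227000000133000000993626000 ∷ cel 1 0 6011000000002000000008008000 ∷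
         cel 10 1 157972081000000385000 ∷ cel 1 1 1004009000000009000 ∷
         cel 3 2 260000000000194000000748000000 ∷ cel 1 2 3000000000002000000001000000 ∷
         cel 2 3 630000000000000559139000000 ∷ cel 1 3 1000000000000001001000000 ∷
         cel 2 4 639345590000000000000000 ∷ cel 1 4 1000001000000000000000 ∷
         cel 195 5 9995000039176339000237490467614 ∷ cel 1 5 140167000059138042000098052109170 ∷
         fac 73815 5 4 ∷ fac 4945 4 3 ∷ fac 122518 5 2 ∷ fac 5746 4 1 ∷ fac 1826 3 0 ∷ fac 7909 1 0 ∷
         fac 1731 4 2 ∷ sqr 6400 8 11006008012018014015017017011000 ∷
         sqr 15287 10 13010012016019020017017017012000 ∷ sqr 4021 5 7003007008008015011005012004000 ∷
         sqr 4791 4 6001007003009012014010006003000 ∷ fac 304 2 1 ∷ []))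
       (branch 0 6 238
        (leaf (ran 539 8 15 ∷ ran 330 4 16 ∷ ran 144 4 13 ∷ ran 838 4 12 ∷ ran 829 5 15 ∷ ran 574 7 13 ∷
          ran 444 6 11 ∷ ran 331 9 14 ∷ ran 550 3 14 ∷ ran 518 8 14 ∷ cel 1 0 398000000000000000000000 ∷
          cel 1 1 283000113000000000000162 ∷ cel 1 2 606000559000000132809000 ∷ cel 1 3 637000000318000000 ∷
          cel 1 5 642689852000000000246000000 ∷ cel 153 6 993000000013071123000025075069050 ∷
          cel 1 6 132000000118038012000130044011104 ∷ fac 937330 6 6 ∷ fac 12635 6 5 ∷ fac 652 5 4 ∷
          fac 344 4 3 ∷ fac 294 5 2 ∷ fac 469 3 1 ∷ fac 222 5 1 ∷ fac 122 4 0 ∷ fac 584 2 0 ∷ fac 205 3 0 ∷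
          sqr 7735 3 5002003003007007005003002000002 ∷ sqr 9996 3 4003002005007005004006006002000 ∷ []))
        (leaf (ran 1148 7 12 ∷ ran 1561 8 15 ∷ ran 993 5 14 ∷ ran 778 4 15 ∷ ran 232 4 12 ∷ ran 544 7 13 ∷
          ran 410 9 14 ∷ ran 1369 6 16 ∷ cel 2 0 601653000393000099000 ∷ cel 1 0 1001000002000001000 ∷
          cel 2 1 270533613367000081000088 ∷ cel 1 1 1000001000002000001 ∷ cel 2 2 911169000291276000 ∷
          cel 1 2 1002000001001000 ∷ cel 2 3 325725250000436000000 ∷ cel 1 3 1002002000002000000 ∷
          cel 1 4 278000000000 ∷ cel 2 5 167000711186000000167000000 ∷ cel 1 5 2000001002000000001000000 ∷
          cel 260 6 998000007034114168000021028008000 ∷ cel 1 6 82000060124229130000139175198000 ∷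
          fac 1584087 6 6 ∷ fac 28582 6 5 ∷ fac 707 5 4 ∷ fac 1317 5 2 ∷ fac 296 3 1 ∷ fac 902 5 0 ∷
          sqr 16246 3 5002003003007007005003002000002 ∷ sqr 23513 2 3001001004006004003005002001000 ∷
          fac 113 3 2 ∷ fac 33 5 3 ∷ [])))))))
   -- From here on at most 189/410 of the vertices lie in the cells 0 to 4.
   (branch 0 5 198
    (branch 0 1 126
     (branch 0 8 270
      (leaf (ran 902 6 14 ∷ ran 7906 8 11 ∷ ran 11882 4 13 ∷ ran 10203 7 14 ∷ ran 3667 4 14 ∷ ran 1898 8 15 ∷
        ran 7154 6 16 ∷ ran 1209 6 15 ∷ ran 3038 6 12 ∷ ran 14658 5 12 ∷
        cel 15 0 26000000000000748616993355000 ∷ cel 1 0 2000000000000008012001008000 ∷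
        cel 19 1 169374000000000951609279000000 ∷ cel 1 1 4011000000000009016001000000 ∷
        cel 9 2 457000000904000000000000 ∷ cel 1 2 1000000004000000000000 ∷
        cel 26 3 90000000149457971000024 ∷ cel 1 3 4000000011012022000018 ∷
        cel 428 4 64000000062116000356638673960996 ∷ cel 1 4 46000000118141000081176140301353 ∷
        fac 8729 3 2 ∷ fac 76938 4 2 ∷ fac 18881 3 1 ∷ fac 74493 4 3 ∷ fac 5262 4 0 ∷ fac 1706 3 0 ∷
        sqr 1057 17 24011019015046045045040047003000 ∷ sqr 1610 13 18007012014021042043043021010000 ∷
        sqr 1048 22 26015018022037048052048000027008 ∷ sqr 823 24 28029024042054053041040027012000 ∷
        sqr 824 13 17000001031020033033043001021005 ∷ sqr 817 16 22012014028046030046045017018000 ∷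
        sqr 689 25 5026027027043054055046040000009 ∷ []))
      (leaf (ran 4269 7 12 ∷ ran 1704 4 12 ∷ ran 4247 8 13 ∷ ran 3127 9 11 ∷ ran 4266 9 16 ∷ ran 4247 6 12 ∷
        ran 3560 5 14 ∷ ran 366 9 13 ∷ ran 3907 9 15 ∷ ran 709 5 12 ∷ cel 8 0 726384000000000000905000709 ∷
        cel 13 1 450054991489000000000152403000000 ∷ cel 12 2 940000000000000 ∷
        cel 6 3 89000000000948000000544000 ∷ cel 253 4 119210367903998 ∷ fac 7581 3 2 ∷ fac 20477 4 2 ∷
        fac 11380 1 0 ∷ fac 167 3 0 ∷ fac 2751 0 0 ∷ fac 3679 1 1 ∷ fac 1747 2 2 ∷ [])))
     (branch 5 5 42
      (leaf (ran 733 4 13 ∷ ran 226 5 11 ∷ ran 205 8 17 ∷ ran 970 8 16 ∷ ran 3181 5 16 ∷ ran 285 9 14 ∷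
        ran 1133 7 13 ∷ ran 307 7 17 ∷ ran 581 8 12 ∷ ran 643 8 14 ∷ cel 2 0 413211119588000387779000242401 ∷
        cel 1 0 1002001001000001001000001001 ∷ cel 3 1 104432805000172128000017000 ∷
        cel 1 1 1003001000000001000001000 ∷ cel 3 2 100000000000843340000000000 ∷
        cel 1 2 1000000000003001000000000 ∷ cel 2 3 56222000000000574000000 ∷
        cel 1 3 1001000000000000000000 ∷ cel 199 4 995000005065090000067092129151135 ∷
        cel 1 4 165000037077070000020115117043050 ∷ fac 1218528 4 4 ∷ fac 2751 3 2 ∷ fac 20980 4 2 ∷
        fac 1263 2 1 ∷ sqr 20329 2 3001001006006003004004001003000 ∷
        sqr 10578 3 4002004005006004007005004000001 ∷ []))
      (branch 9 9 113
       (leaf (ran 1659 5 15 ∷ ran 16525 8 16 ∷ ran 11312 9 13 ∷ ran 14876 9 11 ∷ ran 12656 7 15 ∷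
         ran 10670 7 14 ∷ ran 1300 4 14 ∷ ran 5870 6 13 ∷ ran 16348 6 16 ∷ ran 7804 8 14 ∷ ran 6200 5 12 ∷
         ran 15001 9 17 ∷ cel 19 0 416000943000000000085000995 ∷ cel 1 0 17000009000000000004000006 ∷
         cel 7 1 922317000000000000000000000 ∷ cel 1 1 3004000000000000000000000 ∷
         cel 20 2 960753000000000000035121 ∷ cel 1 2 20015000000000000014011 ∷
         cel 31 3 10642381000000998369000000033 ∷ cel 1 3 2016023000000013007000000023 ∷ cel 9 4 929000 ∷
         cel 1 4 7000 ∷ cel 939 5 80000069240287000104163171998873 ∷
         cel 1 5 888000101703876000370711608208626 ∷ fac 32844 4 3 ∷ fac 265180 5 3 ∷ fac 9466 3 2 ∷
         fac 15688 4 1 ∷ fac 4311 3 1 ∷ fac 15054 3 0 ∷ fac 11546 4 2 ∷ fac 473403 5 2 ∷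
         sqr 2555 15 22002022031045039040034015000004 ∷ sqr 4710 14 20005017024041044040016012008000 ∷
         sqr 1709 11 16006029009032041024015005005000 ∷ sqr 637 19 27000028049049035043029021028011 ∷
         sqr 422 15 21000014045031007027041020020016 ∷ sqr 1238 16 22012013040046037020029009012000 ∷
         sqr 742 14 17006015027022000021044016010017 ∷ []))
       (leaf (ran 1886 8 16 ∷ ran 2747 5 13 ∷ ran 5498 9 11 ∷ ran 10222 7 13 ∷ ran 2950 7 14 ∷
         ran 6615 4 14 ∷ ran 3744 4 11 ∷ ran 7352 8 15 ∷ ran 18371 6 16 ∷ ran 2961 8 14 ∷ ran 7101 5 12 ∷
         ran 3065 8 17 ∷ cel 7 0 159000091191000000000000889000 ∷ cel 1 0 6000001004000000000000002000 ∷
         cel 15 2 216950000000096000000000 ∷ cel 1 2 6010000000000000000000 ∷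
         cel 17 3 364000000000983251000000000 ∷ cel 1 3 2000000000002003000000000 ∷ cel 11 4 264996142000 ∷
         cel 1 4 9011009000 ∷ cel 164 5 323000123695995000000396508651359 ∷
         cel 1 5 98000026086035000000028090147009 ∷ fac 19194 4 3 ∷ fac 1584087 5 3 ∷ fac 11664 3 2 ∷
         fac 8697 4 1 ∷ fac 3873 3 1 ∷ fac 1413130 5 1 ∷ fac 1326884 5 4 ∷ fac 4855 2 0 ∷ fac 3902 1 0 ∷
         fac 1416 2 1 ∷ fac 707 4 0 ∷ sqr 3183 14 20000010020026044034034016021006 ∷
         sqr 1013 24 33022026043054054039033021017000 ∷ sqr 1164 16 22012013040046037020029009012000 ∷
         sqr 1052 14 30000004015006001044031028016020 ∷ sqr 653 20 24015008050034025050018036000009 ∷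
         sqr 559 15 22008019025045026042030010011000 ∷ sqr 514 30 39036037044048032028035032000014 ∷
         sqr 62 30 29041031029000036032030035030024 ∷ [])))))
    (branch 0 0 114
     (leaf (ran 1917 6 11 ∷ ran 307 9 12 ∷ ran 304 7 12 ∷ ran 611 6 14 ∷ ran 110 5 13 ∷ ran 321 7 13 ∷
       ran 430 8 15 ∷ ran 221 6 18 ∷ ran 221 6 17 ∷ ran 1745 5 11 ∷ ran 364 8 11 ∷
       cel 4 0 615473203000000000317590862000 ∷ cel 1 1 792461161000161000000000892000 ∷
       cel 4 2 435790957000 ∷ cel 41 3 41083276516631711826981 ∷ fac 2380 1 0 ∷ fac 1757 2 0 ∷ fac 1473 0 0 ∷
       fac 560 2 1 ∷ fac 4081 3 2 ∷ []))
     (branch 0 6 222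
      (branch 0 4 167
       (leaf (ran 63973 6 15 ∷ ran 27705 6 11 ∷ ran 43950 6 17 ∷ ran 30120 6 14 ∷ ran 16435 4 16 ∷
         ran 56990 9 16 ∷ ran 17287 7 12 ∷ ran 28077 5 12 ∷ ran 51757 7 17 ∷ ran 76710 8 13 ∷
         ran 25701 4 14 ∷ cel 25 0 990000000261000000000000 ∷ cel 1 0 16000000022000000000000 ∷
         cel 130 1 320059000000998903482000000 ∷ cel 1 1 68020000000115006053000000 ∷
         cel 72 2 845706000994034000000000085 ∷ cel 1 2 27069000041051000000000059 ∷
         cel 75 3 269987000432000742638230096 ∷ cel 1 3 70060000033000052049047050 ∷ cel 21 4 720989000 ∷
         cel 1 4 21001000 ∷ cel 2062 5 585481530830000435703853910968998 ∷
         cel 2 5 314944638622000959580477658556719 ∷ fac 76023 4 1 ∷ fac 32651 2 1 ∷ fac 1411504 5 1 ∷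
         fac 60976 4 0 ∷ fac 10249 3 0 ∷ fac 5087 4 2 ∷ fac 28740 3 1 ∷
         sqr 1689 42 58017031107089142075086039031000 ∷ sqr 1245 28 47004014061043075128065042000010 ∷
         sqr 1164 25 39000004058032021115125019033010 ∷ sqr 383 44 77025043078069134144142063021000 ∷
         sqr 343 34 51003029110093134047031104001000 ∷ []))
       (leaf (ran 1287 6 20 ∷ ran 407 6 15 ∷ ran 740 6 12 ∷ ran 557 7 20 ∷ ran 652 6 11 ∷ ran 84 6 18 ∷
         ran 1915 5 20 ∷ ran 419 7 13 ∷ ran 433 9 13 ∷ ran 297 4 17 ∷ ran 762 8 17 ∷ ran 788 6 14 ∷
         cel 4 0 73000000000000123407732782079 ∷ cel 1 0 1000000000000000004004002000 ∷
         cel 2 1 94000000000000715663482000000 ∷ cel 1 1 1000000000000001001001000000 ∷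
         cel 2 2 156439000000621000000146172 ∷ cel 1 2 1000000000002000000001001 ∷
         cel 3 3 173179457229000735 ∷ cel 1 3 3003003002000003 ∷
         cel 417 5 998000004011000014029044044048055 ∷ cel 1 5 227000218227000414213012304156167 ∷
         fac 2677107 5 5 ∷ fac 509 2 1 ∷ fac 6910 5 1 ∷ fac 898 1 0 ∷
         sqr 21361 2 3001002003003006006006003001000 ∷ [])))
      (branch 0 7 239
       (leaf (ran 36624 7 20 ∷ ran 3501 6 14 ∷ ran 6160 7 11 ∷ ran 5965 6 12 ∷ ran 2168 9 15 ∷
         ran 2334 5 14 ∷ ran 72 6 17 ∷ ran 1370 7 16 ∷ ran 118 7 13 ∷ ran 3876 8 13 ∷ ran 477 5 16 ∷
         ran 249 6 18 ∷ ran 853 9 18 ∷ cel 6 0 100104554945000000 ∷ cel 1 0 1002001000000000 ∷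
         cel 30 1 28000000118000127000000027969 ∷ cel 1 1 9000000024000001000000011013 ∷
         cel 11 2 451000000946306000000000088 ∷ cel 1 2 1001000000000006 ∷
         cel 34 3 42000000013098052111196991000 ∷ cel 1 3 4000000017005016030011030000 ∷
         cel 28 4 255821970000000 ∷ cel 1 4 14008016000000 ∷ cel 939 5 141145000044070119131136177998 ∷
         cel 1 5 214123000679104623010220671208 ∷ fac 4883 2 0 ∷ fac 92932 5 0 ∷
         sqr 2265 6 10004008008011016036010006001000 ∷ sqr 1612 30 25034034033000016001010033034041 ∷
         sqr 1074 13 17010006016025043043019016000002 ∷ sqr 572 30 28026036021034000004031036060038 ∷
         sqr 469 8 12000007009022017038026004010002 ∷ fac 456687 5 2 ∷ []))
       (leaf (ran 1106 8 20 ∷ ran 79 7 20 ∷ ran 42 9 11 ∷ ran 151 6 12 ∷ ran 106 8 13 ∷ ran 21 6 11 ∷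
         ran 57 6 15 ∷ ran 71 5 12 ∷ ran 135 6 14 ∷ cel 1 0 131874 ∷ cel 1 1 901000 ∷
         cel 1 2 76237268280000000000000000 ∷ cel 1 3 44000000000000000000842000207 ∷
         cel 1 4 218475710000000000 ∷ cel 112 5 990000000000000003007017024039043 ∷
         cel 1 5 43000000000000104096011042067104 ∷ fac 721023 5 5 ∷
         sqr 8287 1 1001001001002002005002001000000 ∷ fac 71 3 0 ∷ [])))))))

-- The given fact is the bound of two vertices above t / 2, which is where cell 12 begins. The proof
-- is an evaluation of the Boolean check.
refutationA : Check.Refutation 24 12 13 (atMost 12 12 2 ∷ [])
refutationA = record { tree = treeA ; valid = refl }

-- A value above 13t/24 leaves at most three vertices above 11t/24; as before, at most two are above
-- t / 2.
refutationB : Check.Refutation 24 13 14 (atMost 11 13 3 ∷ atMost 12 13 2 ∷ [])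
refutationB = record { tree = treeB ; valid = refl }

-- A value above 14t/24 leaves at most three vertices above 10t/24. They share one cell whose upper
-- end is the trivial bound t.
refutationC : Check.Refutation 24 10 24 (atMost 10 10 3 ∷ [])
refutationC = record { tree = treeC ; valid = refl }

-- Case distinction on the largest value

module Contradiction {m : ℕ} (40≤m : 40 ≤ m) (x : Fin (suc m) → ℕ) (t : ℕ) (2t≡ : 2 * t ≡ suc m * suc m + suc m)
  (sum≥1 : ∀ {u v} → u ≢ v → ¬ Near u v → 1 ≤ x u + x v)
  (sum≤t : ∀ {u v} → u ≢ v → ¬ Near u v → x u + x v ≤ t)
  (sum-injective : ∀ {u v u′ v′} → u ≢ v → ¬ Near u v → u′ ≢ v′ → ¬ Near u′ v′ →
                   x u + x v ≡ x u′ + x v′ → (u ≡ u′ × v ≡ v′) ⊎ (u ≡ v′ × v ≡ u′))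
  where

  open System 40≤m x t 2t≡ sum≥1 sum≤t sum-injective

  below-13 : ¬ (∀ u → 24 * x u ≤ 13 * t)
  below-13 ≤13 = refute (holds-2 11 12 ℕ.≤-refl ∷ []) refutationA
    where open Case 24 12 13 ≤13

  -- The side conditions hold with equality: 13 + 11 = 24 for the neighbours of `M`, and 2 · 12 = 24
  -- for the values above t / 2.
  below-14 : (∀ u → 24 * x u ≤ 14 * t) → ∀ M → ¬ (13 * t < 24 * x M)
  below-14 ≤14 M 13< = refute (holds-3 M 13 10 13 13< ℕ.≤-refl ∷ holds-2 11 13 ℕ.≤-refl ∷ []) refutationB
    where open Case 24 13 14 ≤14

  above-14 : ∀ M → ¬ (14 * t < 24 * x M)
  above-14 M 14< = refute (holds-3 M 14 9 10 14< ℕ.≤-refl ∷ []) refutationC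
    where open Case 24 10 24 (λ u → ℕ.*-monoʳ-≤ 24 (x≤t u))

  contradiction : ⊥
  -- No value exceeds 14t/24 by `above-14`; hence none exceeds 13t/24 by `below-14`; and this is
  -- what `below-13` refutes.
  contradiction = below-13 λ M → ℕ.≮⇒≥ (below-14 (λ u → ℕ.≮⇒≥ (above-14 u)) M)

𝓔⊆5⋯40 : 𝓔 ⊆ ⟦ 5 ⋯ 40 ⟧
𝓔⊆5⋯40 (s≤s (s≤s (s≤s (s≤s (s≤s (z≤n {k}))))) , leech) = s≤s (s≤s (s≤s (s≤s (s≤s z≤n)))) , ℕ.≮⇒≥ λ 40<n →
  -- The wheel has n = 5 + k vertices and 4 + k of them on the rim. As `length-codes` is stated for
  -- a successor, its argument is 3 + k.
  Contradiction.contradiction (ℕ.≤-pred 40<n) x t (length-codes (3 + k)) sum≥1 sum≤t sum-injective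
  where open Spokes (4 + k) (s≤s (s≤s (s≤s z≤n))) leech

-- Labelings of small wheels

∈-concatMap : ∀ {f : A → List B} {x xs y} → x ∈ xs → y ∈ f x → y ∈ concatMap f xs
∈-concatMap {f = f} x∈ y∈ = ∈-concatMap⁺ f (lose x∈ y∈)

module Enumeration {n : ℕ} (G : Graph n) (diam : Diameter≤2 G) where
  open Graph G
  open Geodesic

  through : ∀ {u v} → u ≢ v → ¬ Adj u v → Fin n → List (Geodesic G)
  through {u} {v} u≢v ¬a w with adj? u w ×-dec adj? w v
  ... | yes (a , b) = [ viaGeodesic G u≢v ¬a a b ]
  ... | no _        = []

  between : Fin n → Fin n → List (Geodesic G)
  between u v with u Fin.≟ v | adj? u v
  ... | yes _  | _      = []
  ... | no _   | yes a  = [ edgeGeodesic G a ]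
  ... | no u≢v | no ¬a  = concatMap (through u≢v ¬a) (allFin n)

  -- Of the two orientations of a geodesic only the one with increasing ends is listed.
  ascending : Fin n → Fin n → List (Geodesic G)
  ascending u v with toℕ u ℕ.<? toℕ v
  ... | yes _ = between u v
  ... | no _  = []

  enumeration : List (Geodesic G)
  enumeration = concatMap (λ u → concatMap (ascending u) (allFin n)) (allFin n)

  Listed : List (Geodesic G) → List (Fin n) → Set
  Listed ps vs = ∃ λ q → q ∈ ps × vertices q ≡ vs

  listed-edge : ∀ {u v} → Adj u v → Listed (between u v) (u ∷ v ∷ [])
  listed-edge {u} {v} a with u Fin.≟ v | adj? u v
  ... | yes e | _     = ⊥-elim (loopless e a)
  ... | no _  | yes b = _ , here refl , refl
  ... | no _  | no ¬b = ⊥-elim (¬b a)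

  listed-through : ∀ {u w v} (u≢v : u ≢ v) (¬c : ¬ Adj u v) → Adj u w → Adj w v →
                   Listed (through u≢v ¬c w) (u ∷ w ∷ v ∷ [])
  listed-through {u} {w} {v} u≢v ¬c a b with adj? u w ×-dec adj? w v
  ... | yes _ = _ , here refl , refl
  ... | no ¬d = ⊥-elim (¬d (a , b))

  listed-via : ∀ {u w v} → u ≢ v → ¬ Adj u v → Adj u w → Adj w v → Listed (between u v) (u ∷ w ∷ v ∷ [])
  listed-via {u} {w} {v} u≢v ¬c a b with u Fin.≟ v | adj? u v
  ... | yes e  | _     = ⊥-elim (u≢v e)
  ... | no _   | yes c = ⊥-elim (¬c c)
  ... | no u≢v | no ¬c with q , q∈ , e ← listed-through u≢v ¬c a b = q , ∈-concatMap (∈-allFin w) q∈ , e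

  listed-ascending : ∀ {u v vs} → toℕ u < toℕ v → Listed (between u v) vs → Listed enumeration vs
  listed-ascending {u} {v} u<v (q , q∈ , e) = q , ∈-concatMap (∈-allFin u) (∈-concatMap {f = ascending u} (∈-allFin v) member) , e
    where
    member : q ∈ ascending u v
    member with toℕ u ℕ.<? toℕ v
    ... | yes _  = q∈
    ... | no u≮v = ⊥-elim (u≮v u<v)

  -- The ends are distinct, so either the path or its reverse has increasing ends; both are
  -- available in the unordered list `between`.
  orient : ∀ {u v} vs → u ≢ v → Listed (between u v) vs → Listed (between v u) (reverse vs) →
           Listed enumeration vs ⊎ Listed enumeration (reverse vs)
  orient {u} {v} vs u≢v f b with ℕ.<-cmp (toℕ u) (toℕ v)
  ... | tri< u<v _ _ = inj₁ (listed-ascending u<v f)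
  ... | tri≈ _ e _   = ⊥-elim (u≢v (Fin.toℕ-injective e))
  ... | tri> _ _ v<u = inj₂ (listed-ascending v<u b)

  listed : ∀ {vs} → Shape G vs → Listed enumeration vs ⊎ Listed enumeration (reverse vs)
  listed (edge a refl) = orient _ (λ e → loopless e a) (listed-edge a) (listed-edge (symmetric a))
  listed (via u≢v ¬c a b refl) = orient _ u≢v (listed-via u≢v ¬c a b)
    (listed-via (λ e → u≢v (sym e)) (λ c → ¬c (symmetric c)) (symmetric b) (symmetric a))

  module _ (f : EdgeLabeling G) where
    open EdgeLabeling f

    weights : List ℕ
    weights = map (λ p → weight (vertices p)) enumeration

    -- The permutation serves twice: it is the Leech property, and it shows that the listed weights
    -- are distinct.
    isGeodesicLeech : weights ↭ map suc (upTo (length enumeration)) → IsGeodesicLeech G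
    isGeodesicLeech perm = f , record { geodesics = enumeration ; complete = complete ; unique = unique } , perm
      where
      complete : ∀ p → Any (_≈ᵍ_ G p) enumeration
      complete p with listed (shape G diam p)
      ... | inj₁ (q , q∈ , e) = lose q∈ (inj₁ (sym e))
      ... | inj₂ (q , q∈ , e) = lose q∈ (inj₂ (trans (sym (reverse-involutive (vertices p))) (cong reverse (sym e))))
      -- Equivalent geodesics have equal weights, so distinct weights exclude repetitions up to
      -- reversal without an inspection of the enumeration.
      unique = AllPairs.map (λ {p} {q} w≢ p≈q → w≢ (weight-≈ G diam f p q p≈q))
        (AllPairs.map⁻ (Unique-resp-↭ (setoid ℕ) (↭⇒↭ₛ (↭-sym perm)) (Unique.map⁺ ℕ.suc-injective (Unique.upTo⁺ _))))

-- The default 1 keeps every label positive, also at positions beyond the list.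
at : List ℕ → ℕ → ℕ
at []       _       = 1
at (k ∷ ks) zero    = k
at (k ∷ ks) (suc i) = at ks i

at-positive : ∀ {ks} → All (1 ≤_) ks → ∀ i → 1 ≤ at ks i
at-positive []       i       = s≤s z≤n
at-positive (p ∷ ps) zero    = p
at-positive (p ∷ ps) (suc i) = at-positive ps i

positive? : (ks : List ℕ) → Dec (All (1 ≤_) ks)
positive? = All.all? (1 ℕ.≤?_)

-- The rim edge at index i joins the rim vertices i and i + 1 (mod m).
module Labels (m : ℕ) (3≤m : 3 ≤ m) (spokes rims : List ℕ)
              {spokes>0 : True (positive? spokes)} {rims>0 : True (positive? rims)} where
  open Wheel m 3≤m

  -- Consecutive positions are joined by the edge with the smaller index. The remaining adjacent
  -- pair is 0, m - 1, whose edge has the larger index. Minimum and maximum make the label symmetric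
  -- by construction.
  rimLabel : ℕ → ℕ → ℕ
  rimLabel i j = if suc (i ⊓ j) ≡ᵇ i ⊔ j then at rims (i ⊓ j) else at rims (i ⊔ j)

  rimLabel-comm : ∀ i j → rimLabel i j ≡ rimLabel j i
  rimLabel-comm i j rewrite ℕ.⊓-comm i j | ℕ.⊔-comm i j = refl

  rimLabel-positive : ∀ i j → 1 ≤ rimLabel i j
  rimLabel-positive i j with suc (i ⊓ j) ≡ᵇ i ⊔ j
  ... | true  = at-positive (toWitness rims>0) (i ⊓ j)
  ... | false = at-positive (toWitness rims>0) (i ⊔ j)

  labelOf : Fin (suc m) → Fin (suc m) → ℕ
  labelOf zero    zero    = 0
  labelOf zero    (suc j) = at spokes (toℕ j)
  labelOf (suc i) zero    = at spokes (toℕ i)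
  labelOf (suc i) (suc j) = rimLabel (toℕ i) (toℕ j)

  labeling : EdgeLabeling G
  labeling = record { label = labelOf ; undirected = undirected ; positive = positive }
    where
    undirected : ∀ {u v} → WheelAdj u v → labelOf u v ≡ labelOf v u
    undirected hub-rim         = refl
    undirected rim-hub         = refl
    undirected (rim-rim {i} {j} _) = rimLabel-comm (toℕ i) (toℕ j)
    positive : ∀ {u v} → WheelAdj u v → 1 ≤ labelOf u v
    positive (hub-rim {i})     = at-positive (toWitness spokes>0) (toℕ i)
    positive (rim-hub {i})     = at-positive (toWitness spokes>0) (toℕ i)
    positive (rim-rim {i} {j} _) = rimLabel-positive (toℕ i) (toℕ j)

  open Enumeration G diam using (enumeration; weights; isGeodesicLeech)

  -- Sorting reduces equality of multisets to equality of lists, which for concrete labels is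
  -- settled by evaluation.
  leech-by-sorting : sort (weights labeling) ≡ map suc (upTo (length enumeration)) → IsGeodesicLeech G
  leech-by-sorting e = isGeodesicLeech labeling (↭-trans (↭-sym (sort-↭ (weights labeling))) (↭-reflexive e))

𝓔-5⋯13 : ⟦ 5 ⋯ 13 ⟧ ⊆ 𝓔
𝓔-5⋯13 {n} (5≤n , n≤13) with k , refl ← ℕ.m≤n⇒∃[o]m+o≡n 5≤n = 5≤n′ k , labelled k (ℕ.+-cancelˡ-≤ 5 k 8 n≤13)
  where
  3≤m : ∀ k → 3 ≤ 4 ℕ.+ k
  3≤m k = s≤s (s≤s (s≤s z≤n))
  5≤n′ : ∀ k → 5 ≤ 5 ℕ.+ k
  5≤n′ k = s≤s (s≤s (s≤s (s≤s (s≤s z≤n))))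
  labelled : ∀ k → k ≤ 8 → IsGeodesicLeech (W (5 ℕ.+ k) (ℕ.<⇒≤ (5≤n′ k)))
  -- In each case the upper list holds the spoke labels in cyclic order and the lower list the rim
  -- labels. The enumeration, the weights and the sorting are all computed by `refl`.
  labelled 0 _ = Labels.leech-by-sorting 4 (3≤m 0)
    (1 ∷ 2 ∷ 5 ∷ 7 ∷ [])
    (3 ∷ 8 ∷ 4 ∷ 10 ∷ []) refl
  labelled 1 _ = Labels.leech-by-sorting 5 (3≤m 1)
    (7 ∷ 13 ∷ 8 ∷ 3 ∷ 4 ∷ [])
    (1 ∷ 5 ∷ 9 ∷ 2 ∷ 18 ∷ []) refl
  labelled 2 _ = Labels.leech-by-sorting 6 (3≤m 2)
    (1 ∷ 2 ∷ 20 ∷ 12 ∷ 3 ∷ 7 ∷ [])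
    (6 ∷ 11 ∷ 15 ∷ 10 ∷ 8 ∷ 16 ∷ []) refl
  labelled 3 _ = Labels.leech-by-sorting 7 (3≤m 3)
    (3 ∷ 22 ∷ 18 ∷ 5 ∷ 13 ∷ 7 ∷ 1 ∷ [])
    (2 ∷ 15 ∷ 11 ∷ 9 ∷ 24 ∷ 4 ∷ 30 ∷ []) refl
  labelled 4 _ = Labels.leech-by-sorting 8 (3≤m 4)
    (10 ∷ 31 ∷ 29 ∷ 7 ∷ 5 ∷ 12 ∷ 4 ∷ 1 ∷ [])
    (2 ∷ 18 ∷ 24 ∷ 16 ∷ 21 ∷ 23 ∷ 3 ∷ 25 ∷ []) refl
  labelled 5 _ = Labels.leech-by-sorting 9 (3≤m 5)
    (35 ∷ 1 ∷ 15 ∷ 2 ∷ 16 ∷ 11 ∷ 4 ∷ 7 ∷ 32 ∷ [])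
    (10 ∷ 28 ∷ 21 ∷ 24 ∷ 29 ∷ 25 ∷ 27 ∷ 14 ∷ 30 ∷ []) refl
  labelled 6 _ = Labels.leech-by-sorting 10 (3≤m 6)
    (44 ∷ 33 ∷ 7 ∷ 19 ∷ 9 ∷ 17 ∷ 4 ∷ 21 ∷ 1 ∷ 22 ∷ [])
    (2 ∷ 25 ∷ 32 ∷ 14 ∷ 35 ∷ 12 ∷ 3 ∷ 56 ∷ 6 ∷ 58 ∷ []) refl
  labelled 7 _ = Labels.leech-by-sorting 11 (3≤m 7)
    (37 ∷ 28 ∷ 11 ∷ 38 ∷ 6 ∷ 33 ∷ 21 ∷ 18 ∷ 39 ∷ 36 ∷ 2 ∷ [])
    (1 ∷ 52 ∷ 16 ∷ 15 ∷ 10 ∷ 4 ∷ 5 ∷ 7 ∷ 19 ∷ 3 ∷ 62 ∷ []) refl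
  labelled 8 _ = Labels.leech-by-sorting 12 (3≤m 8)
    (42 ∷ 3 ∷ 43 ∷ 46 ∷ 21 ∷ 25 ∷ 10 ∷ 36 ∷ 16 ∷ 30 ∷ 44 ∷ 2 ∷ [])
    (1 ∷ 34 ∷ 50 ∷ 20 ∷ 9 ∷ 8 ∷ 6 ∷ 77 ∷ 4 ∷ 7 ∷ 15 ∷ 74 ∷ []) refl
  -- Here k ≥ 9, that is n ≥ 14, against the bound n ≤ 13.
  labelled (suc (suc (suc (suc (suc (suc (suc (suc (suc k))))))))) k≤8 =
    ⊥-elim (ℕ.<⇒≱ (ℕ.m≤m+n 9 k) k≤8)

corollary1p2 : (⟦ 5 ⋯ 13 ⟧ ⊆ 𝓔) × (𝓔 ⊆ ⟦ 5 ⋯ 40 ⟧)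
corollary1p2 = 𝓔-5⋯13 , 𝓔⊆5⋯40
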